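{- In the bipartite agent–item setting described in the context, let $\mathcal{F}_{A,E}=(E,\mathcal{I}_A)$ be the combination of the systems $(E_{A,j},\mathcal{I}_{A,j})$, $j\in[M_A]$, where each $(E_{A,j},\mathcal{I}_{A,j})$ is a $k_j$-growth system, and let $\mathcal{F}_{B,E}=(E,\mathcal{I}_B)$ be the combination of the systems $(E_{B,j},\mathcal{I}_{B,j})$, $j\in[M_B]$, where each $(E_{B,j},\mathcal{I}_{B,j})$ is an $\ell_j$-growth system. Let $\mathcal{F}=(E,\mathcal{I})$ with $\mathcal{I}=\mathcal{I}_A\cap\mathcal{I}_B$, and $$\mathrm{Core}(X)=\bigcap_{j=1}^{M_A}\big((X\setminus E_{A,j})\cup\mathrm{PCore}_{j,A}(X\cap E_{A,j})\big)\cap\bigcap_{j=1}^{M_B}\big((X\setminus E_{B,j})\cup\mathrm{PCore}_{j,B}(X\cap E_{B,j})\big)$$ for $X\subseteq E$, where $\mathrm{PCore}_{j,A}$ and $\mathrm{PCore}_{j,B}$ are the primitive core functions of $(E_{A,j},\mathcal{I}_{A,j})$ and $(E_{B,j},\mathcal{I}_{B,j})$. Let $k=\max_{e\in E}\big(\sum_{j:\,e\in E_{A,j}}k_j+\sum_{j:\,e\in E_{B,j}}\ell_j\big)$, and let $Y=Y(p)\subseteq A$ be a random set containing each agent independently with probability $p\in[0,1]$. Then, for $p=\sqrt{1-\frac{1}{k+1}}$, $$\mathbb{E}\big[w(\mathrm{Core}(\mathrm{Rel}(Y)))\big]\ \ge\ \Big(2+\frac1k-2\sqrt{1+\frac1k}\Big)\,w(\mathrm{OPT}(E)),\qquad\text{where}\quad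 2+\frac1k-2\sqrt{1+\frac1k}\;>\;\frac{1}{4k^2}-\frac{1}{8k^3}.$$ Furthermore, if all components are matroids (i.e. $\mathcal{F}$ is a $k$-matchoid, with all $k_j=\ell_j=1$), setting $p=0$ for $k=1$ and $p=1-1/(2k)$ for $k\ge2$ yields $$\mathbb{E}\big[w(\mathrm{Core}(\mathrm{Rel}(Y)))\big]\ \ge\ \begin{cases} w(\mathrm{OPT}(E)) & \text{if }k=1,\\ \frac{1}{4k^2}\,w(\mathrm{OPT}(E)) & \text{if }k\ge2.\end{cases}$$
   Context: An independence system $(S,\mathcal{I})$ is a finite set $S$ with a nonempty downward-closed family $\mathcal{I}\subseteq 2^S$ of independent sets; circuits are minimal non-independent sets; a basis of $X\subseteq S$ is a maximal independent subset of $X$. The combination of $(S_j,\mathcal{I}_j)$, $j\in[M]$, is $(S,\mathcal{I})$ with $S=\bigcup_jS_j$, $\mathcal{I}=\{I\subseteq S: I\cap S_j\in\mathcal{I}_j\ \forall j\}$. $(S,\mathcal{I})$ is a $k$-growth system ($k$ a positive integer) if for all $X\subseteq S$, $I\in\mathcal{I}$ there is a partition $(Q,Z)$ of $I\setminus X$ with $|Z|\le k|X\setminus I|$ such that $P\cup Q\in\mathcal{I}$ for every basis $P$ of $X$. (The 1-growth systems are exactly matroids.) Write $X+e=X\cup\{e\}$, $w(X)=\sum_{x\in X}w(x)$. Setting: $G=(A\cup B,E)$ is a finite bipartite graph (agents $A$, items $B$), $w:E\to\mathbb{R}_{\ge0}$ is injective, and $\delta(v)$, $\delta(Y)$ denote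 the sets of edges incident to a vertex $v$, resp. to a vertex set $Y\subseteq A$. The agent-side constraint is a combination $\mathcal{F}_A$ on $A$ of systems $(A_j,\mathcal{J}_j)$, $j\in[M_A]$, and the item-side constraint is a combination $\mathcal{F}_B$ on $B$ of systems $(B_j,\mathcal{L}_j)$, $j\in[M_B]$ (so $A=\bigcup_jA_j$, $B=\bigcup_jB_j$). They are transferred to edges, treating all edges at the same agent (resp. item) as parallel copies: $E_{A,j}$ is the set of edges incident to $A_j$, and $\mathcal{I}_{A,j}$ consists of the sets $X\subseteq E_{A,j}$ such that each agent is incident to at most one edge of $X$ and the set of agents incident to $X$ belongs to $\mathcal{J}_j$; likewise $E_{B,j}$ is the set of edges incident to $B_j$, and $\mathcal{I}_{B,j}$ consists of the $X\subseteq E_{B,j}$ such that each item is incident to at most one edge of $X$ and the set of items incident to $X$ belongs to $\mathcal{L}_j$. $\mathrm{OPT}(E)$ is a maximum-weight set in $\mathcal{I}$. Primitive hull and core of an independence system $(S,\mathcal{I})$: $\mathrm{PHull}(X)=X\cup\{e\in S:e\text{ belongs to some circuit contained in }X+e\}$ and $\mathrm{PCore}(X)=\{e\in X:e\notin\mathrm{PHull}(\{f\in X:w(f)>w(e)\})\}$. $\mathrm{Greedy}(X)$ for $X\subseteq E$: process the edges of $X$ in decreasing order of $w$, starting from $\emptyset$, adding an edge whenever the current set stays in $\mathcal{I}$; $\mathrm{Greedy}(X)$ is the final set. An edge $e\notin X$ is greedy-relevant with respect to $X$ if $e\in\mathrm{Greedy}(X+e)$. For $Y\subseteq A$ and $a\in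 A\setminus Y$, the top-relevant edge of $a$ is the heaviest edge in $\delta(a)$ that is greedy-relevant with respect to $\delta(Y)$ (if any exists). $\mathrm{Rel}(Y)\subseteq E$ is the set of top-relevant edges of all agents $a\in A\setminus Y$ having one. -}

module Defs where

open import Algebra.Bundles using (CommutativeRing; Semiring)
import Algebra.Definitions.RawMonoid as RawMonoidDefs
import Algebra.Definitions.RawSemiring as RawSemiringDefs
open import Data.Bool.Base using (if_then_else_)
open import Data.Fin.Base using (Fin)
open import Data.Fin.Properties using (_≟_; any?; all?)
open import Data.Fin.Subset
  using (Subset; inside; outside; _∈_; _∉_; _⊆_; _⊂_; _∪_; _∩_; _─_; ∁; ⋃; ⋂; ⁅_⁆; ∣_∣)
  renaming (⊥ to ∅; ⊤ to full)
open import Data.Fin.Subset.Properties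
  using (_∈?_; _⊆?_; _⊂?_; anySubset?; ∉⊥; ⊥⊆; ⊆-trans; x∈p∩q⁺; x∈p∩q⁻; p∩q⊆p)
open import Data.List.Base as List using (foldl; filter; allFin)
import Data.List.Sort as Sort
open import Data.Nat.Base as ℕ using (ℕ; zero; suc)
open import Data.Product.Base using (∃; ∃-syntax; _×_; _,_; proj₁; proj₂)
open import Data.Vec.Base as Vec using ([]; _∷_)
open import Data.Vec.Properties using (lookup∘tabulate; []=⇒lookup; lookup⇒[]=)
import Data.Vec.Functional as Vector
open import Function.Base using (_∘_)
open import Level using (0ℓ) renaming (suc to lsuc; _⊔_ to _⊔ˡ_)
open import Relation.Binary.Bundles using (DecTotalOrder)
import Relation.Binary.Construct.Flip.EqAndOrd as Flip
import Relation.Binary.Construct.On as On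
open import Relation.Binary.PropositionalEquality using (_≡_; sym; trans)
open import Relation.Binary.Structures using (IsDecTotalOrder)
open import Relation.Nullary using (¬_; Dec; yes; no; does)
open import Relation.Nullary.Decidable using (¬?; _×-dec_; _→-dec_; dec-true)
open import Relation.Unary using (Pred; Decidable)

private
  variable
    m n : ℕ

-- The library has no real numbers.  The results only use the
-- ordered-field structure of ℝ and square roots of nonnegative numbers,
-- so they are stated over every ordered field with such square roots.
-- _⁻¹ and √ are total; their values outside the domains of ⁻¹-inverse
-- and of the √ laws are unspecified.

record EuclideanField c ℓ₁ ℓ₂ : Set (lsuc (c ⊔ˡ ℓ₁ ⊔ˡ ℓ₂)) where
  field
    commutativeRing : CommutativeRing c ℓ₁
  open CommutativeRing commutativeRing public
  infix  4 _≤_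
  infix  8 _⁻¹
  field
    _≤_             : Carrier → Carrier → Set ℓ₂
    isDecTotalOrder : IsDecTotalOrder _≈_ _≤_
    +-monoʳ-≤       : ∀ x {y z} → y ≤ z → x + y ≤ x + z
    *-nonneg        : ∀ {x y} → 0# ≤ x → 0# ≤ y → 0# ≤ x * y
    0≉1             : ¬ (0# ≈ 1#)
    _⁻¹             : Carrier → Carrier
    ⁻¹-inverse      : ∀ x → ¬ (x ≈ 0#) → x * x ⁻¹ ≈ 1#
    √               : Carrier → Carrier
    √-nonneg        : ∀ x → 0# ≤ x → 0# ≤ √ x
    √-square        : ∀ x → 0# ≤ x → √ x * √ x ≈ x

  decTotalOrder : DecTotalOrder c ℓ₁ ℓ₂
  decTotalOrder = record { isDecTotalOrder = isDecTotalOrder }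

  open IsDecTotalOrder isDecTotalOrder public using (_≤?_) renaming (_≟_ to _≈?_)

  infix 4 _<_ _<?_
  _<_ : Carrier → Carrier → Set (ℓ₁ ⊔ˡ ℓ₂)
  x < y = x ≤ y × ¬ (x ≈ y)

  _<?_ : ∀ x y → Dec (x < y)
  x <? y = (x ≤? y) ×-dec ¬? (x ≈? y)

  open RawMonoidDefs +-rawMonoid public using (sum)
  open RawSemiringDefs (Semiring.rawSemiring semiring) public using (_^_)

  fromℕ : ℕ → Carrier
  fromℕ k = RawMonoidDefs._×_ +-rawMonoid k 1#

  1/_ : ℕ → Carrier
  1/ k = fromℕ k ⁻¹

module _ {p} {P : Pred (Fin n) p} where

  ⟦_⟧ : Decidable P → Subset n
  ⟦ P? ⟧ = Vec.tabulate (does ∘ P?)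

  ∈⟦⟧⁺ : (P? : Decidable P) → ∀ {x} → P x → x ∈ ⟦ P? ⟧
  ∈⟦⟧⁺ P? {x} px = lookup⇒[]= x _ (trans (lookup∘tabulate _ x) (dec-true (P? x) px))

  ∈⟦⟧⁻ : (P? : Decidable P) → ∀ {x} → x ∈ ⟦ P? ⟧ → P x
  ∈⟦⟧⁻ P? {x} x∈ with P? x | trans (sym (lookup∘tabulate (does ∘ P?) x)) ([]=⇒lookup x∈)
  ... | yes px | _ = px
  ... | no  _  | ()

-- The ground set is a subset of Fin n, so that systems on different
-- parts of a common finite set can be combined.

record IndependenceSystem (n : ℕ) : Set₁ where
  field
    ground          : Subset n
    Indep           : Pred (Subset n) 0ℓ
    Indep?          : Decidable Indep
    indep⊆ground    : ∀ {I} → Indep I → I ⊆ ground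
    nonempty        : ∃ Indep
    downward-closed : ∀ {I J} → J ⊆ I → Indep I → Indep J

module _ (𝓢 : IndependenceSystem n) where
  open IndependenceSystem 𝓢

  IsBasisOf : Subset n → Subset n → Set
  IsBasisOf X P = Indep P × P ⊆ X × (∀ {I} → Indep I → I ⊆ X → P ⊆ I → I ⊆ P)

  IsCircuit : Subset n → Set
  IsCircuit C = C ⊆ ground × ¬ Indep C × ¬ (∃[ D ] (D ⊂ C × ¬ Indep D))

  isCircuit? : Decidable IsCircuit
  isCircuit? C = (C ⊆? ground) ×-dec ¬? (Indep? C)
    ×-dec ¬? (anySubset? λ D → (D ⊂? C) ×-dec ¬? (Indep? D))

  record IsGrowthSystem (k : ℕ) : Set where
    field
      positive : k ℕ.> 0
      growth   : ∀ X I → X ⊆ ground → Indep I →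
                 ∃[ Q ] ∃[ Z ] (Q ∪ Z ≡ I ─ X × Q ∩ Z ≡ ∅
                   × ∣ Z ∣ ℕ.≤ k ℕ.* ∣ X ─ I ∣
                   × (∀ P → IsBasisOf X P → Indep (P ∪ Q)))

  IsMatroid : Set
  IsMatroid = ∀ I J → Indep I → Indep J → ∣ I ∣ ℕ.< ∣ J ∣ →
              ∃[ e ] (e ∈ J × e ∉ I × Indep (I ∪ ⁅ e ⁆))

  PHull : Subset n → Subset n
  PHull X = X ∪ ⟦ (λ e → (e ∈? ground) ×-dec
    anySubset? λ C → isCircuit? C ×-dec (C ⊆? X ∪ ⁅ e ⁆) ×-dec (e ∈? C)) ⟧

module _ where
  open IndependenceSystem

  combination : ∀ {M} → (Fin M → IndependenceSystem n) → IndependenceSystem n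
  combination {n} {M} 𝓢 = record
    { ground          = S
    ; Indep           = λ I → I ⊆ S × (∀ j → Indep (𝓢 j) (I ∩ ground (𝓢 j)))
    ; Indep?          = λ I → (I ⊆? S) ×-dec all? (λ j → Indep? (𝓢 j) (I ∩ ground (𝓢 j)))
    ; indep⊆ground    = proj₁
    ; nonempty        = ∅ , ⊥⊆ , λ j →
        downward-closed (𝓢 j) (⊆-trans (p∩q⊆p ∅ _) ⊥⊆) (proj₂ (nonempty (𝓢 j)))
    ; downward-closed = λ {I} {J} J⊆I (I⊆S , ind) → ⊆-trans J⊆I I⊆S , λ j →
        downward-closed (𝓢 j)
          (λ x∈ → let x∈J , x∈S = x∈p∩q⁻ J _ x∈ in x∈p∩q⁺ (J⊆I x∈J , x∈S)) (ind j)
    }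
    where
    S : Subset n
    S = ⋃ (List.tabulate (ground ∘ 𝓢))

  intersection : (𝓢 𝓣 : IndependenceSystem n) → IndependenceSystem n
  intersection 𝓢 𝓣 = record
    { ground          = ground 𝓢 ∩ ground 𝓣
    ; Indep           = λ I → Indep 𝓢 I × Indep 𝓣 I
    ; Indep?          = λ I → Indep? 𝓢 I ×-dec Indep? 𝓣 I
    ; indep⊆ground    = λ (s , t) x∈ → x∈p∩q⁺ (indep⊆ground 𝓢 s x∈ , indep⊆ground 𝓣 t x∈)
    ; nonempty        = ∅
        , downward-closed 𝓢 ⊥⊆ (proj₂ (nonempty 𝓢))
        , downward-closed 𝓣 ⊥⊆ (proj₂ (nonempty 𝓣))
    ; downward-closed = λ J⊆I (s , t) → downward-closed 𝓢 J⊆I s , downward-closed 𝓣 J⊆I t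
    }

  image : (Fin m → Fin n) → Subset m → Subset n
  image f X = ⟦ (λ v → any? λ e → (e ∈? X) ×-dec (f e ≟ v)) ⟧

  -- Pulls a system on vertices back to edges along the map sending an edge
  -- to its endpoint; edges with the same endpoint become parallel.
  transfer : (Fin m → Fin n) → IndependenceSystem n → IndependenceSystem m
  transfer {m} end 𝓢 = record
    { ground          = G
    ; Indep           = λ X → X ⊆ G × AtMostOne X × Indep 𝓢 (image end X)
    ; Indep?          = λ X → (X ⊆? G) ×-dec atMostOne? X ×-dec Indep? 𝓢 (image end X)
    ; indep⊆ground    = proj₁
    ; nonempty        = ∅ , ⊥⊆ , (λ e f e∈ → λ _ _ → noElem e∈)
        , downward-closed 𝓢 image∅⊆ (proj₂ (nonempty 𝓢))
    ; downward-closed = λ {I} {J} J⊆I (I⊆G , one , ind) →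
        ⊆-trans J⊆I I⊆G
        , (λ e f e∈ f∈ → one e f (J⊆I e∈) (J⊆I f∈))
        , downward-closed 𝓢
            (λ {v} v∈ → let e , e∈J , eq = ∈⟦⟧⁻ (imageOf? J) v∈
                        in ∈⟦⟧⁺ (imageOf? I) {v} (e , J⊆I e∈J , eq)) ind
    }
    where
    G : Subset m
    G = ⟦ (λ e → end e ∈? ground 𝓢) ⟧

    AtMostOne : Pred (Subset m) 0ℓ
    AtMostOne X = ∀ e f → e ∈ X → f ∈ X → end e ≡ end f → e ≡ f

    atMostOne? : Decidable AtMostOne
    atMostOne? X = all? λ e → all? λ f →
      (e ∈? X) →-dec ((f ∈? X) →-dec ((end e ≟ end f) →-dec (e ≟ f)))

    imageOf? : (X : Subset m) → Decidable (λ v → ∃[ e ] (e ∈ X × end e ≡ v))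
    imageOf? X v = any? λ e → (e ∈? X) ×-dec (end e ≟ v)

    noElem : ∀ {e} {A : Set} → e ∈ ∅ → A
    noElem e∈ with () ← ∉⊥ e∈

    image∅⊆ : ∀ {I} → image end ∅ ⊆ I
    image∅⊆ v∈ = noElem (proj₁ (proj₂ (∈⟦⟧⁻ (imageOf? ∅) v∈)))

module Weighted {c ℓ₁ ℓ₂} (R : EuclideanField c ℓ₁ ℓ₂) where
  open EuclideanField R

  weight : (Fin n → Carrier) → Subset n → Carrier
  weight w X = sum λ e → if does (e ∈? X) then w e else 0#

  IsMaxWeight : (Fin n → Carrier) → IndependenceSystem n → Subset n → Set _
  IsMaxWeight w 𝓢 O = Indep O × (∀ I → Indep I → weight w I ≤ weight w O)
    where open IndependenceSystem 𝓢

  PCore : (Fin n → Carrier) → IndependenceSystem n → Subset n → Subset n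
  PCore w 𝓢 X = ⟦ (λ e → (e ∈? X) ×-dec
    ¬? (e ∈? PHull 𝓢 ⟦ (λ f → (f ∈? X) ×-dec (w e <? w f)) ⟧)) ⟧

  -- e comes before f when w f ≤ w e
  decreasing : (Fin n → Carrier) → DecTotalOrder _ _ _
  decreasing w = On.decTotalOrder (Flip.decTotalOrder decTotalOrder) w

  greedyStep : IndependenceSystem n → Subset n → Fin n → Subset n
  greedyStep 𝓢 I e = if does (Indep? (I ∪ ⁅ e ⁆)) then I ∪ ⁅ e ⁆ else I
    where open IndependenceSystem 𝓢

  Greedy : (Fin n → Carrier) → IndependenceSystem n → Subset n → Subset n
  Greedy {n} w 𝓢 X = foldl (greedyStep 𝓢) ∅ (filter (_∈? X) (Sort.sort (decreasing w) (allFin n)))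

  sumSubsets : ∀ n → (Subset n → Carrier) → Carrier
  sumSubsets zero    f = f []
  sumSubsets (suc n) f = sumSubsets n (f ∘ (inside ∷_)) + sumSubsets n (f ∘ (outside ∷_))

  -- The expectation of f Y, for Y ⊆ Fin n containing each element
  -- independently with probability p.
  𝔼 : Carrier → (Subset n → Carrier) → Carrier
  𝔼 {n} p f = sumSubsets n λ Y → (p ^ ∣ Y ∣ * (1# - p) ^ ∣ ∁ Y ∣) * f Y

record Setting {c ℓ₁ ℓ₂} (R : EuclideanField c ℓ₁ ℓ₂) : Set (lsuc 0ℓ ⊔ˡ c ⊔ˡ ℓ₁ ⊔ˡ ℓ₂) where
  open EuclideanField R using (Carrier; _≈_; _≤_; _≤?_; 0#)
  open Weighted R
  open IndependenceSystem

  field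
    #A #B #E : ℕ
    agent    : Fin #E → Fin #A
    item     : Fin #E → Fin #B
    simple   : ∀ {e f} → agent e ≡ agent f → item e ≡ item f → e ≡ f

    w           : Fin #E → Carrier
    w-nonneg    : ∀ e → 0# ≤ w e
    w-injective : ∀ {e f} → w e ≈ w f → e ≡ f

    M-A M-B : ℕ
    𝓙       : Fin M-A → IndependenceSystem #A
    𝓛       : Fin M-B → IndependenceSystem #B
    A-cover : ground (combination 𝓙) ≡ full
    B-cover : ground (combination 𝓛) ≡ full

  𝓘A : Fin M-A → IndependenceSystem #E
  𝓘A j = transfer agent (𝓙 j)

  𝓘B : Fin M-B → IndependenceSystem #E
  𝓘B j = transfer item (𝓛 j)

  𝓕 : IndependenceSystem #E
  𝓕 = intersection (combination 𝓘A) (combination 𝓘B)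

  IsOPT : Subset #E → Set _
  IsOPT = IsMaxWeight w 𝓕

  δ : Subset #A → Subset #E
  δ Y = ⟦ (λ e → agent e ∈? Y) ⟧

  IsRelevant : Subset #E → Fin #E → Set
  IsRelevant X e = e ∉ X × e ∈ Greedy w 𝓕 (X ∪ ⁅ e ⁆)

  isRelevant? : ∀ X → Decidable (IsRelevant X)
  isRelevant? X e = ¬? (e ∈? X) ×-dec (e ∈? Greedy w 𝓕 (X ∪ ⁅ e ⁆))

  IsTopRelevant : Subset #A → Fin #A → Fin #E → Set _
  IsTopRelevant Y a e = agent e ≡ a × IsRelevant (δ Y) e
    × (∀ f → agent f ≡ a × IsRelevant (δ Y) f → w f ≤ w e)

  isTopRelevant? : ∀ Y a → Decidable (IsTopRelevant Y a)
  isTopRelevant? Y a e = (agent e ≟ a) ×-dec isRelevant? (δ Y) e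
    ×-dec all? (λ f → ((agent f ≟ a) ×-dec isRelevant? (δ Y) f) →-dec (w f ≤? w e))

  Rel : Subset #A → Subset #E
  Rel Y = ⟦ (λ e → any? λ a → ¬? (a ∈? Y) ×-dec isTopRelevant? Y a e) ⟧

  corePart : Subset #E → IndependenceSystem #E → Subset #E
  corePart X 𝓢 = (X ─ ground 𝓢) ∪ PCore w 𝓢 (X ∩ ground 𝓢)

  Core : Subset #E → Subset #E
  Core X = ⋂ (List.tabulate (corePart X ∘ 𝓘A)) ∩ ⋂ (List.tabulate (corePart X ∘ 𝓘B))

  expectedCoreWeight : Carrier → Carrier
  expectedCoreWeight p = 𝔼 p λ Y → weight w (Core (Rel Y))

  total : ∀ {M} → (Fin M → IndependenceSystem #E) → (Fin M → ℕ) → Fin #E → ℕ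
  total 𝓢 k e = Vector.foldr ℕ._+_ 0 λ j → if does (e ∈? ground (𝓢 j)) then k j else 0

  -- A maximum over edges, with junk value 0 when there are none.
  maxTotal : (Fin M-A → ℕ) → (Fin M-B → ℕ) → ℕ
  maxTotal k ℓ = Vector.foldr ℕ._⊔_ 0 λ e → total 𝓘A k e ℕ.+ total 𝓘B ℓ e

{-# OPTIONS --safe #-}

-- Write Y⁻ for Y without the agent of an edge e.  Call e top at Y⁻ if it is the
-- heaviest edge of its agent that greedy on δ(Y⁻) would accept.  Greedy on δ(Y)
-- and on δ(Y⁻) agree on all heavier edges, so a top edge e lies in
-- H(Y) = Greedy(δ(Y)) if its agent is in Y and in Rel(Y) otherwise.  Being top
-- does not depend on the coin of the agent, so E w(Rel(Y)) and E w(H(Y)) are in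
-- ratio 1-p : p, and greedy is a k-approximation, whence
-- k E w(Rel(Y)) ≥ (1-p) w(OPT).
--
-- The same coin decides whether a top edge e in the hull of the heavier edges
-- of Rel(Y) ∩ E_j enters H(Y) or enters Rel(Y) and is lost from the core.  For
-- fixed Y the former edges form a subset of an independent set inside the hull
-- of Rel(Y) ∩ E_j, and the growth property bounds their number by
-- k_j |Rel(Y) ∩ E_j|, on every heavy prefix and hence in weight.  So
-- p E w(lost) ≤ (1-p) k E w(Rel(Y)).  In a matroid these edges and the lost
-- ones together number at most |Rel(Y) ∩ E_j|, which gives
-- E w(lost) ≤ (1-p) k E w(Rel(Y)).

module Submission where

open import Defs
import Algebra.Properties.Group
import Algebra.Properties.Ring
import Algebra.Properties.Semiring.Mult
import Algebra.Properties.Semiring.Sum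
import Algebra.Solver.Ring.NaturalCoefficients.Default
open import Data.Bool.Base using (true; false; if_then_else_)
open import Data.Empty using (⊥-elim)
open import Data.Fin.Base using (Fin; zero; suc)
open import Data.Fin.Induction using (spo-wellFounded; spo-noetherian)
open import Data.Fin.Properties using (any?; all?; _≟_)
open import Data.Fin.Subset
  using (Subset; inside; outside; _∈_; _∉_; _⊆_; _⊂_; _⊃_; _∪_; _∩_; _─_; ⁅_⁆; ∣_∣; ∁; ⋂; ⋃)
  renaming (⊥ to ∅; _-_ to _∖_)
open import Data.Fin.Subset.Induction using (⊂-wellFounded; ⊃-wellFounded)
open import Data.Fin.Subset.Properties
open import Data.List.Base as List using (List; []; _∷_; allFin; filter; foldl)
open import Data.List.Membership.Propositional using () renaming (_∈_ to _∈ₗ_)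
open import Data.List.Membership.Propositional.Properties using (∈-allFin; ∈-filter⁺; ∈-filter⁻)
open import Data.List.Relation.Binary.Permutation.Propositional as Perm using (_↭_; ↭-sym; ↭⇒↭ₛ)
open import Data.List.Relation.Binary.Permutation.Propositional.Properties using (∈-resp-↭)
import Data.List.Relation.Binary.Permutation.Setoid.Properties as PermSetoid
open import Data.List.Relation.Unary.All as All using (All; []; _∷_)
open import Data.List.Relation.Unary.AllPairs as AllPairs using (AllPairs; []; _∷_)
import Data.List.Relation.Unary.AllPairs.Properties as AllPairs
open import Data.List.Relation.Unary.Any using (here; there)
import Data.List.Relation.Unary.Sorted.TotalOrder.Properties as Sorted
open import Data.List.Relation.Unary.Unique.Propositional.Properties using (allFin⁺)
import Data.List.Sort as Sort
open import Data.Nat.Base as ℕ using (ℕ; zero; suc; NonZero)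
import Data.Nat.Properties as ℕ
import Data.Nat.Solver
open import Data.Product.Base using (∃-syntax; _×_; _,_; proj₁; proj₂)
open import Data.Sum.Base using (_⊎_; inj₁; inj₂; [_,_]′)
open import Data.Vec.Base using ([]; _∷_; _[_]≔_; here; there)
import Data.Vec.Functional as Vector
open import Function.Base using (_∘_; id; const)
open import Induction.WellFounded using (WellFounded; Acc; acc)
open import Relation.Binary.Bundles using (DecTotalOrder)
import Relation.Binary.Construct.NonStrictToStrict as NonStrictToStrict
open import Relation.Binary.PropositionalEquality as ≡ using (_≡_; _≢_)
import Relation.Binary.Reasoning.PartialOrder
open import Relation.Binary.Structures using (IsDecTotalOrder; IsStrictPartialOrder)
open import Relation.Nullary using (¬_; Dec; yes; no; does)
open import Relation.Nullary.Decidable using (¬?; _×-dec_; _→-dec_; decidable-stable; dec-true; dec-false)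

-- Finite sets and independence systems

-- Write q for 1 - p. The two estimates multiply to (q/k)(1 - qk/p) for growth systems and (q/k)(1 -
-- qk) for matroids; each stated p maximises its product, apart from the case `k ≡ 1`. The obstacle
-- is that Rel(Y) itself depends on the coin of the agent of e, so "e is lost" is not independent of
-- that coin. The event is therefore evaluated at Y⁻ and must be carried back to Y when the agent is
-- in Y. This works because the coin is invisible above a top edge: heavier edges of Rel(Y⁻) remain
-- in Rel(Y), and hulls grow with their argument. One counting fact drives both the loss bound and
-- the greedy ratio: few elements of an independent set lie in the hull of X. For greedy with output
-- G, an element of OPT that is rejected lies in the hull of the heavier part of G in some
-- component. Charging only G outside OPT keeps the ratio at k instead of k + 1.

private
  variable
    n : ℕ

module _ where
  private
    variable
      p q : Subset n
      x y : Fin n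

  x∈p─q⇒x∉q : x ∈ p ─ q → x ∉ q
  x∈p─q⇒x∉q {p = _ ∷ p} {inside ∷ q} () here
  x∈p─q⇒x∉q {p = _ ∷ p} {_ ∷ q} (there x∈) (there x∈q) = x∈p─q⇒x∉q {p = p} x∈ x∈q

  x∈p∪⁅y⁆⁻ : ∀ (p : Subset n) → x ∈ p ∪ ⁅ y ⁆ → x ∈ p ⊎ x ≡ y
  x∈p∪⁅y⁆⁻ {y = y} p x∈ with x∈p∪q⁻ p ⁅ y ⁆ x∈
  ... | inj₁ x∈p = inj₁ x∈p
  ... | inj₂ x∈y = inj₂ (x∈⁅y⁆⇒x≡y y x∈y)

  y∈p∪⁅y⁆ : ∀ (p : Subset n) y → y ∈ p ∪ ⁅ y ⁆
  y∈p∪⁅y⁆ p y = x∈p∪q⁺ (inj₂ (x∈⁅x⁆ y))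

  ∪⁅⁆-least : p ⊆ q → y ∈ q → p ∪ ⁅ y ⁆ ⊆ q
  ∪⁅⁆-least {p = p} p⊆q y∈q x∈ with x∈p∪⁅y⁆⁻ p x∈
  ... | inj₁ x∈p  = p⊆q x∈p
  ... | inj₂ ≡.refl = y∈q

  ∪⁅⁆-monoˡ : p ⊆ q → p ∪ ⁅ y ⁆ ⊆ q ∪ ⁅ y ⁆
  ∪⁅⁆-monoˡ {q = q} p⊆q = ∪⁅⁆-least (p⊆p∪q _ ∘ p⊆q) (y∈p∪⁅y⁆ q _)

  p⊆q∪⁅y⁆⇒p∖y⊆q : p ⊆ q ∪ ⁅ y ⁆ → p ∖ y ⊆ q
  p⊆q∪⁅y⁆⇒p∖y⊆q {p = p} {q} {y} p⊆ x∈ with x∈p∪⁅y⁆⁻ q (p⊆ (p─q⊆p p ⁅ y ⁆ x∈))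
  ... | inj₁ x∈q  = x∈q
  ... | inj₂ ≡.refl = ⊥-elim (x∈p─q⇒x∉q {p = p} x∈ (x∈⁅x⁆ y))

  p∖y⊆q⇒p⊆q∪⁅y⁆ : p ∖ y ⊆ q → p ⊆ q ∪ ⁅ y ⁆
  p∖y⊆q⇒p⊆q∪⁅y⁆ {y = y} {q} p∖y⊆q {x} x∈p with x ≟ y
  ... | yes ≡.refl = y∈p∪⁅y⁆ q y
  ... | no x≢y   = p⊆p∪q _ (p∖y⊆q (x∈p∧x≢y⇒x∈p-y x∈p x≢y))

  ∣p∣≡∣p∩q∣+∣p─q∣ : ∀ (p q : Subset n) → ∣ p ∣ ≡ ∣ p ∩ q ∣ ℕ.+ ∣ p ─ q ∣
  ∣p∣≡∣p∩q∣+∣p─q∣ []            []            = ≡.refl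
  ∣p∣≡∣p∩q∣+∣p─q∣ (outside ∷ p) (outside ∷ q) = ∣p∣≡∣p∩q∣+∣p─q∣ p q
  ∣p∣≡∣p∩q∣+∣p─q∣ (outside ∷ p) (inside  ∷ q) = ∣p∣≡∣p∩q∣+∣p─q∣ p q
  ∣p∣≡∣p∩q∣+∣p─q∣ (inside  ∷ p) (outside ∷ q) =
    ≡.trans (≡.cong suc (∣p∣≡∣p∩q∣+∣p─q∣ p q)) (≡.sym (ℕ.+-suc ∣ p ∩ q ∣ _))
  ∣p∣≡∣p∩q∣+∣p─q∣ (inside  ∷ p) (inside  ∷ q) = ≡.cong suc (∣p∣≡∣p∩q∣+∣p─q∣ p q)

  ∣p∪q∣≡∣p∣+∣q∣ : (∀ {x} → x ∈ p → x ∉ q) → ∣ p ∪ q ∣ ≡ ∣ p ∣ ℕ.+ ∣ q ∣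
  ∣p∪q∣≡∣p∣+∣q∣ {p = []}          {[]}          dis = ≡.refl
  ∣p∪q∣≡∣p∣+∣q∣ {p = outside ∷ p} {outside ∷ q} dis = ∣p∪q∣≡∣p∣+∣q∣ (λ x∈ x∈′ → dis (there x∈) (there x∈′))
  ∣p∪q∣≡∣p∣+∣q∣ {p = outside ∷ p} {inside  ∷ q} dis =
    ≡.trans (≡.cong suc (∣p∪q∣≡∣p∣+∣q∣ {p = p} {q} (λ x∈ x∈′ → dis (there x∈) (there x∈′)))) (≡.sym (ℕ.+-suc ∣ p ∣ _))
  ∣p∪q∣≡∣p∣+∣q∣ {p = inside  ∷ p} {outside ∷ q} dis =
    ≡.cong suc (∣p∪q∣≡∣p∣+∣q∣ {p = p} {q} (λ x∈ x∈′ → dis (there x∈) (there x∈′)))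
  ∣p∪q∣≡∣p∣+∣q∣ {p = inside  ∷ p} {inside  ∷ q} dis = ⊥-elim (dis here here)

  ∣p∪⁅x⁆∣≡1+∣p∣ : x ∉ p → ∣ p ∪ ⁅ x ⁆ ∣ ≡ suc ∣ p ∣
  ∣p∪⁅x⁆∣≡1+∣p∣ {x = x} {p} x∉p =
    ≡.trans (∣p∪q∣≡∣p∣+∣q∣ λ y∈p y∈x → x∉p (≡.subst (_∈ p) (x∈⁅y⁆⇒x≡y x y∈x) y∈p))
          (≡.trans (≡.cong (∣ p ∣ ℕ.+_) (∣⁅x⁆∣≡1 x)) (ℕ.+-comm ∣ p ∣ 1))

  ∈⋂-tabulate : ∀ {m} (f : Fin m → Subset n) → (∀ j → x ∈ f j) → x ∈ ⋂ (List.tabulate f)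
  ∈⋂-tabulate {m = zero}  f h = ∈⊤
  ∈⋂-tabulate {m = suc m} f h = x∈p∩q⁺ (h zero , ∈⋂-tabulate (f ∘ suc) (h ∘ suc))

  ∈⋃-tabulate : ∀ {m} (f : Fin m → Subset n) → x ∈ ⋃ (List.tabulate f) → ∃[ j ] x ∈ f j
  ∈⋃-tabulate {m = zero}  f x∈ = ⊥-elim (∉⊥ x∈)
  ∈⋃-tabulate {m = suc m} f x∈ with x∈p∪q⁻ (f zero) _ x∈
  ... | inj₁ x∈f₀ = zero , x∈f₀
  ... | inj₂ x∈fₛ = let j , x∈fⱼ = ∈⋃-tabulate (f ∘ suc) x∈fₛ in suc j , x∈fⱼ

-- Bases, circuits and primitive hulls.

module _ (𝓢 : IndependenceSystem n) where
  open IndependenceSystem 𝓢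

  module _ (X : Subset n) where

    addable? : ∀ I f → Dec (f ∈ X × f ∉ I × Indep (I ∪ ⁅ f ⁆))
    addable? I f = (f ∈? X) ×-dec ¬? (f ∈? I) ×-dec Indep? (I ∪ ⁅ f ⁆)

    unaugmentable⇒basis : ∀ {I} → Indep I → I ⊆ X →
      (∀ {f} → f ∈ X → f ∉ I → ¬ Indep (I ∪ ⁅ f ⁆)) → IsBasisOf 𝓢 X I
    unaugmentable⇒basis {I} indI I⊆X blocked = indI , I⊆X , λ {K} indK K⊆X I⊆K {x} x∈K →
      decidable-stable (x ∈? I) λ x∉I →
        blocked (K⊆X x∈K) x∉I (downward-closed (∪⁅⁆-least I⊆K x∈K) indK)

    basis⇒unaugmentable : ∀ {P} → IsBasisOf 𝓢 X P →
      ∀ {f} → f ∈ X → f ∉ P → ¬ Indep (P ∪ ⁅ f ⁆)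
    basis⇒unaugmentable {P} (_ , P⊆X , max) f∈X f∉P ind =
      f∉P (max ind (∪⁅⁆-least P⊆X f∈X) (p⊆p∪q _) (y∈p∪⁅y⁆ P _))

    extendToBasis : ∀ {I} → Indep I → I ⊆ X → ∃[ P ] (IsBasisOf 𝓢 X P × I ⊆ P)
    extendToBasis {I} = go I (⊃-wellFounded I)
      where
      go : ∀ I → Acc _⊃_ I → Indep I → I ⊆ X → ∃[ P ] (IsBasisOf 𝓢 X P × I ⊆ P)
      go I (acc rec) indI I⊆X with any? (addable? I)
      ... | yes (f , f∈X , f∉I , ind) =
        let P , basis , I+f⊆P = go (I ∪ ⁅ f ⁆) (rec (p⊆p∪q _ , f , y∈p∪⁅y⁆ I f , f∉I))
                                   ind (∪⁅⁆-least I⊆X f∈X)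
        in P , basis , I+f⊆P ∘ p⊆p∪q _
      ... | no none = I , unaugmentable⇒basis indI I⊆X
              (λ f∈X f∉I ind → none (_ , f∈X , f∉I , ind)) , id

  dependent⇒circuit : ∀ {D} → D ⊆ ground → ¬ Indep D → ∃[ C ] (IsCircuit 𝓢 C × C ⊆ D)
  dependent⇒circuit {D} = go D (⊂-wellFounded D)
    where
    go : ∀ D → Acc _⊂_ D → D ⊆ ground → ¬ Indep D → ∃[ C ] (IsCircuit 𝓢 C × C ⊆ D)
    go D (acc rec) D⊆S dep with anySubset? (λ D′ → (D′ ⊂? D) ×-dec ¬? (Indep? D′))
    ... | no minimal = D , (D⊆S , dep , minimal) , id
    ... | yes (D′ , D′⊂D@(D′⊆D , _) , dep′) =
      let C , circuit , C⊆D′ = go D′ (rec D′⊂D) (D⊆S ∘ D′⊆D) dep′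
      in C , circuit , D′⊆D ∘ C⊆D′

  circuit-minus : ∀ {C e} → IsCircuit 𝓢 C → e ∈ C → Indep (C ∖ e)
  circuit-minus (_ , _ , minimal) e∈C =
    decidable-stable (Indep? _) λ dep → minimal (_ , x∈p⇒p-x⊂p e∈C , dep)

  closesCircuit? : ∀ X e C → Dec (IsCircuit 𝓢 C × C ⊆ X ∪ ⁅ e ⁆ × e ∈ C)
  closesCircuit? X e C = isCircuit? 𝓢 C ×-dec (C ⊆? X ∪ ⁅ e ⁆) ×-dec (e ∈? C)

  inHull? : ∀ X e → Dec (e ∈ ground × ∃[ C ] (IsCircuit 𝓢 C × C ⊆ X ∪ ⁅ e ⁆ × e ∈ C))
  inHull? X e = (e ∈? ground) ×-dec anySubset? (closesCircuit? X e)

  ∈PHull⁺ : ∀ {X e C} → IsCircuit 𝓢 C → C ⊆ X ∪ ⁅ e ⁆ → e ∈ C → e ∈ PHull 𝓢 X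
  ∈PHull⁺ {X} {e} circuit@(C⊆S , _) C⊆ e∈C =
    x∈p∪q⁺ (inj₂ (∈⟦⟧⁺ (inHull? X) (C⊆S e∈C , _ , circuit , C⊆ , e∈C)))

  ∈PHull⁻ : ∀ {X e} → e ∈ PHull 𝓢 X → e ∉ X → ∃[ C ] (IsCircuit 𝓢 C × C ⊆ X ∪ ⁅ e ⁆ × e ∈ C)
  ∈PHull⁻ {X} e∈ e∉X with x∈p∪q⁻ X _ e∈
  ... | inj₁ e∈X = ⊥-elim (e∉X e∈X)
  ... | inj₂ e∈H = proj₂ (∈⟦⟧⁻ (inHull? X) e∈H)

  PHull⊆ground : ∀ {X} → X ⊆ ground → PHull 𝓢 X ⊆ ground
  PHull⊆ground {X} X⊆S e∈ with x∈p∪q⁻ X _ e∈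
  ... | inj₁ e∈X = X⊆S e∈X
  ... | inj₂ e∈H = proj₁ (∈⟦⟧⁻ (inHull? X) e∈H)

  PHull-mono : ∀ {X Y} → X ⊆ Y → PHull 𝓢 X ⊆ PHull 𝓢 Y
  PHull-mono {X} {Y} X⊆Y e∈ with x∈p∪q⁻ X _ e∈
  ... | inj₁ e∈X = p⊆p∪q _ (X⊆Y e∈X)
  ... | inj₂ e∈H = let _ , _ , circuit , C⊆ , e∈C = ∈⟦⟧⁻ (inHull? X) e∈H
                   in ∈PHull⁺ circuit (∪⁅⁆-monoˡ X⊆Y ∘ C⊆) e∈C

  -- A circuit inside X + e has to use e, since otherwise it would lie in the independent set X.
  dependent-augmentation⇒∈PHull : ∀ {X e} → X ⊆ ground → e ∈ ground → Indep X →
                                  ¬ Indep (X ∪ ⁅ e ⁆) → e ∈ PHull 𝓢 X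
  dependent-augmentation⇒∈PHull {X} {e} X⊆S e∈S indX dep
    with dependent⇒circuit (∪⁅⁆-least X⊆S e∈S) dep
  ... | C , circuit@(_ , depC , _) , C⊆ with e ∈? C
  ...   | yes e∈C = ∈PHull⁺ circuit C⊆ e∈C
  ...   | no e∉C  = ⊥-elim (depC (downward-closed C⊆X indX))
    where
    C⊆X : C ⊆ X
    C⊆X {x} x∈C with x∈p∪⁅y⁆⁻ X (C⊆ x∈C)
    ... | inj₁ x∈X  = x∈X
    ... | inj₂ ≡.refl = ⊥-elim (e∉C x∈C)

  -- The form in which the growth property enters all later estimates; matroids satisfy it with
  -- constant 1. Elements of X that already belong to I are not charged.
  HullBounded : ℕ → Set
  HullBounded k = ∀ {X I J} → X ⊆ ground → Indep I → J ⊆ I → (∀ {e} → e ∈ J → e ∉ X) →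
                  J ⊆ PHull 𝓢 X → ∣ J ∣ ℕ.≤ k ℕ.* ∣ X ─ I ∣

  -- An element of J in the part Q of the growth partition would complete a
  -- circuit inside P ∪ Q for a suitable basis P of X, so J lies in Z.
  growth⇒hullBounded : ∀ {k} → IsGrowthSystem 𝓢 k → HullBounded k
  growth⇒hullBounded {k} gs {X} {I} {J} X⊆S indI J⊆I dis J⊆H
    with IsGrowthSystem.growth gs X I X⊆S indI
  ... | Q , Z , Q∪Z≡ , _ , ∣Z∣≤ , union-indep = ℕ.≤-trans (p⊆q⇒∣p∣≤∣q∣ J⊆Z) ∣Z∣≤
    where
    J⊆Z : J ⊆ Z
    J⊆Z {e} e∈J with x∈p∪q⁻ Q Z (≡.subst (e ∈_) (≡.sym Q∪Z≡) (x∈p∧x∉q⇒x∈p─q (J⊆I e∈J) (dis e∈J)))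
    ... | inj₂ e∈Z = e∈Z
    ... | inj₁ e∈Q =
      let C , circuit , C⊆ , e∈C = ∈PHull⁻ (J⊆H e∈J) (dis e∈J)
          P , basis , C∖e⊆P = extendToBasis X (circuit-minus circuit e∈C) (p⊆q∪⁅y⁆⇒p∖y⊆q C⊆)
          C⊆P∪Q : C ⊆ P ∪ Q
          C⊆P∪Q = ∪⁅⁆-least (p⊆p∪q Q) (q⊆p∪q P Q e∈Q) ∘ p∖y⊆q⇒p⊆q∪⁅y⁆ C∖e⊆P
      in ⊥-elim (proj₁ (proj₂ circuit) (downward-closed C⊆P∪Q (union-indep P basis)))

  module _ (matroid : IsMatroid 𝓢) where

    -- A basis P of X extending C ∖ e cannot take e, because P + e contains the circuit C. To move
    -- this to an arbitrary basis B, compare sizes: augmenting P from B + e, or B from P,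
    -- contradicts the circuit or the maximality of one of the two bases.
    hull⇒basis-dependent : ∀ {X B e} → e ∈ PHull 𝓢 X → e ∉ X → IsBasisOf 𝓢 X B →
                           ¬ Indep (B ∪ ⁅ e ⁆)
    hull⇒basis-dependent {X} {B} {e} e∈H e∉X basisB@(indB , B⊆X , _) indB+e
      with ∈PHull⁻ e∈H e∉X
    ... | C , circuit , C⊆ , e∈C
      with extendToBasis X (circuit-minus circuit e∈C) (p⊆q∪⁅y⁆⇒p∖y⊆q C⊆)
    ... | P , basisP@(indP , P⊆X , _) , C∖e⊆P with ∣ P ∣ ℕ.≤? ∣ B ∣
    ...   | yes ∣P∣≤∣B∣ =
      let ∣P∣<∣B+e∣ = ≡.subst (∣ P ∣ ℕ.<_) (≡.sym (∣p∪⁅x⁆∣≡1+∣p∣ (e∉X ∘ B⊆X))) (ℕ.s≤s ∣P∣≤∣B∣)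
          g , g∈B+e , g∉P , indP+g = matroid P (B ∪ ⁅ e ⁆) indP indB+e ∣P∣<∣B+e∣
      in [ (λ g∈B → basis⇒unaugmentable X basisP (B⊆X g∈B) g∉P indP+g)
         , (λ g≡e → proj₁ (proj₂ circuit) (downward-closed (p∖y⊆q⇒p⊆q∪⁅y⁆ C∖e⊆P)
                           (≡.subst (λ x → Indep (P ∪ ⁅ x ⁆)) g≡e indP+g)))
         ]′ (x∈p∪⁅y⁆⁻ B g∈B+e)
    ...   | no ∣P∣≰∣B∣ =
      let g , g∈P , g∉B , indB+g = matroid B P indB indP (ℕ.≰⇒> ∣P∣≰∣B∣)
      in basis⇒unaugmentable X basisB (P⊆X g∈P) g∉B indB+g

    -- No element of J outside B can augment B, so a larger J would contradict the augmentation
    -- axiom.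
    hull-rank : ∀ {X B J} → IsBasisOf 𝓢 X B → Indep J →
                (∀ {e} → e ∈ J → e ∈ B ⊎ e ∈ PHull 𝓢 X × e ∉ X) → ∣ J ∣ ℕ.≤ ∣ B ∣
    hull-rank {X} {B} {J} basis@(indB , _) indJ spanned = ℕ.≮⇒≥ λ ∣B∣<∣J∣ →
      let g , g∈J , g∉B , indB+g = matroid B J indB indJ ∣B∣<∣J∣
      in [ g∉B , (λ (g∈H , g∉X) → hull⇒basis-dependent g∈H g∉X basis indB+g) ]′ (spanned g∈J)

    -- X ∩ I and J are disjoint parts of I, and a basis of X extending X ∩ I spans both. Hence their
    -- sizes add up to at most ∣ X ∣, and ∣ X ∩ I ∣ cancels.
    matroid⇒hullBounded : HullBounded 1
    matroid⇒hullBounded {X} {I} {J} X⊆S indI J⊆I dis J⊆H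
      with extendToBasis X {X ∩ I} (downward-closed (p∩q⊆q X I) indI) (p∩q⊆p X I)
    ... | P , basis@(_ , P⊆X , _) , X∩I⊆P = ℕ.+-cancelˡ-≤ ∣ X ∩ I ∣ _ _ (begin
      ∣ X ∩ I ∣ ℕ.+ ∣ J ∣             ≡⟨ ∣p∪q∣≡∣p∣+∣q∣ {p = X ∩ I} (λ x∈ x∈J → dis x∈J (p∩q⊆p X I x∈)) ⟨
      ∣ X ∩ I ∪ J ∣                   ≤⟨ hull-rank basis (downward-closed ∪⊆I indI) spanned ⟩
      ∣ P ∣                           ≤⟨ p⊆q⇒∣p∣≤∣q∣ P⊆X ⟩
      ∣ X ∣                           ≡⟨ ∣p∣≡∣p∩q∣+∣p─q∣ X I ⟩
      ∣ X ∩ I ∣ ℕ.+ ∣ X ─ I ∣         ≡⟨ ≡.cong (∣ X ∩ I ∣ ℕ.+_) (ℕ.*-identityˡ _) ⟨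
      ∣ X ∩ I ∣ ℕ.+ 1 ℕ.* ∣ X ─ I ∣   ∎)
      where
      open ℕ.≤-Reasoning

      ∪⊆I : X ∩ I ∪ J ⊆ I
      ∪⊆I x∈ = [ p∩q⊆q X I , J⊆I ]′ (x∈p∪q⁻ (X ∩ I) J x∈)

      spanned : ∀ {e} → e ∈ X ∩ I ∪ J → e ∈ P ⊎ e ∈ PHull 𝓢 X × e ∉ X
      spanned e∈ with x∈p∪q⁻ (X ∩ I) J e∈
      ... | inj₁ e∈X∩I = inj₁ (X∩I⊆P e∈X∩I)
      ... | inj₂ e∈J   = inj₂ (J⊆H e∈J , dis e∈J)

-- Ordered fields, weights and expectations

module OrderedField {c ℓ₁ ℓ₂} (R : EuclideanField c ℓ₁ ℓ₂) where
  open EuclideanField R hiding (zero)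
  open Weighted R
  open DecTotalOrder decTotalOrder public
    using (poset; antisym)
    renaming (refl to ≤-refl; reflexive to ≤-reflexive; trans to ≤-trans; total to ≤-total)
  open Algebra.Properties.Ring ring using (-‿distribʳ-*)
  open Algebra.Properties.Group +-group using (⁻¹-involutive)
  open Algebra.Properties.Semiring.Mult semiring using (×-homo-+; ×1-homo-*)
  open Algebra.Properties.Semiring.Sum semiring public
    using (sum-cong-≋; ∑-distrib-+; ∑-comm; *-distribˡ-sum)
  module ≤-Reasoning = Relation.Binary.Reasoning.PartialOrder poset
  open ≤-Reasoning
  module Solver = Algebra.Solver.Ring.NaturalCoefficients.Default commutativeSemiring
  open Solver using (solve; _:=_; _:+_; _:*_; con)

  <⇒≱ : ∀ {x y} → x < y → ¬ (y ≤ x)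
  <⇒≱ (x≤y , x≉y) y≤x = x≉y (antisym x≤y y≤x)

  ≰⇒> : ∀ {x y} → ¬ (x ≤ y) → y < x
  ≰⇒> {x} {y} x≰y with ≤-total x y
  ... | inj₁ x≤y = ⊥-elim (x≰y x≤y)
  ... | inj₂ y≤x = y≤x , λ y≈x → x≰y (≤-reflexive (sym y≈x))

  ≮⇒≥ : ∀ {x y} → ¬ (x < y) → y ≤ x
  ≮⇒≥ {x} {y} x≮y with y ≤? x
  ... | yes y≤x = y≤x
  ... | no y≰x  = ⊥-elim (x≮y (≰⇒> y≰x))

  +-monoˡ-≤ : ∀ x {y z} → y ≤ z → y + x ≤ z + x
  +-monoˡ-≤ x {y} {z} y≤z = begin
    y + x ≈⟨ +-comm y x ⟩
    x + y ≤⟨ +-monoʳ-≤ x y≤z ⟩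
    x + z ≈⟨ +-comm x z ⟩
    z + x ∎

  +-mono-≤ : ∀ {x y u v} → x ≤ y → u ≤ v → x + u ≤ y + v
  +-mono-≤ {u = u} x≤y u≤v = ≤-trans (+-monoˡ-≤ u x≤y) (+-monoʳ-≤ _ u≤v)

  +-nonneg : ∀ {x y} → 0# ≤ x → 0# ≤ y → 0# ≤ x + y
  +-nonneg {x} {y} 0≤x 0≤y = begin
    0#      ≈⟨ +-identityˡ 0# ⟨
    0# + 0# ≤⟨ +-mono-≤ 0≤x 0≤y ⟩
    x + y   ∎

  x≤x+y : ∀ {x y} → 0# ≤ y → x ≤ x + y
  x≤x+y {x} {y} 0≤y = begin
    x      ≈⟨ +-identityʳ x ⟨
    x + 0# ≤⟨ +-monoʳ-≤ x 0≤y ⟩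
    x + y  ∎

  x-y+y≈x : ∀ x y → (x - y) + y ≈ x
  x-y+y≈x x y = trans (+-assoc x (- y) y) (trans (+-congˡ (-‿inverseˡ y)) (+-identityʳ x))

  y+[x-y]≈x : ∀ x y → y + (x - y) ≈ x
  y+[x-y]≈x x y = trans (+-comm y (x - y)) (x-y+y≈x x y)

  x+y-x≈y : ∀ x y → (x + y) - x ≈ y
  x+y-x≈y x y = trans (+-congʳ (+-comm x y)) (trans (+-assoc y x (- x)) (trans (+-congˡ (-‿inverseʳ x)) (+-identityʳ y)))

  +-cancelˡ-≤ : ∀ z {x y} → z + x ≤ z + y → x ≤ y
  +-cancelˡ-≤ z {x} {y} z+x≤z+y = begin
    x           ≈⟨ x+y-x≈y z x ⟨
    z + x + - z ≤⟨ +-monoˡ-≤ (- z) z+x≤z+y ⟩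
    z + y + - z ≈⟨ x+y-x≈y z y ⟩
    y           ∎

  x≤y⇒0≤y-x : ∀ {x y} → x ≤ y → 0# ≤ y - x
  x≤y⇒0≤y-x {x} {y} x≤y = begin
    0#    ≈⟨ -‿inverseʳ x ⟨
    x - x ≤⟨ +-monoˡ-≤ (- x) x≤y ⟩
    y - x ∎

  *-monoˡ-≤ : ∀ {z x y} → 0# ≤ z → x ≤ y → z * x ≤ z * y
  *-monoˡ-≤ {z} {x} {y} 0≤z x≤y = begin
    z * x               ≤⟨ x≤x+y (*-nonneg 0≤z (x≤y⇒0≤y-x x≤y)) ⟩
    z * x + z * (y - x) ≈⟨ distribˡ z x (y - x) ⟨
    z * (x + (y - x))   ≈⟨ *-congˡ (y+[x-y]≈x y x) ⟩
    z * y               ∎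

  *-monoʳ-≤ : ∀ {z x y} → 0# ≤ z → x ≤ y → x * z ≤ y * z
  *-monoʳ-≤ {z} {x} {y} 0≤z x≤y = begin
    x * z ≈⟨ *-comm x z ⟩
    z * x ≤⟨ *-monoˡ-≤ 0≤z x≤y ⟩
    z * y ≈⟨ *-comm z y ⟩
    y * z ∎

  x≤0⇒0≤-x : ∀ {x} → x ≤ 0# → 0# ≤ - x
  x≤0⇒0≤-x {x} x≤0 = begin
    0#     ≤⟨ x≤y⇒0≤y-x x≤0 ⟩
    0# - x ≈⟨ +-identityˡ (- x) ⟩
    - x    ∎

  0≤1 : 0# ≤ 1#
  0≤1 with ≤-total 0# 1#
  ... | inj₁ 0≤1 = 0≤1
  ... | inj₂ 1≤0 = begin
    0#            ≤⟨ *-nonneg (x≤0⇒0≤-x 1≤0) (x≤0⇒0≤-x 1≤0) ⟩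
    - 1# * - 1#   ≈⟨ -‿distribʳ-* (- 1#) 1# ⟨
    - (- 1# * 1#) ≈⟨ -‿cong (*-identityʳ (- 1#)) ⟩
    - - 1#        ≈⟨ ⁻¹-involutive 1# ⟩
    1#            ∎

  <⇒≉0 : ∀ {x} → 0# < x → ¬ (x ≈ 0#)
  <⇒≉0 (_ , 0≉x) x≈0 = 0≉x (sym x≈0)

  ⁻¹-nonneg : ∀ {x} → 0# < x → 0# ≤ x ⁻¹
  ⁻¹-nonneg {x} 0<x@(0≤x , _) with ≤-total 0# (x ⁻¹)
  ... | inj₁ 0≤x⁻¹ = 0≤x⁻¹
  ... | inj₂ x⁻¹≤0 = ⊥-elim (0≉1 (antisym 0≤1 (begin
    1#       ≈⟨ ⁻¹-inverse x (<⇒≉0 0<x) ⟨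
    x * x ⁻¹ ≤⟨ *-monoˡ-≤ 0≤x x⁻¹≤0 ⟩
    x * 0#   ≈⟨ zeroʳ x ⟩
    0#       ∎)))

  ⁻¹-cancelˡ : ∀ {z} → 0# < z → ∀ x → z ⁻¹ * (z * x) ≈ x
  ⁻¹-cancelˡ {z} 0<z x = begin-equality
    z ⁻¹ * (z * x) ≈⟨ solve 3 (λ i z x → i :* (z :* x) := z :* i :* x) refl (z ⁻¹) z x ⟩
    z * z ⁻¹ * x   ≈⟨ *-congʳ (⁻¹-inverse z (<⇒≉0 0<z)) ⟩
    1# * x         ≈⟨ *-identityˡ x ⟩
    x              ∎

  *-cancelˡ-≤ : ∀ {z x y} → 0# < z → z * x ≤ z * y → x ≤ y
  *-cancelˡ-≤ {z} {x} {y} 0<z z*x≤z*y = begin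
    x              ≈⟨ ⁻¹-cancelˡ 0<z x ⟨
    z ⁻¹ * (z * x) ≤⟨ *-monoˡ-≤ (⁻¹-nonneg 0<z) z*x≤z*y ⟩
    z ⁻¹ * (z * y) ≈⟨ ⁻¹-cancelˡ 0<z y ⟩
    y              ∎

  *-cancelˡ : ∀ {z x y} → 0# < z → z * x ≈ z * y → x ≈ y
  *-cancelˡ {z} {x} {y} 0<z eq = trans (sym (⁻¹-cancelˡ 0<z x)) (trans (*-congˡ eq) (⁻¹-cancelˡ 0<z y))

  *-pos : ∀ {x y} → 0# < x → 0# < y → 0# < x * y
  *-pos {x} {y} 0<x@(0≤x , _) (0≤y , 0≉y) =
    *-nonneg 0≤x 0≤y , λ 0≈xy → 0≉y (*-cancelˡ 0<x (trans (zeroʳ x) 0≈xy))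

  +-cancelˡ-≈ : ∀ x {y z} → x + y ≈ x + z → y ≈ z
  +-cancelˡ-≈ x eq = antisym (+-cancelˡ-≤ x (≤-reflexive eq)) (+-cancelˡ-≤ x (≤-reflexive (sym eq)))

  ⁻¹-unique : ∀ {x y} → 0# < x → x * y ≈ 1# → x ⁻¹ ≈ y
  ⁻¹-unique {x} {y} 0<x xy≈1 = *-cancelˡ 0<x (trans (⁻¹-inverse x (<⇒≉0 0<x)) (sym xy≈1))

  ⁻¹-pos : ∀ {x} → 0# < x → 0# < x ⁻¹
  ⁻¹-pos {x} 0<x = ⁻¹-nonneg 0<x , λ 0≈x⁻¹ → 0≉1 (begin-equality
    0#       ≈⟨ zeroʳ x ⟨
    x * 0#   ≈⟨ *-congˡ 0≈x⁻¹ ⟩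
    x * x ⁻¹ ≈⟨ ⁻¹-inverse x (<⇒≉0 0<x) ⟩
    1#       ∎)

  <-≤-trans : ∀ {x y z} → x < y → y ≤ z → x < z
  <-≤-trans {x} {y} {z} x<y y≤z = begin-strict x <⟨ x<y ⟩ y ≤⟨ y≤z ⟩ z ∎

  square-cancel-≤ : ∀ {x y} → 0# ≤ y → x * x ≤ y * y → x ≤ y
  square-cancel-≤ {x} {y} 0≤y x²≤y² with x ≤? y
  ... | yes x≤y = x≤y
  ... | no x≰y  = *-cancelˡ-≤ (begin-strict 0# ≤⟨ 0≤y ⟩ y <⟨ ≰⇒> x≰y ⟩ x ∎) (begin
    x * x ≤⟨ x²≤y² ⟩
    y * y ≤⟨ *-monoʳ-≤ 0≤y (proj₁ (≰⇒> x≰y)) ⟩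
    x * y ∎)

  fromℕ-nonneg : ∀ k → 0# ≤ fromℕ k
  fromℕ-nonneg zero    = ≤-refl
  fromℕ-nonneg (suc k) = +-nonneg 0≤1 (fromℕ-nonneg k)

  fromℕ-homo-+ : ∀ i j → fromℕ (i ℕ.+ j) ≈ fromℕ i + fromℕ j
  fromℕ-homo-+ = ×-homo-+ 1#

  fromℕ-homo-* : ∀ i j → fromℕ (i ℕ.* j) ≈ fromℕ i * fromℕ j
  fromℕ-homo-* = ×1-homo-*

  fromℕ-mono : ∀ {i j} → i ℕ.≤ j → fromℕ i ≤ fromℕ j
  fromℕ-mono {i} {j} i≤j = begin
    fromℕ i                   ≤⟨ x≤x+y (fromℕ-nonneg (j ℕ.∸ i)) ⟩
    fromℕ i + fromℕ (j ℕ.∸ i) ≈⟨ fromℕ-homo-+ i (j ℕ.∸ i) ⟨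
    fromℕ (i ℕ.+ (j ℕ.∸ i))   ≡⟨ ≡.cong fromℕ (ℕ.m+[n∸m]≡n i≤j) ⟩
    fromℕ j                   ∎

  1≤fromℕ : ∀ {k} → 1 ℕ.≤ k → 1# ≤ fromℕ k
  1≤fromℕ 1≤k = ≤-trans (≤-reflexive (sym (+-identityʳ 1#))) (fromℕ-mono 1≤k)

  fromℕ-pos : ∀ {k} → 1 ℕ.≤ k → 0# < fromℕ k
  fromℕ-pos 1≤k = <-≤-trans (0≤1 , 0≉1) (1≤fromℕ 1≤k)

  sum-mono-≤ : ∀ {n} {f g : Fin n → Carrier} → (∀ i → f i ≤ g i) → sum f ≤ sum g
  sum-mono-≤ {zero}  f≤g = ≤-refl
  sum-mono-≤ {suc n} f≤g = +-mono-≤ (f≤g zero) (sum-mono-≤ (f≤g ∘ suc))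

  sum-nonneg : ∀ {n} {f : Fin n → Carrier} → (∀ i → 0# ≤ f i) → 0# ≤ sum f
  sum-nonneg {zero}  0≤f = ≤-refl
  sum-nonneg {suc n} 0≤f = +-nonneg (0≤f zero) (sum-nonneg (0≤f ∘ suc))

  term≤sum : ∀ {n} {f : Fin n → Carrier} → (∀ i → 0# ≤ f i) → ∀ i → f i ≤ sum f
  term≤sum {suc n} {f} 0≤f zero = x≤x+y (sum-nonneg (0≤f ∘ suc))
  term≤sum {suc n} {f} 0≤f (suc i) = begin
    f (suc i)              ≤⟨ term≤sum (0≤f ∘ suc) i ⟩
    sum (f ∘ suc)          ≤⟨ x≤x+y (0≤f zero) ⟩
    sum (f ∘ suc) + f zero ≈⟨ +-comm (sum (f ∘ suc)) (f zero) ⟩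
    sum f                  ∎

  -- Weights of subsets.

  private
    variable
      X Y : Subset n
      e : Fin n

  on : (Fin n → Carrier) → Subset n → Fin n → Carrier
  on w X e = if does (e ∈? X) then w e else 0#

  on-∈ : ∀ (w : Fin n → Carrier) → e ∈ X → on w X e ≡ w e
  on-∈ {e = e} {X = X} w e∈X = ≡.cong (if_then w e else 0#) (dec-true (e ∈? X) e∈X)

  on-∉ : ∀ (w : Fin n → Carrier) → e ∉ X → on w X e ≡ 0#
  on-∉ {e = e} {X = X} w e∉X = ≡.cong (if_then w e else 0#) (dec-false (e ∈? X) e∉X)

  on-nonneg : ∀ {w : Fin n → Carrier} → (∀ e → 0# ≤ w e) → ∀ X e → 0# ≤ on w X e
  on-nonneg 0≤w X e with does (e ∈? X)
  ... | true  = 0≤w e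
  ... | false = ≤-refl

  weight-const-1 : ∀ (X : Subset n) → weight (const 1#) X ≈ fromℕ ∣ X ∣
  weight-const-1 []            = refl
  weight-const-1 (inside  ∷ X) = +-congˡ (weight-const-1 X)
  weight-const-1 (outside ∷ X) = trans (+-identityˡ _) (weight-const-1 X)

  weight-split : ∀ (w : Fin n → Carrier) X Y → weight w X ≈ weight w (X ∩ Y) + weight w (X ─ Y)
  weight-split w X Y = trans (sum-cong-≋ pointwise) (∑-distrib-+ (on w (X ∩ Y)) (on w (X ─ Y)))
    where
    pointwise : ∀ e → on w X e ≈ on w (X ∩ Y) e + on w (X ─ Y) e
    pointwise e with e ∈? X
    ... | no e∉X rewrite on-∉ w (e∉X ∘ p∩q⊆p X Y) | on-∉ w (e∉X ∘ p─q⊆p X Y) = sym (+-identityˡ 0#)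
    ... | yes e∈X with e ∈? Y
    ...   | yes e∈Y rewrite on-∈ w (x∈p∩q⁺ (e∈X , e∈Y))
                          | on-∉ {e = e} {X = X ─ Y} w (λ e∈ → x∈p─q⇒x∉q {p = X} e∈ e∈Y) = sym (+-identityʳ (w e))
    ...   | no e∉Y rewrite on-∉ w (e∉Y ∘ p∩q⊆q X Y) | on-∈ w (x∈p∧x∉q⇒x∈p─q e∈X e∉Y) = sym (+-identityˡ (w e))

  weight-disjoint-∪ : ∀ (w : Fin n → Carrier) → (∀ {e} → e ∈ X → e ∉ Y) →
                      weight w (X ∪ Y) ≈ weight w X + weight w Y
  weight-disjoint-∪ {X = X} {Y = Y} w dis = trans (sum-cong-≋ pointwise) (∑-distrib-+ (on w X) (on w Y))
    where
    pointwise : ∀ e → on w (X ∪ Y) e ≈ on w X e + on w Y e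
    pointwise e with e ∈? X
    ... | yes e∈X rewrite on-∈ w (x∈p∪q⁺ {p = X} {q = Y} (inj₁ e∈X)) | on-∉ w (dis e∈X) = sym (+-identityʳ (w e))
    ... | no e∉X with e ∈? Y
    ...   | yes e∈Y rewrite on-∈ w (x∈p∪q⁺ {p = X} {q = Y} (inj₂ e∈Y)) = sym (+-identityˡ (w e))
    ...   | no e∉Y rewrite on-∉ {e = e} {X = X ∪ Y} w ([ e∉X , e∉Y ]′ ∘ x∈p∪q⁻ X Y) = sym (+-identityˡ 0#)

  module _ {w : Fin n → Carrier} (0≤w : ∀ e → 0# ≤ w e) where

    weight-nonneg : ∀ X → 0# ≤ weight w X
    weight-nonneg X = sum-nonneg (on-nonneg 0≤w X)

    weight-mono : X ⊆ Y → weight w X ≤ weight w Y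
    weight-mono {X = X} {Y = Y} X⊆Y = sum-mono-≤ pointwise
      where
      pointwise : ∀ e → on w X e ≤ on w Y e
      pointwise e with e ∈? X
      ... | yes e∈X = ≤-reflexive (reflexive (≡.sym (on-∈ w (X⊆Y e∈X))))
      ... | no e∉X  = on-nonneg 0≤w Y e

    -- A union bound. One set and two families fit both uses: the core with the losses of agent and
    -- item components, and O ∩ G with the elements blocked in agent and item components.
    weight-cover : ∀ {i j} {C : Subset n} {U : Fin i → Subset n} {V : Fin j → Subset n} →
      (∀ {e} → e ∈ X → e ∈ C ⊎ (∃[ i ] e ∈ U i) ⊎ (∃[ j ] e ∈ V j)) →
      weight w X ≤ weight w C + (sum (weight w ∘ U) + sum (weight w ∘ V))
    weight-cover {X = X} {C = C} {U} {V} cover = begin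
      sum (on w X)
        ≤⟨ sum-mono-≤ pointwise ⟩
      sum (λ e → on w C e + (sum (λ i → on w (U i) e) + sum (λ j → on w (V j) e)))
        ≈⟨ ∑-distrib-+ (on w C) _ ⟩
      weight w C + sum (λ e → sum (λ i → on w (U i) e) + sum (λ j → on w (V j) e))
        ≈⟨ +-congˡ (∑-distrib-+ (λ e → sum (λ i → on w (U i) e)) _) ⟩
      weight w C + (sum (λ e → sum (λ i → on w (U i) e)) + sum (λ e → sum (λ j → on w (V j) e)))
        ≈⟨ +-congˡ (+-cong (∑-comm λ e i → on w (U i) e) (∑-comm λ e j → on w (V j) e)) ⟩
      weight w C + (sum (weight w ∘ U) + sum (weight w ∘ V)) ∎
      where
      0≤U : ∀ e → 0# ≤ sum (λ i → on w (U i) e)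
      0≤U e = sum-nonneg λ i → on-nonneg 0≤w (U i) e
      0≤V : ∀ e → 0# ≤ sum (λ j → on w (V j) e)
      0≤V e = sum-nonneg λ j → on-nonneg 0≤w (V j) e
      pointwise : ∀ e → on w X e ≤ on w C e + (sum (λ i → on w (U i) e) + sum (λ j → on w (V j) e))
      pointwise e with e ∈? X
      ... | no e∉X = +-nonneg (on-nonneg 0≤w C e) (+-nonneg (0≤U e) (0≤V e))
      ... | yes e∈X with cover e∈X
      ...   | inj₁ e∈C = begin
        w e      ≡⟨ on-∈ w e∈C ⟨
        on w C e ≤⟨ x≤x+y (+-nonneg (0≤U e) (0≤V e)) ⟩
        _        ∎
      ...   | inj₂ (inj₁ (i , e∈Uᵢ)) = begin
        w e                        ≡⟨ on-∈ w e∈Uᵢ ⟨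
        on w (U i) e               ≤⟨ term≤sum (λ i → on-nonneg 0≤w (U i) e) i ⟩
        sum (λ i → on w (U i) e)   ≤⟨ x≤x+y (0≤V e) ⟩
        _                          ≤⟨ x≤x+y (on-nonneg 0≤w C e) ⟩
        _                          ≈⟨ +-comm _ (on w C e) ⟩
        _                          ∎
      ...   | inj₂ (inj₂ (j , e∈Vⱼ)) = begin
        w e                        ≡⟨ on-∈ w e∈Vⱼ ⟨
        on w (V j) e               ≤⟨ term≤sum (λ j → on-nonneg 0≤w (V j) e) j ⟩
        sum (λ j → on w (V j) e)   ≤⟨ x≤x+y (0≤U e) ⟩
        _                          ≤⟨ x≤x+y (on-nonneg 0≤w C e) ⟩
        _                          ≈⟨ solve 3 (λ c u v → v :+ u :+ c := c :+ (u :+ v)) refl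
                                        (on w C e) (sum (λ i → on w (U i) e)) (sum (λ j → on w (V j) e)) ⟩
        _                          ∎

  sumₗ : (Fin n → Carrier) → List (Fin n) → Carrier
  sumₗ f = List.foldr (λ e s → f e + s) 0#

  sumₗ-tabulate : ∀ {m} (f : Fin n → Carrier) (g : Fin m → Fin n) → sumₗ f (List.tabulate g) ≡ sum (f ∘ g)
  sumₗ-tabulate {m = zero}  f g = ≡.refl
  sumₗ-tabulate {m = suc m} f g = ≡.cong (f (g zero) +_) (sumₗ-tabulate f (g ∘ suc))

  sumₗ-↭ : ∀ (f : Fin n → Carrier) {xs ys} → xs ↭ ys → sumₗ f xs ≈ sumₗ f ys
  sumₗ-↭ f Perm.refl           = refl
  sumₗ-↭ f (Perm.prep x p)     = +-congˡ (sumₗ-↭ f p)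
  sumₗ-↭ f (Perm.swap x y p)   = trans (+-congˡ (+-congˡ (sumₗ-↭ f p)))
    (solve 3 (λ x y s → x :+ (y :+ s) := y :+ (x :+ s)) refl (f x) (f y) _)
  sumₗ-↭ f (Perm.trans p₁ p₂)  = trans (sumₗ-↭ f p₁) (sumₗ-↭ f p₂)

  -- Summation by parts along decreasing weight.

  module Ordered (w : Fin n → Carrier) (w-injective : ∀ {e f} → w e ≈ w f → e ≡ f) where

    infix 4 _≻_
    _≻_ : Fin n → Fin n → Set _
    e ≻ f = w f < w e

    descending : List (Fin n)
    descending = Sort.sort (decreasing w) (allFin n)

    descending-↭ : descending ↭ allFin n
    descending-↭ = Sort.sort-↭ (decreasing w) (allFin n)

    ∈-descending : ∀ e → e ∈ₗ descending
    ∈-descending e = ∈-resp-↭ (↭-sym descending-↭) (∈-allFin e)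

    -- Sorting yields a weak order only. The list is a permutation of a duplicate-free one, so
    -- injectivity of `w` makes the order strict.
    descending-≻ : AllPairs _≻_ descending
    descending-≻ = AllPairs.zipWith (λ (f≤e , e≢f) → f≤e , λ eq → e≢f (≡.sym (w-injective eq)))
      ( Sorted.Sorted⇒AllPairs (DecTotalOrder.totalOrder (decreasing w)) (Sort.sort-↗ (decreasing w) (allFin n))
      , PermSetoid.AllPairs-resp-↭ (≡.setoid (Fin n)) (λ e≢f f≡e → e≢f (≡.sym f≡e))
          ((λ { ≡.refl e≢f → e≢f }) , (λ { ≡.refl e≢f → e≢f }))
          (↭⇒↭ₛ (↭-sym descending-↭)) (allFin⁺ n))

    sumₗ-descending : ∀ f → sumₗ f descending ≈ sum f
    sumₗ-descending f = trans (sumₗ-↭ f descending-↭) (reflexive (sumₗ-tabulate f id))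

    atLeast? : ∀ (X : Subset n) t e → Dec (e ∈ X × w t ≤ w e)
    atLeast? X t e = (e ∈? X) ×-dec (w t ≤? w e)

    infixl 8 _↟_
    _↟_ : Subset n → Fin n → Subset n
    X ↟ t = ⟦ atLeast? X t ⟧

    atLeast-on : ∀ (f : Fin n → Carrier) t e → Carrier
    atLeast-on f t e = if does (w t ≤? w e) then f e else 0#

    atLeast-on-≥ : ∀ f {t e} → w t ≤ w e → atLeast-on f t e ≡ f e
    atLeast-on-≥ f {t} {e} t≤e = ≡.cong (if_then f e else 0#) (dec-true (w t ≤? w e) t≤e)

    atLeast-on-< : ∀ f {t e} → t ≻ e → atLeast-on f t e ≡ 0#
    atLeast-on-< f {t} {e} t≻e = ≡.cong (if_then f e else 0#) (dec-false (w t ≤? w e) (<⇒≱ t≻e))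

    atLeast-on-* : ∀ k f t e → atLeast-on (λ e → k * f e) t e ≈ k * atLeast-on f t e
    atLeast-on-* k f t e with does (w t ≤? w e)
    ... | true  = refl
    ... | false = sym (zeroʳ k)

    on-↟ : ∀ (f : Fin n → Carrier) X t e → atLeast-on (on f X) t e ≡ on f (X ↟ t) e
    on-↟ f X t e with w t ≤? w e | e ∈? X
    ... | no t≰e  | _       = ≡.sym (on-∉ {X = X ↟ t} f (λ e∈ → t≰e (proj₂ (∈⟦⟧⁻ (atLeast? X t) e∈))))
    ... | yes t≤e | yes e∈X = ≡.sym (on-∈ f (∈⟦⟧⁺ (atLeast? X t) (e∈X , t≤e)))
    ... | yes _   | no e∉X  = ≡.sym (on-∉ {X = X ↟ t} f (λ e∈ → e∉X (proj₁ (∈⟦⟧⁻ (atLeast? X t) e∈))))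

    sumₗ-lighter : ∀ f {x xs} → All (x ≻_) xs → sumₗ (atLeast-on f x) xs ≈ 0#
    sumₗ-lighter f []           = refl
    sumₗ-lighter f (x≻y ∷ x≻xs) = trans (+-cong (reflexive (atLeast-on-< f x≻y)) (sumₗ-lighter f x≻xs)) (+-identityˡ 0#)

    module _ (0≤w : ∀ e → 0# ≤ w e) where

      -- The surplus s of b over a on the heavier elements may be spent at any
      -- weight top that dominates the rest of the list.
      abel-list : ∀ {a b : Fin n → Carrier} {s top} xs → AllPairs _≻_ xs → 0# ≤ s →
        All (λ e → w e ≤ top) xs → 0# ≤ top →
        (∀ {t} → t ∈ₗ xs → sumₗ (atLeast-on a t) xs ≤ s + sumₗ (atLeast-on b t) xs) →
        sumₗ (λ e → a e * w e) xs ≤ s * top + sumₗ (λ e → b e * w e) xs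
      abel-list [] _ 0≤s _ 0≤top _ = +-nonneg (*-nonneg 0≤s 0≤top) ≤-refl
      abel-list {a} {b} {s} {top} (x ∷ xs) (x≻xs ∷ xs↘) 0≤s (x≤top ∷ _) 0≤top prefix = begin
        a x * w x + Σa
          ≤⟨ +-monoʳ-≤ _ (abel-list xs xs↘ (x≤y⇒0≤y-x aₓ≤s+bₓ) (All.map proj₁ x≻xs) (0≤w x) prefix′) ⟩
        a x * w x + (s′ * w x + Σb)
          ≈⟨ solve 4 (λ a s′ w Σb → a :* w :+ (s′ :* w :+ Σb) := (a :+ s′) :* w :+ Σb) refl (a x) s′ (w x) Σb ⟩
        (a x + s′) * w x + Σb         ≈⟨ +-congʳ (*-congʳ aₓ+s′≈s+bₓ) ⟩
        (s + b x) * w x + Σb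
          ≈⟨ solve 4 (λ s b w Σb → (s :+ b) :* w :+ Σb := s :* w :+ (b :* w :+ Σb)) refl s (b x) (w x) Σb ⟩
        s * w x + (b x * w x + Σb)    ≤⟨ +-monoˡ-≤ _ (*-monoˡ-≤ 0≤s x≤top) ⟩
        s * top + (b x * w x + Σb)    ∎
        where
        Σa = sumₗ (λ e → a e * w e) xs
        Σb = sumₗ (λ e → b e * w e) xs
        -- The surplus left after x. It is nonnegative by the prefix condition at t = x, where every
        -- later element is cut off.
        s′ = (s + b x) - a x
        aₓ+s′≈s+bₓ : a x + s′ ≈ s + b x
        aₓ+s′≈s+bₓ = y+[x-y]≈x (s + b x) (a x)

        head-term : ∀ f → atLeast-on f x x + sumₗ (atLeast-on f x) xs ≈ f x
        head-term f = trans (+-cong (reflexive (atLeast-on-≥ f ≤-refl)) (sumₗ-lighter f x≻xs)) (+-identityʳ (f x))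

        aₓ≤s+bₓ : a x ≤ s + b x
        aₓ≤s+bₓ = begin
          a x                                              ≈⟨ head-term a ⟨
          atLeast-on a x x + sumₗ (atLeast-on a x) xs      ≤⟨ prefix (here ≡.refl) ⟩
          s + (atLeast-on b x x + sumₗ (atLeast-on b x) xs) ≈⟨ +-congˡ (head-term b) ⟩
          s + b x                                          ∎

        prefix′ : ∀ {t} → t ∈ₗ xs → sumₗ (atLeast-on a t) xs ≤ s′ + sumₗ (atLeast-on b t) xs
        prefix′ {t} t∈ = +-cancelˡ-≤ (a x) (begin
          a x + sumₗ (atLeast-on a t) xs                    ≡⟨ ≡.cong (_+ _) (atLeast-on-≥ a t≤x) ⟨
          atLeast-on a t x + sumₗ (atLeast-on a t) xs       ≤⟨ prefix (there t∈) ⟩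
          s + (atLeast-on b t x + sumₗ (atLeast-on b t) xs)
            ≡⟨ ≡.cong (λ y → s + (y + _)) (atLeast-on-≥ b t≤x) ⟩
          s + (b x + sumₗ (atLeast-on b t) xs)              ≈⟨ +-assoc s (b x) _ ⟨
          (s + b x) + sumₗ (atLeast-on b t) xs              ≈⟨ +-congʳ aₓ+s′≈s+bₓ ⟨
          (a x + s′) + sumₗ (atLeast-on b t) xs             ≈⟨ +-assoc (a x) s′ _ ⟩
          a x + (s′ + sumₗ (atLeast-on b t) xs)             ∎)
          where
          t≤x : w t ≤ w x
          t≤x = proj₁ (All.lookup x≻xs t∈)

      weight-via-counts : ∀ X → sum (λ e → on (const 1#) X e * w e) ≈ weight w X
      weight-via-counts X = sum-cong-≋ pointwise
        where
        pointwise : ∀ e → on (const 1#) X e * w e ≈ on w X e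
        pointwise e with does (e ∈? X)
        ... | true  = *-identityˡ (w e)
        ... | false = zeroˡ (w e)

      count-via-sumₗ : ∀ X t → sumₗ (atLeast-on (on (const 1#) X) t) descending ≈ fromℕ ∣ X ↟ t ∣
      count-via-sumₗ X t = begin-equality
        sumₗ (atLeast-on (on (const 1#) X) t) descending ≈⟨ sumₗ-descending _ ⟩
        sum (atLeast-on (on (const 1#) X) t)
          ≈⟨ sum-cong-≋ (λ e → reflexive (on-↟ (const 1#) X t e)) ⟩
        weight (const 1#) (X ↟ t)                        ≈⟨ weight-const-1 (X ↟ t) ⟩
        fromℕ ∣ X ↟ t ∣                                  ∎

      sumₗ-*ˡ : ∀ k (f : Fin n → Carrier) xs → sumₗ (λ e → k * f e) xs ≈ k * sumₗ f xs
      sumₗ-*ˡ k f []       = sym (zeroʳ k)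
      sumₗ-*ˡ k f (x ∷ xs) = trans (+-congˡ (sumₗ-*ˡ k f xs)) (sym (distribˡ k (f x) _))

      sumₗ-cong : ∀ {f g : Fin n → Carrier} → (∀ e → f e ≈ g e) → ∀ xs → sumₗ f xs ≈ sumₗ g xs
      sumₗ-cong f≈g []       = refl
      sumₗ-cong f≈g (x ∷ xs) = +-cong (f≈g x) (sumₗ-cong f≈g xs)

      -- Summation by parts: a weight is a combination of prefix counts with nonnegative
      -- coefficients, so domination of all prefix counts passes to the weights.
      abel : ∀ k A B → (∀ t → ∣ A ↟ t ∣ ℕ.≤ k ℕ.* ∣ B ↟ t ∣) → weight w A ≤ fromℕ k * weight w B
      abel k A B counts = begin
        weight w A                                    ≈⟨ weight-via-counts A ⟨
        sum (λ e → a e * w e)                         ≈⟨ sumₗ-descending _ ⟨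
        sumₗ (λ e → a e * w e) descending
          -- The surplus starts at 0, so `top` may be any upper bound on the weights; `sum w` is one
          -- because the weights are nonnegative.
          ≤⟨ abel-list descending descending-≻ ≤-refl (All.tabulate (λ {e} _ → term≤sum 0≤w e)) (sum-nonneg 0≤w) (λ {t} _ → prefix t) ⟩
        0# * sum w + sumₗ (λ e → b e * w e) descending ≈⟨ +-cong (zeroˡ (sum w)) (sumₗ-descending _) ⟩
        0# + sum (λ e → b e * w e)                    ≈⟨ +-identityˡ _ ⟩
        sum (λ e → b e * w e)                         ≈⟨ sum-cong-≋ (λ e → *-assoc (fromℕ k) _ (w e)) ⟩
        sum (λ e → fromℕ k * (on (const 1#) B e * w e))
          ≈⟨ *-distribˡ-sum (fromℕ k) (λ e → on (const 1#) B e * w e) ⟨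
        fromℕ k * sum (λ e → on (const 1#) B e * w e) ≈⟨ *-congˡ (weight-via-counts B) ⟩
        fromℕ k * weight w B                          ∎
        where
        a b : Fin n → Carrier
        a = on (const 1#) A
        b e = fromℕ k * on (const 1#) B e

        prefix : ∀ t → sumₗ (atLeast-on a t) descending ≤ 0# + sumₗ (atLeast-on b t) descending
        prefix t = begin
          sumₗ (atLeast-on a t) descending                            ≈⟨ count-via-sumₗ A t ⟩
          fromℕ ∣ A ↟ t ∣                                             ≤⟨ fromℕ-mono (counts t) ⟩
          fromℕ (k ℕ.* ∣ B ↟ t ∣)                                     ≈⟨ fromℕ-homo-* k ∣ B ↟ t ∣ ⟩
          fromℕ k * fromℕ ∣ B ↟ t ∣                                   ≈⟨ *-congˡ (count-via-sumₗ B t) ⟨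
          fromℕ k * sumₗ (atLeast-on (on (const 1#) B) t) descending  ≈⟨ sumₗ-*ˡ (fromℕ k) _ descending ⟨
          sumₗ (λ e → fromℕ k * atLeast-on (on (const 1#) B) t e) descending
            ≈⟨ sumₗ-cong (atLeast-on-* (fromℕ k) (on (const 1#) B) t) descending ⟨
          sumₗ (atLeast-on b t) descending                            ≈⟨ +-identityˡ _ ⟨
          0# + sumₗ (atLeast-on b t) descending                       ∎

  -- Expectation over independent coins.

  sumSubsets-cong : ∀ n {f g : Subset n → Carrier} → (∀ Y → f Y ≈ g Y) → sumSubsets n f ≈ sumSubsets n g
  sumSubsets-cong zero    f≈g = f≈g []
  sumSubsets-cong (suc n) f≈g = +-cong (sumSubsets-cong n (f≈g ∘ (inside ∷_))) (sumSubsets-cong n (f≈g ∘ (outside ∷_)))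

  sumSubsets-mono : ∀ n {f g : Subset n → Carrier} → (∀ Y → f Y ≤ g Y) → sumSubsets n f ≤ sumSubsets n g
  sumSubsets-mono zero    f≤g = f≤g []
  sumSubsets-mono (suc n) f≤g = +-mono-≤ (sumSubsets-mono n (f≤g ∘ (inside ∷_))) (sumSubsets-mono n (f≤g ∘ (outside ∷_)))

  sumSubsets-+ : ∀ n (f g : Subset n → Carrier) → sumSubsets n (λ Y → f Y + g Y) ≈ sumSubsets n f + sumSubsets n g
  sumSubsets-+ zero    f g = refl
  sumSubsets-+ (suc n) f g = trans
    (+-cong (sumSubsets-+ n (f ∘ (inside ∷_)) (g ∘ (inside ∷_))) (sumSubsets-+ n (f ∘ (outside ∷_)) (g ∘ (outside ∷_))))
    (solve 4 (λ a b c d → (a :+ b) :+ (c :+ d) := (a :+ c) :+ (b :+ d)) refl _ _ _ _)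

  sumSubsets-*ˡ : ∀ n x (f : Subset n → Carrier) → sumSubsets n (λ Y → x * f Y) ≈ x * sumSubsets n f
  sumSubsets-*ˡ zero    x f = refl
  sumSubsets-*ˡ (suc n) x f = trans
    (+-cong (sumSubsets-*ˡ n x (f ∘ (inside ∷_))) (sumSubsets-*ˡ n x (f ∘ (outside ∷_))))
    (sym (distribˡ x _ _))

  ^-nonneg : ∀ {x} → 0# ≤ x → ∀ k → 0# ≤ x ^ k
  ^-nonneg 0≤x zero    = 0≤1
  ^-nonneg 0≤x (suc k) = *-nonneg 0≤x (^-nonneg 0≤x k)

  module Expectation (p : Carrier) where

    q : Carrier
    q = 1# - p

    p+q≈1 : p + q ≈ 1#
    p+q≈1 = y+[x-y]≈x 1# p

    E : (Subset n → Carrier) → Carrier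
    E = 𝔼 p

    E-cong : {f g : Subset n → Carrier} → (∀ Y → f Y ≈ g Y) → E f ≈ E g
    E-cong {n} f≈g = sumSubsets-cong n (λ Y → *-congˡ (f≈g Y))

    E-mono : 0# ≤ p → 0# ≤ q → {f g : Subset n → Carrier} → (∀ Y → f Y ≤ g Y) → E f ≤ E g
    E-mono {n} 0≤p 0≤q f≤g = sumSubsets-mono n λ Y →
      *-monoˡ-≤ (*-nonneg (^-nonneg 0≤p ∣ Y ∣) (^-nonneg 0≤q ∣ ∁ Y ∣)) (f≤g Y)

    E-+ : ∀ (f g : Subset n → Carrier) → E (λ Y → f Y + g Y) ≈ E f + E g
    E-+ {n} f g = trans (sumSubsets-cong n (λ Y → distribˡ _ (f Y) (g Y))) (sumSubsets-+ n _ _)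

    E-*ˡ : ∀ x (f : Subset n → Carrier) → E (λ Y → x * f Y) ≈ x * E f
    E-*ˡ {n} x f = trans
      (sumSubsets-cong n (λ Y → solve 3 (λ a x y → a :* (x :* y) := x :* (a :* y)) refl _ x (f Y)))
      (sumSubsets-*ˡ n x _)

    E-zero : E {n} (const 0#) ≈ 0#
    E-zero {n} = begin-equality
      E {n} (const 0#)          ≈⟨ E-cong {n} (λ _ → zeroˡ 0#) ⟨
      E {n} (const (0# * 0#))   ≈⟨ E-*ˡ {n} 0# (const 0#) ⟩
      0# * E {n} (const 0#)     ≈⟨ zeroˡ _ ⟩
      0#                        ∎

    E-sum : ∀ {m} (F : Fin m → Subset n → Carrier) → E (λ Y → sum (λ i → F i Y)) ≈ sum (λ i → E (F i))
    E-sum {n} {zero}  F = E-zero {n}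
    E-sum {n} {suc m} F = trans (E-+ (F zero) _) (+-congˡ (E-sum (F ∘ suc)))

    E-suc : ∀ (f : Subset (suc n) → Carrier) → E f ≈ p * E (f ∘ (inside ∷_)) + q * E (f ∘ (outside ∷_))
    E-suc {n} f = +-cong
      (trans (sumSubsets-cong n (λ Y → solve 4 (λ p a b y → p :* a :* b :* y := p :* (a :* b :* y)) refl p (p ^ ∣ Y ∣) (q ^ ∣ ∁ Y ∣) (f (inside ∷ Y)))) (sumSubsets-*ˡ n p _))
      (trans (sumSubsets-cong n (λ Y → solve 4 (λ q a b y → a :* (q :* b) :* y := q :* (a :* b :* y)) refl q (p ^ ∣ Y ∣) (q ^ ∣ ∁ Y ∣) (f (outside ∷ Y)))) (sumSubsets-*ˡ n q _))

    average : ∀ x → p * x + q * x ≈ x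
    average x = trans (sym (distribʳ x p q)) (trans (*-congʳ p+q≈1) (*-identityˡ x))

    E-const : ∀ x → E {n} (const x) ≈ x
    E-const {zero}  x = trans (*-congʳ (*-identityˡ 1#)) (*-identityˡ x)
    E-const {suc n} x = begin-equality
      E {suc n} (const x)                           ≈⟨ E-suc {n} (const x) ⟩
      p * E {n} (const x) + q * E {n} (const x)     ≈⟨ average (E {n} (const x)) ⟩
      E {n} (const x)                               ≈⟨ E-const {n} x ⟩
      x                                             ∎

    -- The argument of g has the coin of a erased, so g is independent of that coin. The induction
    -- conditions on the coins before a; at a itself both outcomes give g the same argument.
    E-inside : ∀ a (g : Subset n → Carrier) →
      E (λ Y → if does (a ∈? Y) then g (Y [ a ]≔ outside) else 0#) ≈ p * E (λ Y → g (Y [ a ]≔ outside))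
    E-inside {suc n} zero g = begin-equality
      E (λ Y → if does (zero ∈? Y) then g (Y [ zero ]≔ outside) else 0#)
        ≈⟨ E-suc (λ Y → if does (zero ∈? Y) then g (Y [ zero ]≔ outside) else 0#) ⟩
      p * E (g ∘ (outside ∷_)) + q * E {n} (const 0#) ≈⟨ +-congˡ (trans (*-congˡ (E-zero {n})) (zeroʳ q)) ⟩
      p * E (g ∘ (outside ∷_)) + 0#                   ≈⟨ +-identityʳ _ ⟩
      -- The erased coin is put back: both of its outcomes contribute the same value.
      p * E (g ∘ (outside ∷_))                        ≈⟨ *-congˡ (average _) ⟨
      p * (p * E (g ∘ (outside ∷_)) + q * E (g ∘ (outside ∷_)))
        ≈⟨ *-congˡ (E-suc (λ Y → g (Y [ zero ]≔ outside))) ⟨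
      p * E (λ Y → g (Y [ zero ]≔ outside))           ∎
    E-inside {suc n} (suc a) g = begin-equality
      E (λ Y → if does (suc a ∈? Y) then g (Y [ suc a ]≔ outside) else 0#)
        ≈⟨ E-suc (λ Y → if does (suc a ∈? Y) then g (Y [ suc a ]≔ outside) else 0#) ⟩
      _ ≈⟨ +-cong (*-congˡ (E-inside a (g ∘ (inside ∷_)))) (*-congˡ (E-inside a (g ∘ (outside ∷_)))) ⟩
      p * (p * E₁) + q * (p * E₀)
        ≈⟨ solve 4 (λ p q x y → p :* (p :* x) :+ q :* (p :* y) := p :* (p :* x :+ q :* y)) refl p q E₁ E₀ ⟩
      p * (p * E₁ + q * E₀)       ≈⟨ *-congˡ (E-suc (λ Y → g (Y [ suc a ]≔ outside))) ⟨
      p * E (λ Y → g (Y [ suc a ]≔ outside)) ∎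
      where
      E₁ = E (λ Y → g (inside ∷ (Y [ a ]≔ outside)))
      E₀ = E (λ Y → g (outside ∷ (Y [ a ]≔ outside)))

    -- The complement of `E-inside`: the two restricted integrands add up to the unrestricted one,
    -- and p + q = 1.
    E-outside : ∀ a (g : Subset n → Carrier) →
      E (λ Y → if does (a ∈? Y) then 0# else g (Y [ a ]≔ outside)) ≈ q * E (λ Y → g (Y [ a ]≔ outside))
    E-outside {n} a g = begin-equality
      Eₒ           ≈⟨ x+y-x≈y (p * Eg) Eₒ ⟨
      p * Eg + Eₒ - p * Eg   ≈⟨ +-congʳ (+-congʳ (E-inside a g)) ⟨
      Eᵢ + Eₒ - p * Eg       ≈⟨ +-congʳ (E-+ fᵢ fₒ) ⟨
      E (λ Y → fᵢ Y + fₒ Y) - p * Eg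
                             ≈⟨ +-congʳ (E-cong merge) ⟩
      Eg - p * Eg            ≈⟨ +-congʳ (average Eg) ⟨
      p * Eg + q * Eg - p * Eg ≈⟨ x+y-x≈y (p * Eg) (q * Eg) ⟩
      q * Eg                 ∎
      where
      Eg = E (λ Y → g (Y [ a ]≔ outside))
      fᵢ fₒ : Subset n → Carrier
      fᵢ Y = if does (a ∈? Y) then g (Y [ a ]≔ outside) else 0#
      fₒ Y = if does (a ∈? Y) then 0# else g (Y [ a ]≔ outside)
      Eᵢ = E fᵢ
      Eₒ = E fₒ
      merge : ∀ Y → fᵢ Y + fₒ Y ≈ g (Y [ a ]≔ outside)
      merge Y with does (a ∈? Y)
      ... | true  = +-identityʳ _
      ... | false = +-identityˡ _

    module _ {m} (agent : Fin m → Fin n) (w : Fin m → Carrier)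
             {ℓ} {D : Subset n → Fin m → Set ℓ} (D? : ∀ Y e → Dec (D Y e)) where

      -- The expected weight of e on the event D, judged with the agent of e removed. Its sum over e
      -- is the common quantity S of which the two outcomes of the coin receive the shares p and q.
      resampled : Fin m → Carrier
      resampled e = E (λ Y → if does (D? (Y [ agent e ]≔ outside) e) then w e else 0#)

      E-agent-inside : (U : Subset n → Subset m) →
        (∀ Y e → e ∈ U Y → agent e ∈ Y × D (Y [ agent e ]≔ outside) e) →
        (∀ Y e → agent e ∈ Y → D (Y [ agent e ]≔ outside) e → e ∈ U Y) →
        E (weight w ∘ U) ≈ p * sum resampled
      E-agent-inside U U⁻ U⁺ = begin-equality
        E (weight w ∘ U)                   ≈⟨ E-sum (λ e Y → on w (U Y) e) ⟩
        sum (λ e → E (λ Y → on w (U Y) e))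
          ≈⟨ sum-cong-≋ (λ e → trans (E-cong (pointwise e)) (E-inside (agent e) (λ Y → if does (D? Y e) then w e else 0#))) ⟩
        sum (λ e → p * resampled e)        ≈⟨ *-distribˡ-sum p resampled ⟨
        p * sum resampled                  ∎
        where
        pointwise : ∀ e Y → on w (U Y) e ≈
          (if does (agent e ∈? Y) then (if does (D? (Y [ agent e ]≔ outside) e) then w e else 0#) else 0#)
        pointwise e Y with agent e ∈? Y | D? (Y [ agent e ]≔ outside) e
        ... | no a∉  | _     = reflexive (on-∉ {X = U Y} w (a∉ ∘ proj₁ ∘ U⁻ Y e))
        ... | yes a∈ | yes d = reflexive (on-∈ w (U⁺ Y e a∈ d))
        ... | yes _  | no ¬d = reflexive (on-∉ {X = U Y} w (¬d ∘ proj₂ ∘ U⁻ Y e))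

      E-agent-outside : (V : Subset n → Subset m) →
        (∀ Y e → e ∈ V Y → agent e ∉ Y × D (Y [ agent e ]≔ outside) e) →
        (∀ Y e → agent e ∉ Y → D (Y [ agent e ]≔ outside) e → e ∈ V Y) →
        E (weight w ∘ V) ≈ q * sum resampled
      E-agent-outside V V⁻ V⁺ = begin-equality
        E (weight w ∘ V)                   ≈⟨ E-sum (λ e Y → on w (V Y) e) ⟩
        sum (λ e → E (λ Y → on w (V Y) e))
          ≈⟨ sum-cong-≋ (λ e → trans (E-cong (pointwise e)) (E-outside (agent e) (λ Y → if does (D? Y e) then w e else 0#))) ⟩
        sum (λ e → q * resampled e)        ≈⟨ *-distribˡ-sum q resampled ⟨
        q * sum resampled                  ∎
        where
        pointwise : ∀ e Y → on w (V Y) e ≈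
          (if does (agent e ∈? Y) then 0# else (if does (D? (Y [ agent e ]≔ outside) e) then w e else 0#))
        pointwise e Y with agent e ∈? Y | D? (Y [ agent e ]≔ outside) e
        ... | yes a∈ | _     = reflexive (on-∉ {X = V Y} w (λ e∈ → proj₁ (V⁻ Y e e∈) a∈))
        ... | no a∉  | yes d = reflexive (on-∈ w (V⁺ Y e a∉ d))
        ... | no _   | no ¬d = reflexive (on-∉ {X = V Y} w (¬d ∘ proj₂ ∘ V⁻ Y e))

-- Heavy prefixes, cores and the greedy algorithm

module Heaviness {c ℓ₁ ℓ₂} (R : EuclideanField c ℓ₁ ℓ₂) {n : ℕ}
    (w : Fin n → EuclideanField.Carrier R)
    (0≤w : ∀ e → EuclideanField._≤_ R (EuclideanField.0# R) (w e))
    (w-injective : ∀ {e f} → EuclideanField._≈_ R (w e) (w f) → e ≡ f) where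
  open EuclideanField R hiding (zero)
  open Weighted R
  open OrderedField R
  open Ordered w w-injective public

  ≻-isStrictPartialOrder : IsStrictPartialOrder _≡_ _≻_
  ≻-isStrictPartialOrder = record
    { isEquivalence = ≡.isEquivalence
    ; irrefl        = λ { ≡.refl (_ , w≉w) → w≉w refl }
    ; trans         = λ f<e g<f → NonStrictToStrict.<-trans _≈_ _≤_
        (IsDecTotalOrder.isPartialOrder isDecTotalOrder) g<f f<e
    ; <-resp-≈      = (λ { ≡.refl e≻f → e≻f }) , (λ { ≡.refl e≻f → e≻f })
    }

  open IsStrictPartialOrder ≻-isStrictPartialOrder public
    using () renaming (trans to ≻-trans; irrefl to ≻-irrefl)

  -- Recursion along this relation passes to heavier elements, in the order of the greedy algorithm;
  -- recursion along `≺-wellFounded` passes to lighter ones.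
  ≻-wellFounded : WellFounded _≻_
  ≻-wellFounded = spo-wellFounded ≻-isStrictPartialOrder

  ≺-wellFounded : WellFounded (λ e f → f ≻ e)
  ≺-wellFounded = spo-noetherian ≻-isStrictPartialOrder

  heavier-or-equal : ∀ {e f} → w e ≤ w f → f ≻ e ⊎ f ≡ e
  heavier-or-equal {e} {f} e≤f with w e ≈? w f
  ... | yes e≈f = inj₂ (≡.sym (w-injective e≈f))
  ... | no e≉f  = inj₁ (e≤f , e≉f)

  above? : ∀ X e f → Dec (f ∈ X × f ≻ e)
  above? X e f = (f ∈? X) ×-dec (w e <? w f)

  -- The strict prefix whose hull `PCore` tests. Counting uses the inclusive prefix `_↟_` instead.
  above : Subset n → Fin n → Subset n
  above X e = ⟦ above? X e ⟧

  ∈above⁺ : ∀ {X e f} → f ∈ X → f ≻ e → f ∈ above X e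
  ∈above⁺ {X} {e} f∈X f≻e = ∈⟦⟧⁺ (above? X e) (f∈X , f≻e)

  ∈above⁻ : ∀ X e {f} → f ∈ above X e → f ∈ X × f ≻ e
  ∈above⁻ X e = ∈⟦⟧⁻ (above? X e)

  above⊆ : ∀ {X e} → above X e ⊆ X
  above⊆ {X} {e} = proj₁ ∘ ∈above⁻ X e

  ∉above : ∀ {X e} → e ∉ above X e
  ∉above {X} {e} e∈ = ≻-irrefl ≡.refl (proj₂ (∈above⁻ X e e∈))

  above-monoˡ : ∀ {X Y e} → X ⊆ Y → above X e ⊆ above Y e
  above-monoˡ {X} {e = e} X⊆Y f∈ = let f∈X , f≻e = ∈above⁻ X e f∈ in ∈above⁺ (X⊆Y f∈X) f≻e

  above-monoʳ : ∀ {X e f} → f ≻ e → above X f ⊆ above X e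
  above-monoʳ {X} {f = f} f≻e g∈ = let g∈X , g≻f = ∈above⁻ X f g∈ in ∈above⁺ g∈X (≻-trans g≻f f≻e)

  ∈↟⁺ : ∀ {X t e} → e ∈ X → w t ≤ w e → e ∈ X ↟ t
  ∈↟⁺ {X} {t} e∈X t≤e = ∈⟦⟧⁺ (atLeast? X t) (e∈X , t≤e)

  ∈↟⁻ : ∀ X t {e} → e ∈ X ↟ t → e ∈ X × w t ≤ w e
  ∈↟⁻ X t = ∈⟦⟧⁻ (atLeast? X t)

  ↟⊆ : ∀ {X t} → X ↟ t ⊆ X
  ↟⊆ {X} {t} = proj₁ ∘ ∈↟⁻ X t

  above⊆↟ : ∀ {X t e} → w t ≤ w e → above X e ⊆ X ↟ t
  above⊆↟ {X} {e = e} t≤e f∈ = let f∈X , e≤f , _ = ∈above⁻ X e f∈ in ∈↟⁺ f∈X (≤-trans t≤e e≤f)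

  -- Weighted hull bounds, primitive cores and greedy runs.

  module _ (𝓢 : IndependenceSystem n) where
    open IndependenceSystem 𝓢

    -- An element e of J that is at least as heavy as t lies in the hull of the part of X above e,
    -- which is contained in `X ↟ t`. So the hull bound applies on every prefix, as `abel` requires.
    hull-weight : ∀ {k X I J} → HullBounded 𝓢 k → X ⊆ ground → Indep I → J ⊆ I →
      (∀ {e} → e ∈ J → e ∉ X) → (∀ {e} → e ∈ J → e ∈ PHull 𝓢 (above X e)) →
      weight w J ≤ fromℕ k * weight w (X ─ I)
    hull-weight {k} {X} {I} {J} bounded X⊆S indI J⊆I dis J⊆H = abel 0≤w k J (X ─ I) λ t →
      ℕ.≤-trans
        (bounded {X ↟ t} {I} {J ↟ t} (X⊆S ∘ ↟⊆) indI (J⊆I ∘ ↟⊆) (λ e∈J e∈X → dis (↟⊆ e∈J) (↟⊆ e∈X))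
          (λ e∈ → let e∈J , t≤e = ∈↟⁻ J t e∈ in PHull-mono 𝓢 (above⊆↟ t≤e) (J⊆H e∈J)))
        (ℕ.*-monoʳ-≤ k (p⊆q⇒∣p∣≤∣q∣ λ e∈ → let e∈X , t≤e = ∈↟⁻ X t (p─q⊆p (X ↟ t) I e∈)
          in ∈↟⁺ (x∈p∧x∉q⇒x∈p─q e∈X (x∈p─q⇒x∉q {p = X ↟ t} e∈)) t≤e))

    inPCore? : ∀ X e → Dec (e ∈ X × e ∉ PHull 𝓢 (above X e))
    inPCore? X e = (e ∈? X) ×-dec ¬? (e ∈? PHull 𝓢 (above X e))

    ∈PCore⁺ : ∀ {X e} → e ∈ X → e ∉ PHull 𝓢 (above X e) → e ∈ PCore w 𝓢 X
    ∈PCore⁺ {X} e∈X e∉H = ∈⟦⟧⁺ (inPCore? X) (e∈X , e∉H)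

    ∈PCore⁻ : ∀ {X e} → e ∈ PCore w 𝓢 X → e ∈ X × e ∉ PHull 𝓢 (above X e)
    ∈PCore⁻ {X} = ∈⟦⟧⁻ (inPCore? X)

    PCore⊆ : ∀ {X} → PCore w 𝓢 X ⊆ X
    PCore⊆ = proj₁ ∘ ∈PCore⁻

    ∉PCore⇒∈PHull : ∀ {X e} → e ∈ X → e ∉ PCore w 𝓢 X → e ∈ PHull 𝓢 (above X e)
    ∉PCore⇒∈PHull e∈X e∉ = decidable-stable (_ ∈? _) λ e∉H → e∉ (∈PCore⁺ e∈X e∉H)

    Indep-∅ : Indep ∅
    Indep-∅ = downward-closed ⊥⊆ (proj₂ nonempty)

    -- The lightest element of a circuit lies in the hull of the others.
    PCore-indep : ∀ {X} → X ⊆ ground → Indep (PCore w 𝓢 X)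
    PCore-indep {X} X⊆S = decidable-stable (Indep? _) λ dep →
      let C , circuit , C⊆ = dependent⇒circuit 𝓢 (X⊆S ∘ PCore⊆) dep
      in proj₁ (proj₂ circuit)
           -- A circuit inside the core would have no lightest element; it would then be empty,
           -- hence independent.
           (downward-closed {J = C} (λ {e} e∈C → ⊥-elim (no-lightest circuit C⊆ (≺-wellFounded e) e∈C)) Indep-∅)
      where
      no-lightest : ∀ {C} → IsCircuit 𝓢 C → C ⊆ PCore w 𝓢 X → ∀ {e} → Acc (λ e f → f ≻ e) e → e ∉ C
      no-lightest {C} circuit C⊆ {e} (acc rec) e∈C with any? (λ f → (f ∈? C) ×-dec (w f <? w e))
      ... | yes (f , f∈C , e≻f) = no-lightest circuit C⊆ (rec e≻f) f∈C
      ... | no lightest = proj₂ (∈PCore⁻ (C⊆ e∈C)) (∈PHull⁺ 𝓢 circuit C⊆X+e e∈C)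
        where
        C⊆X+e : C ⊆ above X e ∪ ⁅ e ⁆
        C⊆X+e {f} f∈C with heavier-or-equal (≮⇒≥ λ f<e → lightest (f , f∈C , f<e))
        ... | inj₁ f≻e    = p⊆p∪q _ (∈above⁺ (PCore⊆ (C⊆ f∈C)) f≻e)
        ... | inj₂ ≡.refl = y∈p∪⁅y⁆ _ e

    module _ (matroid : IsMatroid 𝓢) {X : Subset n} (X⊆S : X ⊆ ground) where
      private
        B = PCore w 𝓢 X

      -- Induction from the heaviest element. Once all heavier rejected elements are blocked,
      -- `above B f` is a basis of `above X f`, and such a basis cannot take an element of the hull.
      PCore-blocks : ∀ {f} → f ∈ X → f ∉ B → ¬ Indep (above B f ∪ ⁅ f ⁆)
      PCore-blocks {f} = go (≻-wellFounded f)
        where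
        go : ∀ {f} → Acc _≻_ f → f ∈ X → f ∉ B → ¬ Indep (above B f ∪ ⁅ f ⁆)
        go {f} (acc rec) f∈X f∉B = hull⇒basis-dependent 𝓢 matroid (∉PCore⇒∈PHull f∈X f∉B) ∉above
          (unaugmentable⇒basis 𝓢 (above X f) (downward-closed above⊆ (PCore-indep X⊆S)) (above-monoˡ PCore⊆)
            λ {g} g∈ g∉ ind → let g∈X , g≻f = ∈above⁻ X f g∈ in
              go (rec g≻f) g∈X (λ g∈B → g∉ (∈above⁺ g∈B g≻f))
                (downward-closed (∪⁅⁆-monoˡ (above-monoʳ g≻f)) ind))

      -- In a matroid the primitive core is the greedy basis, which spans every heavy prefix.
      PCore-prefix-basis : ∀ t → IsBasisOf 𝓢 (X ↟ t) (B ↟ t)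
      PCore-prefix-basis t = unaugmentable⇒basis 𝓢 (X ↟ t) (downward-closed ↟⊆ (PCore-indep X⊆S))
        (λ e∈ → let e∈B , t≤e = ∈↟⁻ B t e∈ in ∈↟⁺ (PCore⊆ e∈B) t≤e)
        (λ f∈ f∉ ind → let f∈X , t≤f = ∈↟⁻ X t f∈ in
          PCore-blocks f∈X (λ f∈B → f∉ (∈↟⁺ f∈B t≤f)) (downward-closed (∪⁅⁆-monoˡ (above⊆↟ t≤f)) ind))

      -- On each prefix J is spanned by X and is therefore no larger than the basis `B ↟ t`. It can
      -- take the place of B in the count, and X ─ B fills up the rest of X.
      matroid-hull-weight : ∀ {J} → Indep J → (∀ {e} → e ∈ J → e ∉ X) →
        (∀ {e} → e ∈ J → e ∈ PHull 𝓢 (above X e)) →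
        weight w J + weight w (X ─ B) ≤ weight w X
      matroid-hull-weight {J} indJ dis J⊆H = let open ≤-Reasoning in begin
        weight w J + weight w (X ─ B) ≈⟨ weight-disjoint-∪ w (λ e∈J e∈X─B → dis e∈J (p─q⊆p X B e∈X─B)) ⟨
        weight w (J ∪ (X ─ B))        ≤⟨ abel 0≤w 1 (J ∪ (X ─ B)) X counts ⟩
        fromℕ 1 * weight w X          ≈⟨ *-congʳ (+-identityʳ 1#) ⟩
        1# * weight w X               ≈⟨ *-identityˡ _ ⟩
        weight w X                    ∎
        where
        J-rank : ∀ t → ∣ J ↟ t ∣ ℕ.≤ ∣ B ↟ t ∣
        J-rank t = hull-rank 𝓢 matroid (PCore-prefix-basis t) (downward-closed ↟⊆ indJ)
          (λ e∈ → let e∈J , t≤e = ∈↟⁻ J t e∈ in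
            inj₂ (PHull-mono 𝓢 (above⊆↟ t≤e) (J⊆H e∈J) , (dis e∈J ∘ ↟⊆)))

        prefix⊆ : ∀ t → (J ∪ (X ─ B)) ↟ t ⊆ J ↟ t ∪ (X ↟ t ─ B ↟ t)
        prefix⊆ t e∈ with ∈↟⁻ (J ∪ (X ─ B)) t e∈
        ... | e∈∪ , t≤e with x∈p∪q⁻ J (X ─ B) e∈∪
        ...   | inj₁ e∈J   = x∈p∪q⁺ (inj₁ (∈↟⁺ e∈J t≤e))
        ...   | inj₂ e∈X─B = x∈p∪q⁺ (inj₂ (x∈p∧x∉q⇒x∈p─q (∈↟⁺ (p─q⊆p X B e∈X─B) t≤e)
                                                           (x∈p─q⇒x∉q {p = X} e∈X─B ∘ ↟⊆)))

        counts : ∀ t → ∣ (J ∪ (X ─ B)) ↟ t ∣ ℕ.≤ 1 ℕ.* ∣ X ↟ t ∣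
        counts t = begin
          ∣ (J ∪ (X ─ B)) ↟ t ∣                       ≤⟨ p⊆q⇒∣p∣≤∣q∣ (prefix⊆ t) ⟩
          ∣ J ↟ t ∪ (X ↟ t ─ B ↟ t) ∣
            ≡⟨ ∣p∪q∣≡∣p∣+∣q∣ {p = J ↟ t} (λ e∈J e∈ → dis (↟⊆ e∈J) (↟⊆ (p─q⊆p (X ↟ t) (B ↟ t) e∈))) ⟩
          ∣ J ↟ t ∣ ℕ.+ ∣ X ↟ t ─ B ↟ t ∣             ≤⟨ ℕ.+-monoˡ-≤ _ (J-rank t) ⟩
          ∣ B ↟ t ∣ ℕ.+ ∣ X ↟ t ─ B ↟ t ∣
            ≤⟨ ℕ.+-monoˡ-≤ _ (p⊆q⇒∣p∣≤∣q∣ λ e∈ → x∈p∩q⁺ (proj₁ (proj₂ (PCore-prefix-basis t)) e∈ , e∈)) ⟩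
          ∣ X ↟ t ∩ B ↟ t ∣ ℕ.+ ∣ X ↟ t ─ B ↟ t ∣     ≡⟨ ∣p∣≡∣p∩q∣+∣p─q∣ (X ↟ t) (B ↟ t) ⟨
          ∣ X ↟ t ∣                                   ≡⟨ ℕ.*-identityˡ _ ⟨
          1 ℕ.* ∣ X ↟ t ∣                             ∎
          where open ℕ.≤-Reasoning

    -- The greedy test for e read off a final set G: the elements of G above e are exactly those
    -- present when e is processed.
    Adm : Subset n → Fin n → Set
    Adm G e = Indep (above G e ∪ ⁅ e ⁆)

    private
      run : Subset n → List (Fin n) → Subset n
      run = foldl (greedyStep 𝓢)

    greedyStep-⊇ : ∀ I e → I ⊆ greedyStep 𝓢 I e
    greedyStep-⊇ I e with Indep? (I ∪ ⁅ e ⁆)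
    ... | yes _ = p⊆p∪q _
    ... | no _  = id

    greedyStep-⊆ : ∀ I e {f} → f ∈ greedyStep 𝓢 I e → f ∈ I ⊎ f ≡ e
    greedyStep-⊆ I e f∈ with Indep? (I ∪ ⁅ e ⁆)
    ... | yes _ = x∈p∪⁅y⁆⁻ I f∈
    ... | no _  = inj₁ f∈

    greedyStep-indep : ∀ I e → Indep I → Indep (greedyStep 𝓢 I e)
    greedyStep-indep I e indI with Indep? (I ∪ ⁅ e ⁆)
    ... | yes ind = ind
    ... | no _    = indI

    run-⊇ : ∀ I xs → I ⊆ run I xs
    run-⊇ I []       = id
    run-⊇ I (x ∷ xs) = run-⊇ (greedyStep 𝓢 I x) xs ∘ greedyStep-⊇ I x

    run-⊆ : ∀ I xs {f} → f ∈ run I xs → f ∈ I ⊎ f ∈ₗ xs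
    run-⊆ I []       f∈ = inj₁ f∈
    run-⊆ I (x ∷ xs) f∈ with run-⊆ (greedyStep 𝓢 I x) xs f∈
    ... | inj₂ f∈xs = inj₂ (there f∈xs)
    ... | inj₁ f∈I′ = [ inj₁ , inj₂ ∘ here ]′ (greedyStep-⊆ I x f∈I′)

    run-indep : ∀ I xs → Indep I → Indep (run I xs)
    run-indep I []       indI = indI
    run-indep I (x ∷ xs) indI = run-indep _ xs (greedyStep-indep I x indI)

    -- The invariant is that I is heavier than everything still to come. Elements added after x are
    -- lighter than x, so the state met by x is the part of the final set above x.
    run-spec : ∀ I xs → AllPairs _≻_ xs → (∀ {f} → f ∈ I → All (f ≻_) xs) → ∀ {e} → e ∈ₗ xs →
               (e ∈ run I xs × Adm (run I xs) e) ⊎ (e ∉ run I xs × ¬ Adm (run I xs) e)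
    run-spec I (x ∷ xs) (x≻xs ∷ xs↘) I≻ (there e∈xs) =
      run-spec (greedyStep 𝓢 I x) xs xs↘
        (λ f∈ → [ All.tail ∘ I≻ , (λ { ≡.refl → x≻xs }) ]′ (greedyStep-⊆ I x f∈)) e∈xs
    run-spec I (x ∷ xs) (x≻xs ∷ xs↘) I≻ (here ≡.refl) with Indep? (I ∪ ⁅ x ⁆)
    ... | yes ind = inj₁ (run-⊇ (I ∪ ⁅ x ⁆) xs (y∈p∪⁅y⁆ I x) , downward-closed (∪⁅⁆-monoˡ above⊆I) ind)
      where
      above⊆I : above (run (I ∪ ⁅ x ⁆) xs) x ⊆ I
      above⊆I f∈ with ∈above⁻ (run (I ∪ ⁅ x ⁆) xs) x f∈
      ... | f∈run , f≻x with run-⊆ (I ∪ ⁅ x ⁆) xs f∈run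
      ...   | inj₂ f∈xs = ⊥-elim (≻-irrefl ≡.refl (≻-trans f≻x (All.lookup x≻xs f∈xs)))
      ...   | inj₁ f∈I+x with x∈p∪⁅y⁆⁻ I f∈I+x
      ...     | inj₁ f∈I    = f∈I
      ...     | inj₂ ≡.refl = ⊥-elim (≻-irrefl ≡.refl f≻x)
    ... | no dep = inj₂
      ( [ (λ x∈I → ≻-irrefl ≡.refl (All.head (I≻ x∈I))) , (λ x∈xs → ≻-irrefl ≡.refl (All.lookup x≻xs x∈xs)) ]′ ∘ run-⊆ I xs
      , λ adm → dep (downward-closed (∪⁅⁆-monoˡ λ f∈I → ∈above⁺ (run-⊇ I xs f∈I) (All.head (I≻ f∈I))) adm))

    private
      G : Subset n → Subset n
      G = Greedy w 𝓢

    Greedy-indep : ∀ X → Indep (G X)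
    Greedy-indep X = run-indep ∅ (filter (_∈? X) descending) Indep-∅

    Greedy-spec : ∀ {X e} → e ∈ X → (e ∈ G X × Adm (G X) e) ⊎ (e ∉ G X × ¬ Adm (G X) e)
    Greedy-spec {X} {e} e∈X = run-spec ∅ _ (AllPairs.filter⁺ (_∈? X) descending-≻) (⊥-elim ∘ ∉⊥)
      (∈-filter⁺ (_∈? X) (∈-descending e) e∈X)

    Greedy⊆ : ∀ {X} → G X ⊆ X
    Greedy⊆ {X} e∈ with run-⊆ ∅ (filter (_∈? X) descending) e∈
    ... | inj₁ e∈∅ = ⊥-elim (∉⊥ e∈∅)
    ... | inj₂ e∈l = proj₂ (∈-filter⁻ (_∈? X) {xs = descending} e∈l)

    ∈Greedy⁻ : ∀ {X e} → e ∈ G X → Adm (G X) e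
    ∈Greedy⁻ e∈ with Greedy-spec (Greedy⊆ e∈)
    ... | inj₁ (_ , adm) = adm
    ... | inj₂ (e∉ , _)  = ⊥-elim (e∉ e∈)

    ∈Greedy⁺ : ∀ {X e} → e ∈ X → Adm (G X) e → e ∈ G X
    ∈Greedy⁺ e∈X adm with Greedy-spec e∈X
    ... | inj₁ (e∈ , _)   = e∈
    ... | inj₂ (_ , ¬adm) = ⊥-elim (¬adm adm)

    module _ {X X′ : Subset n} (X⊆X′ : X ⊆ X′) where

      -- Going down from the heaviest element, the two runs can first part only at an element of X′
      -- outside X that is admissible over G X. The hypothesis excludes such elements above e.
      above-Greedy-≡ : ∀ {e} → (∀ {f} → f ≻ e → f ∈ X′ → f ∉ X → ¬ Adm (G X) f) →
                       above (G X) e ≡ above (G X′) e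
      above-Greedy-≡ {e} = go (≻-wellFounded e)
        where
        go : ∀ {e} → Acc _≻_ e → (∀ {f} → f ≻ e → f ∈ X′ → f ∉ X → ¬ Adm (G X) f) →
             above (G X) e ≡ above (G X′) e
        go {e} (acc rec) new = ⊆-antisym ⊆₁ ⊆₂
          where
          Adm-≡ : ∀ {f} → f ≻ e → Adm (G X) f ≡ Adm (G X′) f
          Adm-≡ {f} f≻e = ≡.cong (λ A → Indep (A ∪ ⁅ f ⁆)) (go (rec f≻e) (λ g≻f → new (≻-trans g≻f f≻e)))

          ⊆₁ : above (G X) e ⊆ above (G X′) e
          ⊆₁ f∈ = let f∈G , f≻e = ∈above⁻ (G X) e f∈ in
            ∈above⁺ (∈Greedy⁺ (X⊆X′ (Greedy⊆ f∈G)) (≡.subst id (Adm-≡ f≻e) (∈Greedy⁻ f∈G))) f≻e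

          ⊆₂ : above (G X′) e ⊆ above (G X) e
          ⊆₂ {f} f∈ with ∈above⁻ (G X′) e f∈
          ... | f∈G , f≻e with ≡.subst id (≡.sym (Adm-≡ f≻e)) (∈Greedy⁻ f∈G) | f ∈? X
          ...   | adm | yes f∈X = ∈above⁺ (∈Greedy⁺ f∈X adm) f≻e
          ...   | adm | no f∉X  = ⊥-elim (new f≻e (Greedy⊆ f∈G) f∉X adm)

-- Top-relevant edges

∈-[]≔outside⁻ : ∀ {n} {x : Fin n} (Y : Subset n) a → x ∈ Y [ a ]≔ outside → x ∈ Y × x ≢ a
∈-[]≔outside⁻ (y ∷ Y) zero    (there x∈) = there x∈ , λ ()
∈-[]≔outside⁻ (y ∷ Y) (suc a) here       = here , λ ()
∈-[]≔outside⁻ (y ∷ Y) (suc a) (there x∈) =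
  let x∈Y , x≢a = ∈-[]≔outside⁻ Y a x∈ in there x∈Y , λ { ≡.refl → x≢a ≡.refl }

∈-[]≔outside⁺ : ∀ {n} {x a : Fin n} {Y : Subset n} → x ∈ Y → x ≢ a → x ∈ Y [ a ]≔ outside
∈-[]≔outside⁺ {x = zero}  {zero}  x∈         x≢a = ⊥-elim (x≢a ≡.refl)
∈-[]≔outside⁺ {x = zero}  {suc a} here       x≢a = here
∈-[]≔outside⁺ {x = suc x} {zero}  (there x∈) x≢a = there x∈
∈-[]≔outside⁺ {x = suc x} {suc a} (there x∈) x≢a = there (∈-[]≔outside⁺ x∈ (x≢a ∘ ≡.cong suc))

∉⇒[]≔outside : ∀ {n} {a : Fin n} {Y : Subset n} → a ∉ Y → Y [ a ]≔ outside ≡ Y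
∉⇒[]≔outside {a = a} {Y} a∉Y = ⊆-antisym (proj₁ ∘ ∈-[]≔outside⁻ Y a)
  (λ x∈Y → ∈-[]≔outside⁺ x∈Y λ { ≡.refl → a∉Y x∈Y })

term≤foldr-⊔ : ∀ {n} (f : Fin n → ℕ) i → f i ℕ.≤ Vector.foldr ℕ._⊔_ 0 f
term≤foldr-⊔ f zero    = ℕ.m≤m⊔n (f zero) _
term≤foldr-⊔ f (suc i) = ℕ.≤-trans (term≤foldr-⊔ (f ∘ suc) i) (ℕ.m≤n⊔m (f zero) _)

term≤foldr-+ : ∀ {n} (f : Fin n → ℕ) i → f i ℕ.≤ Vector.foldr ℕ._+_ 0 f
term≤foldr-+ f zero    = ℕ.m≤m+n (f zero) _
term≤foldr-+ f (suc i) = ℕ.≤-trans (term≤foldr-+ (f ∘ suc) i) (ℕ.m≤n+m _ (f zero))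

module Analysis {c ℓ₁ ℓ₂} (R : EuclideanField c ℓ₁ ℓ₂) (𝔾 : Setting R) where
  open EuclideanField R hiding (zero)
  open Weighted R
  open OrderedField R
  open Setting 𝔾
  open Heaviness R w w-nonneg w-injective
  open IndependenceSystem
  open ≤-Reasoning

  ∈ground-transfer⁺ : ∀ {m n} (end : Fin m → Fin n) (𝓢 : IndependenceSystem n) {e} →
                      end e ∈ ground 𝓢 → e ∈ ground (transfer end 𝓢)
  ∈ground-transfer⁺ end 𝓢 = ∈⟦⟧⁺ (λ e → end e ∈? ground 𝓢)

  agent-covered : ∀ e → ∃[ j ] e ∈ ground (𝓘A j)
  agent-covered e =
    let j , a∈ = ∈⋃-tabulate (ground ∘ 𝓙) (≡.subst (agent e ∈_) (≡.sym A-cover) ∈⊤)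
    in j , ∈ground-transfer⁺ agent (𝓙 j) a∈

  item-covered : ∀ e → ∃[ j ] e ∈ ground (𝓘B j)
  item-covered e =
    let j , b∈ = ∈⋃-tabulate (ground ∘ 𝓛) (≡.subst (item e ∈_) (≡.sym B-cover) ∈⊤)
    in j , ∈ground-transfer⁺ item (𝓛 j) b∈

  δ? : ∀ Y e → Dec (agent e ∈ Y)
  δ? Y e = agent e ∈? Y

  opaque
    H : Subset #A → Subset #E
    H Y = Greedy w 𝓕 (δ Y)

    H≡Greedy : ∀ Y → H Y ≡ Greedy w 𝓕 (δ Y)
    H≡Greedy Y = ≡.refl

    H-indep : ∀ Y → Indep 𝓕 (H Y)
    H-indep Y = Greedy-indep 𝓕 (δ Y)

  opaque
    unfolding H

    -- For an agent in Y this amounts to membership in `H Y`, and for an agent outside Y to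
    -- greedy-relevance. One predicate thus serves both outcomes of the coin.
    Admissible : Subset #A → Fin #E → Set
    Admissible Y = Adm 𝓕 (H Y)

    admissible? : ∀ Y e → Dec (Admissible Y e)
    admissible? Y e = Indep? 𝓕 (above (H Y) e ∪ ⁅ e ⁆)

    admissible-≡ : ∀ {Y Y′ e} → above (H Y) e ≡ above (H Y′) e → Admissible Y e → Admissible Y′ e
    admissible-≡ {e = e} = ≡.subst (λ A → Indep 𝓕 (A ∪ ⁅ e ⁆))

    H⊆δ : ∀ {Y e} → e ∈ H Y → agent e ∈ Y
    H⊆δ {Y} e∈ = ∈⟦⟧⁻ (δ? Y) (Greedy⊆ 𝓕 {δ Y} e∈)

    ∈H⁺ : ∀ {Y e} → agent e ∈ Y → Admissible Y e → e ∈ H Y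
    ∈H⁺ {Y} a∈Y = ∈Greedy⁺ 𝓕 {δ Y} (∈⟦⟧⁺ (δ? Y) a∈Y)

    ∈H⁻ : ∀ {Y e} → e ∈ H Y → Admissible Y e
    ∈H⁻ {Y} = ∈Greedy⁻ 𝓕 {δ Y}

    above-H-≡ : ∀ {Y Y′ e} → Y ⊆ Y′ →
      (∀ {f} → f ≻ e → agent f ∈ Y′ → agent f ∉ Y → ¬ Admissible Y f) → above (H Y) e ≡ above (H Y′) e
    above-H-≡ {Y} {Y′} Y⊆Y′ none = above-Greedy-≡ 𝓕 {δ Y} {δ Y′}
      (λ e∈ → ∈⟦⟧⁺ (δ? Y′) (Y⊆Y′ (∈⟦⟧⁻ (δ? Y) e∈)))
      (λ f≻e f∈ f∉ → none f≻e (∈⟦⟧⁻ (δ? Y′) f∈) (f∉ ∘ ∈⟦⟧⁺ (δ? Y)))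

  module _ {Y e} (a∉Y : agent e ∉ Y) where
    private
      X⁺ = δ Y ∪ ⁅ e ⁆

      -- The only new candidate is e, which is not above itself.
      above-relevant : above (Greedy w 𝓕 (δ Y)) e ≡ above (Greedy w 𝓕 X⁺) e
      above-relevant = above-Greedy-≡ 𝓕 {δ Y} {X⁺} (p⊆p∪q ⁅ e ⁆) λ f≻e f∈ f∉ →
        [ ⊥-elim ∘ f∉ , (λ f≡e → ⊥-elim (≻-irrefl f≡e f≻e)) ]′ (x∈p∪⁅y⁆⁻ (δ Y) f∈)

    opaque
      unfolding Admissible

      relevant⇒admissible : IsRelevant (δ Y) e → Admissible Y e
      relevant⇒admissible (_ , e∈) =
        ≡.subst (λ A → Indep 𝓕 (A ∪ ⁅ e ⁆)) (≡.sym above-relevant) (∈Greedy⁻ 𝓕 {X⁺} e∈)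

      admissible⇒relevant : Admissible Y e → IsRelevant (δ Y) e
      admissible⇒relevant adm = a∉Y ∘ ∈⟦⟧⁻ (δ? Y) ,
        ∈Greedy⁺ 𝓕 {X⁺} (y∈p∪⁅y⁆ (δ Y) e) (≡.subst (λ A → Indep 𝓕 (A ∪ ⁅ e ⁆)) above-relevant adm)

  H-component-A : ∀ Y j → Indep (𝓘A j) (H Y ∩ ground (𝓘A j))
  H-component-A Y = proj₂ (proj₁ (H-indep Y))

  H-component-B : ∀ Y j → Indep (𝓘B j) (H Y ∩ ground (𝓘B j))
  H-component-B Y = proj₂ (proj₂ (H-indep Y))

  -- Edges of one agent are parallel in each component containing that agent, and `A-cover` provides
  -- such a component.
  H-one-edge-per-agent : ∀ {Y e f} → e ∈ H Y → f ∈ H Y → agent e ≡ agent f → e ≡ f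
  H-one-edge-per-agent {Y} {e} {f} e∈ f∈ eq =
    let j , a∈ = ∈⋃-tabulate (ground ∘ 𝓙) (≡.subst (agent e ∈_) (≡.sym A-cover) ∈⊤)
        _ , one , _ = H-component-A Y j
    in one e f (x∈p∩q⁺ (e∈ , ∈ground-transfer⁺ agent (𝓙 j) a∈))
               (x∈p∩q⁺ (f∈ , ∈ground-transfer⁺ agent (𝓙 j) (≡.subst (_∈ ground (𝓙 j)) eq a∈))) eq

  Top : Subset #A → Fin #E → Set _
  Top Y e = Admissible Y e × (∀ f → agent f ≡ agent e → Admissible Y f → w f ≤ w e)

  top? : ∀ Y e → Dec (Top Y e)
  top? Y e = admissible? Y e ×-dec
    all? λ f → (agent f ≟ agent e) →-dec (admissible? Y f →-dec (w f ≤? w e))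

  inRel? : ∀ Y e → Dec (∃[ a ] (a ∉ Y × IsTopRelevant Y a e))
  inRel? Y e = any? λ a → ¬? (a ∈? Y) ×-dec isTopRelevant? Y a e

  ∈Rel⁻ : ∀ {Y e} → e ∈ Rel Y → agent e ∉ Y × Top Y e
  ∈Rel⁻ {Y} {e} e∈ = unpack (∈⟦⟧⁻ (inRel? Y) e∈)
    where
    unpack : (∃[ a ] (a ∉ Y × IsTopRelevant Y a e)) → agent e ∉ Y × Top Y e
    unpack (_ , a∉Y , ≡.refl , rel , top) = a∉Y , relevant⇒admissible a∉Y rel , λ f eq adm →
      top f (eq , admissible⇒relevant (≡.subst (_∉ Y) (≡.sym eq) a∉Y) adm)

  ∈Rel⁺ : ∀ {Y e} → agent e ∉ Y → Top Y e → e ∈ Rel Y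
  ∈Rel⁺ {Y} a∉Y (adm , top) = ∈⟦⟧⁺ (inRel? Y) (_ , a∉Y , ≡.refl , admissible⇒relevant a∉Y adm ,
    λ f (eq , rel) → top f eq (relevant⇒admissible (≡.subst (_∉ Y) (≡.sym eq) a∉Y) rel))

  -- Effect of the coin of a single agent.

  module _ (Y : Subset #A) (a : Fin #A) where
    private
      Y⁻ = Y [ a ]≔ outside

    -- Y and Y⁻ differ at most in a, so only an admissible edge of a above e could make the greedy
    -- runs differ there.
    agree : ∀ {e} → (∀ {f} → f ≻ e → agent f ≡ a → ¬ Admissible Y⁻ f) →
            above (H Y⁻) e ≡ above (H Y) e
    agree none = above-H-≡ (proj₁ ∘ ∈-[]≔outside⁻ Y a) λ {f} f≻e b∈Y b∉Y⁻ →
      none f≻e (decidable-stable (agent f ≟ a) λ ≢a → b∉Y⁻ (∈-[]≔outside⁺ b∈Y ≢a))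

  top⇒no-heavier : ∀ {Y e f} → Top Y e → f ≻ e → agent f ≡ agent e → ¬ Admissible Y f
  top⇒no-heavier (_ , top) f≻e eq adm = <⇒≱ f≻e (top _ eq adm)

  module _ (Y : Subset #A) (e : Fin #E) where
    private
      a  = agent e
      Y⁻ = Y [ a ]≔ outside

    top⇒∈H : a ∈ Y → Top Y⁻ e → e ∈ H Y
    top⇒∈H a∈Y top@(adm , _) = ∈H⁺ a∈Y (admissible-≡ (agree Y a (top⇒no-heavier top)) adm)

    -- Suppose some heavier edge of the agent were admissible at Y⁻. The heaviest such edge would
    -- meet the same greedy state at Y and be accepted, giving the agent a second edge in `H Y`
    -- besides e.
    ∈H⇒top : e ∈ H Y → Top Y⁻ e
    ∈H⇒top e∈ =
      admissible-≡ (≡.sym (agree Y a λ f≻e → none (≻-wellFounded _) f≻e)) (∈H⁻ e∈) ,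
      λ f eq adm → ≮⇒≥ λ f≻e → none (≻-wellFounded f) f≻e eq adm
      where
      none : ∀ {f} → Acc _≻_ f → f ≻ e → agent f ≡ a → ¬ Admissible Y⁻ f
      none {f} (acc rec) f≻e eq adm = ≻-irrefl (H-one-edge-per-agent f∈ e∈ eq) f≻e
        where
        f∈ : f ∈ H Y
        f∈ = ∈H⁺ (≡.subst (_∈ Y) (≡.sym eq) (H⊆δ e∈))
          (admissible-≡ (agree Y a λ g≻f → none (rec g≻f) (≻-trans g≻f f≻e)) adm)

    -- Above a top edge e, greedy does not notice whether the agent of e is present, so f remains a
    -- top edge. The agent of f is a different one, because f is admissible and heavier than e.
    heavier-Rel : Top Y⁻ e → ∀ {f} → f ≻ e → f ∈ Rel Y⁻ → f ∈ Rel Y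
    heavier-Rel top {f} f≻e f∈ =
      let b∉Y⁻ , adm , topf = ∈Rel⁻ {Y⁻} f∈ in
      ∈Rel⁺ {Y} (λ b∈Y → b∉Y⁻ (∈-[]≔outside⁺ b∈Y λ eq → top⇒no-heavier top f≻e eq adm))
        ( admissible-≡ (agree-above f≻e) adm
        , λ g eq admg → ≮⇒≥ λ g≻f →
            <⇒≱ g≻f (topf g eq (admissible-≡ (≡.sym (agree-above (≻-trans g≻f f≻e))) admg)))
      where
      agree-above : ∀ {g} → g ≻ e → above (H Y⁻) g ≡ above (H Y) g
      agree-above g≻e = agree Y a λ h≻g → top⇒no-heavier top (≻-trans h≻g g≻e)

  Rel⇒top : ∀ Y e → e ∈ Rel Y → agent e ∉ Y × Top (Y [ agent e ]≔ outside) e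
  Rel⇒top Y e e∈ = let a∉Y , top = ∈Rel⁻ {Y} e∈ in
    a∉Y , ≡.subst (λ Y′ → Top Y′ e) (≡.sym (∉⇒[]≔outside a∉Y)) top

  top⇒Rel : ∀ Y e → agent e ∉ Y → Top (Y [ agent e ]≔ outside) e → e ∈ Rel Y
  top⇒Rel Y e a∉Y top = ∈Rel⁺ {Y} a∉Y (≡.subst (λ Y′ → Top Y′ e) (∉⇒[]≔outside a∉Y) top)

  lost : Subset #E → IndependenceSystem #E → Subset #E
  lost X 𝓢 = (X ∩ ground 𝓢) ─ PCore w 𝓢 (X ∩ ground 𝓢)

  Core-or-lost : ∀ {X e} → e ∈ X →
    e ∈ Core X ⊎ (∃[ j ] e ∈ lost X (𝓘A j)) ⊎ (∃[ j ] e ∈ lost X (𝓘B j))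
  Core-or-lost {X} {e} e∈X = decide (any? λ j → e ∈? lost X (𝓘A j)) (any? λ j → e ∈? lost X (𝓘B j))
    where
    kept : ∀ 𝓢 → e ∉ lost X 𝓢 → e ∈ corePart X 𝓢
    kept 𝓢 ¬lost = decide (e ∈? ground 𝓢)
      where
      decide : Dec (e ∈ ground 𝓢) → e ∈ corePart X 𝓢
      decide (no e∉S)  = x∈p∪q⁺ (inj₁ (x∈p∧x∉q⇒x∈p─q e∈X e∉S))
      decide (yes e∈S) = x∈p∪q⁺ (inj₂ (decidable-stable (_ ∈? _) λ e∉C →
        ¬lost (x∈p∧x∉q⇒x∈p─q (x∈p∩q⁺ (e∈X , e∈S)) e∉C)))

    decide : Dec (∃[ j ] e ∈ lost X (𝓘A j)) → Dec (∃[ j ] e ∈ lost X (𝓘B j)) →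
             e ∈ Core X ⊎ (∃[ j ] e ∈ lost X (𝓘A j)) ⊎ (∃[ j ] e ∈ lost X (𝓘B j))
    decide (yes lostA) _           = inj₂ (inj₁ lostA)
    decide (no _)      (yes lostB) = inj₂ (inj₂ lostB)
    decide (no ¬lostA) (no ¬lostB) = inj₁ (x∈p∩q⁺
      ( ∈⋂-tabulate _ (λ j → kept (𝓘A j) λ l → ¬lostA (j , l))
      , ∈⋂-tabulate _ (λ j → kept (𝓘B j) λ l → ¬lostB (j , l))))

  -- The event that e is lost from the core once it enters Rel.  At Y with the
  -- agent of e removed it does not depend on the coin of that agent, so it
  -- splits in ratio p : 1 - p between edges of H Y and edges of Rel Y.
  module _ (𝓢 : IndependenceSystem #E) where

    Doomed : Subset #A → Fin #E → Set _
    Doomed Y e = Top Y e × e ∈ PHull 𝓢 (above (Rel Y ∩ ground 𝓢) e)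

    doomed? : ∀ Y e → Dec (Doomed Y e)
    doomed? Y e = top? Y e ×-dec (e ∈? PHull 𝓢 (above (Rel Y ∩ ground 𝓢) e))

    selectedDoomed? : ∀ Y e → Dec (agent e ∈ Y × Doomed (Y [ agent e ]≔ outside) e)
    selectedDoomed? Y e = (agent e ∈? Y) ×-dec doomed? (Y [ agent e ]≔ outside) e

    selectedDoomed : Subset #A → Subset #E
    selectedDoomed Y = ⟦ selectedDoomed? Y ⟧

    module _ (Y : Subset #A) (e : Fin #E) where
      private
        X = Rel Y ∩ ground 𝓢

      lost⇒doomed : e ∈ lost (Rel Y) 𝓢 → agent e ∉ Y × Doomed (Y [ agent e ]≔ outside) e
      lost⇒doomed e∈ = a∉Y , ≡.subst (λ Y′ → Doomed Y′ e) (≡.sym (∉⇒[]≔outside a∉Y))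
        (proj₂ rel , ∉PCore⇒∈PHull 𝓢 {X} e∈X (x∈p─q⇒x∉q {p = X} {PCore w 𝓢 X} e∈))
        where
        e∈X : e ∈ X
        e∈X = p─q⊆p X (PCore w 𝓢 X) e∈
        rel : agent e ∉ Y × Top Y e
        rel = ∈Rel⁻ {Y} (p∩q⊆p (Rel Y) (ground 𝓢) e∈X)
        a∉Y = proj₁ rel

      doomed⇒lost : agent e ∉ Y → Doomed (Y [ agent e ]≔ outside) e → e ∈ lost (Rel Y) 𝓢
      doomed⇒lost a∉Y doomed⁻ =
        x∈p∧x∉q⇒x∈p─q {p = X} {q = PCore w 𝓢 X} e∈X (λ e∈C → proj₂ (∈PCore⁻ 𝓢 {X} e∈C) (proj₂ doomed))
        where
        doomed : Doomed Y e
        doomed = ≡.subst (λ Y′ → Doomed Y′ e) (∉⇒[]≔outside a∉Y) doomed⁻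
        e∈X : e ∈ X
        e∈X = x∈p∩q⁺ {p = Rel Y} (∈Rel⁺ {Y} a∉Y (proj₁ doomed) ,
          PHull⊆ground 𝓢 {above X e} (p∩q⊆q (Rel Y) (ground 𝓢) ∘ above⊆ {X}) (proj₂ doomed))

    module _ (Y : Subset #A) where
      private
        X = Rel Y ∩ ground 𝓢

      X⊆ground : X ⊆ ground 𝓢
      X⊆ground = p∩q⊆q (Rel Y) (ground 𝓢)

      selectedDoomed⊆H : selectedDoomed Y ⊆ H Y ∩ ground 𝓢
      selectedDoomed⊆H {e} e∈ =
        let a∈Y , top , e∈PH = ∈⟦⟧⁻ (selectedDoomed? Y) e∈
        in x∈p∩q⁺ (top⇒∈H Y e a∈Y top , PHull⊆ground 𝓢 (p∩q⊆q _ (ground 𝓢) ∘ above⊆) e∈PH)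

      selectedDoomed∉Rel : ∀ {e} → e ∈ selectedDoomed Y → e ∉ X
      selectedDoomed∉Rel e∈ e∈X =
        proj₁ (∈Rel⁻ {Y} (p∩q⊆p (Rel Y) _ e∈X)) (proj₁ (∈⟦⟧⁻ (selectedDoomed? Y) e∈))

      -- Doom is judged at Y with the agent of e removed, which differs from edge to edge. Counting
      -- needs one common set X, and `heavier-Rel` with monotonicity of the hull provides it.
      selectedDoomed∈PHull : ∀ {e} → e ∈ selectedDoomed Y → e ∈ PHull 𝓢 (above X e)
      selectedDoomed∈PHull {e} e∈ =
        let _ , top , e∈PH = ∈⟦⟧⁻ (selectedDoomed? Y) e∈ in
        PHull-mono 𝓢 {X⁻ e} {above X e} (λ f∈ →
          let f∈R∩S , f≻e = ∈above⁻ (Rel (Y [ agent e ]≔ outside) ∩ ground 𝓢) e f∈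
              f∈R , f∈S = x∈p∩q⁻ (Rel (Y [ agent e ]≔ outside)) (ground 𝓢) f∈R∩S
          in ∈above⁺ {X} (x∈p∩q⁺ (heavier-Rel Y e top f≻e f∈R , f∈S)) f≻e) e∈PH
        where
        X⁻ : Fin #E → Subset #E
        X⁻ e = above (Rel (Y [ agent e ]≔ outside) ∩ ground 𝓢) e

      module _ (indep : Indep 𝓢 (H Y ∩ ground 𝓢)) where

        selectedDoomed-weight : ∀ {k} → HullBounded 𝓢 k →
          weight w (selectedDoomed Y) ≤ fromℕ k * weight w X
        selectedDoomed-weight {k} bounded = ≤-trans
          (hull-weight 𝓢 {k} {X} bounded X⊆ground indep selectedDoomed⊆H selectedDoomed∉Rel selectedDoomed∈PHull)
          -- Dropping `H Y` from the difference costs nothing: edges of `Rel Y` have agents outside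
          -- Y, edges of `H Y` inside.
          (*-monoˡ-≤ (fromℕ-nonneg k) (weight-mono w-nonneg (p─q⊆p X (H Y ∩ ground 𝓢))))

        matroid-doomed-weight : IsMatroid 𝓢 →
          weight w (selectedDoomed Y) + weight w (lost (Rel Y) 𝓢) ≤ weight w X
        matroid-doomed-weight matroid = matroid-hull-weight 𝓢 matroid X⊆ground
          (downward-closed 𝓢 selectedDoomed⊆H indep) selectedDoomed∉Rel selectedDoomed∈PHull

  -- Expected loss in one component.

  module Random (p : Carrier) (0≤p : 0# ≤ p) (p≤1 : p ≤ 1#) where
    open Expectation p public

    0≤q : 0# ≤ q
    0≤q = x≤y⇒0≤y-x p≤1

    module _ (𝓢 : IndependenceSystem #E) (indep : ∀ Y → Indep 𝓢 (H Y ∩ ground 𝓢)) where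
      private
        S = sum (resampled agent w (doomed? 𝓢))

        E-selectedDoomed : E (weight w ∘ selectedDoomed 𝓢) ≈ p * S
        E-selectedDoomed = E-agent-inside agent w (doomed? 𝓢) (selectedDoomed 𝓢)
          (λ Y e → ∈⟦⟧⁻ (selectedDoomed? 𝓢 Y))
          (λ Y e a∈Y doomed → ∈⟦⟧⁺ (selectedDoomed? 𝓢 Y) (a∈Y , doomed))

        E-lost : E (λ Y → weight w (lost (Rel Y) 𝓢)) ≈ q * S
        E-lost = E-agent-outside agent w (doomed? 𝓢) (λ Y → lost (Rel Y) 𝓢)
          (lost⇒doomed 𝓢) (doomed⇒lost 𝓢)

        E-Rel : Carrier
        E-Rel = E (λ Y → weight w (Rel Y ∩ ground 𝓢))

      E-lost-growth : ∀ {k} → HullBounded 𝓢 k →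
        p * E (λ Y → weight w (lost (Rel Y) 𝓢)) ≤ q * (fromℕ k * E-Rel)
      E-lost-growth {k} bounded = begin
        p * E (λ Y → weight w (lost (Rel Y) 𝓢)) ≈⟨ *-congˡ E-lost ⟩
        p * (q * S)
          ≈⟨ solve 3 (λ p q s → p :* (q :* s) := q :* (p :* s)) refl p q S ⟩
        q * (p * S)                             ≈⟨ *-congˡ E-selectedDoomed ⟨
        q * E (weight w ∘ selectedDoomed 𝓢)
          ≤⟨ *-monoˡ-≤ 0≤q (E-mono 0≤p 0≤q λ Y → selectedDoomed-weight 𝓢 Y (indep Y) {k} bounded) ⟩
        q * E (λ Y → fromℕ k * weight w (Rel Y ∩ ground 𝓢))
          ≈⟨ *-congˡ (E-*ˡ (fromℕ k) λ Y → weight w (Rel Y ∩ ground 𝓢)) ⟩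
        q * (fromℕ k * E-Rel)                   ∎
        where open Solver using (solve; _:=_; _:*_)

      -- The matroid inequality controls selected and lost edges together, that is pS + qS = S,
      -- rather than pS alone. This removes the factor 1/p of the growth case.
      E-lost-matroid : IsMatroid 𝓢 → E (λ Y → weight w (lost (Rel Y) 𝓢)) ≤ q * E-Rel
      E-lost-matroid matroid = begin
        E (λ Y → weight w (lost (Rel Y) 𝓢)) ≈⟨ E-lost ⟩
        q * S                               ≈⟨ *-congˡ (average S) ⟨
        q * (p * S + q * S)                 ≈⟨ *-congˡ (+-cong E-selectedDoomed E-lost) ⟨
        q * (E (weight w ∘ selectedDoomed 𝓢) + E (λ Y → weight w (lost (Rel Y) 𝓢)))
          ≈⟨ *-congˡ (E-+ (weight w ∘ selectedDoomed 𝓢) λ Y → weight w (lost (Rel Y) 𝓢)) ⟨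
        q * E (λ Y → weight w (selectedDoomed 𝓢 Y) + weight w (lost (Rel Y) 𝓢))
          ≤⟨ *-monoˡ-≤ 0≤q (E-mono 0≤p 0≤q λ Y → matroid-doomed-weight 𝓢 Y (indep Y) matroid) ⟩
        q * E-Rel                           ∎

-- Combining the components

module Combined {c ℓ₁ ℓ₂} (R : EuclideanField c ℓ₁ ℓ₂) (𝔾 : Setting R)
    (k′ : Fin (Setting.M-A 𝔾) → ℕ) (ℓ′ : Fin (Setting.M-B 𝔾) → ℕ)
    (boundedA : ∀ j → HullBounded (Setting.𝓘A 𝔾 j) (k′ j))
    (boundedB : ∀ j → HullBounded (Setting.𝓘B 𝔾 j) (ℓ′ j)) where
  open Setting 𝔾
  open EuclideanField R hiding (zero)
  open Weighted R
  open OrderedField R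
  open Analysis R 𝔾
  open Heaviness R w w-nonneg w-injective
  open IndependenceSystem
  open ≤-Reasoning
  open Solver using (solve; _:=_; _:+_; _:*_)

  K : Carrier
  K = fromℕ (maxTotal k′ ℓ′)

  on-total : ∀ X e {M} (𝓢 : Fin M → IndependenceSystem #E) (k : Fin M → ℕ) →
    sum (λ j → fromℕ (k j) * on w (X ∩ ground (𝓢 j)) e) ≈ fromℕ (total 𝓢 k e) * on w X e
  on-total X e {zero}  𝓢 k = sym (zeroˡ _)
  on-total X e {suc M} 𝓢 k = begin-equality
    fromℕ (k zero) * on w (X ∩ ground (𝓢 zero)) e + sum (λ j → fromℕ (k (suc j)) * on w (X ∩ ground (𝓢 (suc j))) e)
      ≈⟨ +-cong first (on-total X e (𝓢 ∘ suc) (k ∘ suc)) ⟩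
    fromℕ k₀ * on w X e + fromℕ (total (𝓢 ∘ suc) (k ∘ suc) e) * on w X e
      ≈⟨ distribʳ (on w X e) _ _ ⟨
    (fromℕ k₀ + fromℕ (total (𝓢 ∘ suc) (k ∘ suc) e)) * on w X e
      ≈⟨ *-congʳ (fromℕ-homo-+ k₀ _) ⟨
    fromℕ (total 𝓢 k e) * on w X e ∎
    where
    k₀ = if does (e ∈? ground (𝓢 zero)) then k zero else 0
    first : fromℕ (k zero) * on w (X ∩ ground (𝓢 zero)) e ≈ fromℕ k₀ * on w X e
    first with e ∈? ground (𝓢 zero) | e ∈? X
    ... | yes e∈S | yes e∈X = *-congˡ (reflexive (on-∈ w (x∈p∩q⁺ (e∈X , e∈S))))
    ... | yes _   | no e∉X  = *-congˡ (reflexive (on-∉ {X = X ∩ ground (𝓢 zero)} w (e∉X ∘ p∩q⊆p X _)))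
    ... | no e∉S  | _       = trans (*-congˡ (reflexive (on-∉ {X = X ∩ ground (𝓢 zero)} w (e∉S ∘ p∩q⊆q X _))))
                                    (trans (zeroʳ _) (sym (zeroˡ _)))

  weight-total : ∀ X {M} (𝓢 : Fin M → IndependenceSystem #E) (k : Fin M → ℕ) →
    sum (λ j → fromℕ (k j) * weight w (X ∩ ground (𝓢 j))) ≈ sum (λ e → fromℕ (total 𝓢 k e) * on w X e)
  weight-total X 𝓢 k = begin-equality
    sum (λ j → fromℕ (k j) * weight w (X ∩ ground (𝓢 j)))
      ≈⟨ sum-cong-≋ (λ j → *-distribˡ-sum (fromℕ (k j)) (on w (X ∩ ground (𝓢 j)))) ⟩
    sum (λ j → sum (λ e → fromℕ (k j) * on w (X ∩ ground (𝓢 j)) e))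
      ≈⟨ ∑-comm (λ j e → fromℕ (k j) * on w (X ∩ ground (𝓢 j)) e) ⟩
    sum (λ e → sum (λ j → fromℕ (k j) * on w (X ∩ ground (𝓢 j)) e))
      ≈⟨ sum-cong-≋ (λ e → on-total X e 𝓢 k) ⟩
    sum (λ e → fromℕ (total 𝓢 k e) * on w X e) ∎

  -- Double counting: after exchanging the sums, each edge is charged the constants of all
  -- components containing it, at most `maxTotal` in total.
  components-weight : ∀ X →
    sum (λ j → fromℕ (k′ j) * weight w (X ∩ ground (𝓘A j))) + sum (λ j → fromℕ (ℓ′ j) * weight w (X ∩ ground (𝓘B j)))
    ≤ K * weight w X
  components-weight X = begin
    _ ≈⟨ +-cong (weight-total X 𝓘A k′) (weight-total X 𝓘B ℓ′) ⟩
    sum (λ e → fromℕ (total 𝓘A k′ e) * on w X e) + sum (λ e → fromℕ (total 𝓘B ℓ′ e) * on w X e)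
      ≈⟨ ∑-distrib-+ (λ e → fromℕ (total 𝓘A k′ e) * on w X e) _ ⟨
    sum (λ e → fromℕ (total 𝓘A k′ e) * on w X e + fromℕ (total 𝓘B ℓ′ e) * on w X e)
      ≤⟨ sum-mono-≤ pointwise ⟩
    sum (λ e → K * on w X e)
      ≈⟨ *-distribˡ-sum K (on w X) ⟨
    K * weight w X ∎
    where
    pointwise : ∀ e → fromℕ (total 𝓘A k′ e) * on w X e + fromℕ (total 𝓘B ℓ′ e) * on w X e ≤ K * on w X e
    pointwise e = begin
      fromℕ (total 𝓘A k′ e) * on w X e + fromℕ (total 𝓘B ℓ′ e) * on w X e ≈⟨ distribʳ (on w X e) _ _ ⟨
      (fromℕ (total 𝓘A k′ e) + fromℕ (total 𝓘B ℓ′ e)) * on w X e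
        ≈⟨ *-congʳ (fromℕ-homo-+ (total 𝓘A k′ e) _) ⟨
      fromℕ (total 𝓘A k′ e ℕ.+ total 𝓘B ℓ′ e) * on w X e
        ≤⟨ *-monoʳ-≤ (on-nonneg w-nonneg X e) (fromℕ-mono (term≤foldr-⊔ (λ e → total 𝓘A k′ e ℕ.+ total 𝓘B ℓ′ e) e)) ⟩
      K * on w X e ∎

  -- Greedy approximation.

  module _ {X O : Subset #E} (indO : Indep 𝓕 O) (O⊆X : O ⊆ X) (1≤k : 1 ℕ.≤ maxTotal k′ ℓ′) where
    private
      G : Subset #E
      G = Greedy w 𝓕 X

    blocked? : ∀ 𝓢 e → Dec (e ∈ O ─ G × e ∈ PHull 𝓢 (above (G ∩ ground 𝓢) e))
    blocked? 𝓢 e = (e ∈? O ─ G) ×-dec (e ∈? PHull 𝓢 (above (G ∩ ground 𝓢) e))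

    blocked : IndependenceSystem #E → Subset #E
    blocked 𝓢 = ⟦ blocked? 𝓢 ⟧

    blocked-weight : ∀ 𝓢 {k} → HullBounded 𝓢 k → Indep 𝓢 (O ∩ ground 𝓢) →
      weight w (blocked 𝓢) ≤ fromℕ k * weight w ((G ─ O) ∩ ground 𝓢)
    blocked-weight 𝓢 {k} bounded ind = ≤-trans
      (hull-weight 𝓢 {k} {G ∩ ground 𝓢} {O ∩ ground 𝓢} bounded (p∩q⊆q G _) ind
        (λ {e} e∈ → let e∈O─G , e∈H = ∈⟦⟧⁻ (blocked? 𝓢) e∈ in
          x∈p∩q⁺ (p─q⊆p O G e∈O─G , PHull⊆ground 𝓢 {above (G ∩ ground 𝓢) e} (p∩q⊆q G _ ∘ above⊆ {G ∩ ground 𝓢}) e∈H))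
        (λ e∈ e∈G → x∈p─q⇒x∉q {p = O} (proj₁ (∈⟦⟧⁻ (blocked? 𝓢) e∈)) (p∩q⊆p G _ e∈G))
        (λ e∈ → proj₂ (∈⟦⟧⁻ (blocked? 𝓢) e∈)))
      (*-monoˡ-≤ (fromℕ-nonneg k) (weight-mono w-nonneg λ e∈ →
        let e∈G , e∈S = x∈p∩q⁻ G (ground 𝓢) (p─q⊆p (G ∩ ground 𝓢) _ e∈)
        in x∈p∩q⁺ (x∈p∧x∉q⇒x∈p─q e∈G
             (λ e∈O → x∈p─q⇒x∉q {p = G ∩ ground 𝓢} e∈ (x∈p∩q⁺ (e∈O , e∈S))) , e∈S)))

    -- If the restriction were dependent, it would contain e, since otherwise it is part of the
    -- independent `G ∩ ground 𝓢`. Then e closes a circuit with heavier elements of G.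
    component-admits : ∀ 𝓢 {e} → Indep 𝓢 (G ∩ ground 𝓢) → e ∉ PHull 𝓢 (above (G ∩ ground 𝓢) e) →
      Indep 𝓢 ((above G e ∪ ⁅ e ⁆) ∩ ground 𝓢)
    component-admits 𝓢 {e} indG e∉H = decidable-stable (Indep? 𝓢 _) λ dep →
      e∉H (dependent-augmentation⇒∈PHull 𝓢 {above (G ∩ ground 𝓢) e} {e}
        (p∩q⊆q G _ ∘ above⊆ {G ∩ ground 𝓢})
        (decidable-stable (e ∈? ground 𝓢) λ e∉S → dep (downward-closed 𝓢 (without e∉S) indG))
        (downward-closed 𝓢 (above⊆ {G ∩ ground 𝓢}) indG)
        (dep ∘ downward-closed 𝓢 within))
      where
      without : e ∉ ground 𝓢 → (above G e ∪ ⁅ e ⁆) ∩ ground 𝓢 ⊆ G ∩ ground 𝓢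
      without e∉S x∈ =
        let x∈A , x∈S = x∈p∩q⁻ (above G e ∪ ⁅ e ⁆) (ground 𝓢) x∈
        in [ (λ x∈above → x∈p∩q⁺ (above⊆ {G} {e} x∈above , x∈S))
           , (λ x≡e → ⊥-elim (e∉S (≡.subst (_∈ ground 𝓢) x≡e x∈S))) ]′ (x∈p∪⁅y⁆⁻ (above G e) x∈A)

      within : (above G e ∪ ⁅ e ⁆) ∩ ground 𝓢 ⊆ above (G ∩ ground 𝓢) e ∪ ⁅ e ⁆
      within x∈ =
        let x∈A , x∈S = x∈p∩q⁻ (above G e ∪ ⁅ e ⁆) (ground 𝓢) x∈
        in [ (λ x∈above → let x∈G , x≻e = ∈above⁻ G e x∈above in
               p⊆p∪q ⁅ e ⁆ (∈above⁺ {G ∩ ground 𝓢} (x∈p∩q⁺ (x∈G , x∈S)) x≻e))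
           , (λ x≡e → ≡.subst (_∈ above (G ∩ ground 𝓢) e ∪ ⁅ e ⁆) (≡.sym x≡e) (y∈p∪⁅y⁆ _ e))
           ]′ (x∈p∪⁅y⁆⁻ (above G e) x∈A)

    -- An element of O that no component blocks passes the test of every component at once, so
    -- greedy would have accepted it.
    kept-or-blocked : ∀ {e} → e ∈ O →
      e ∈ O ∩ G ⊎ (∃[ j ] e ∈ blocked (𝓘A j)) ⊎ (∃[ j ] e ∈ blocked (𝓘B j))
    kept-or-blocked {e} e∈O =
      decide (e ∈? G) (any? λ j → e ∈? blocked (𝓘A j)) (any? λ j → e ∈? blocked (𝓘B j))
      where
      G-indep : Indep 𝓕 G
      G-indep = Greedy-indep 𝓕 X

      ∉blocked : ∀ 𝓢 → e ∉ G → e ∉ blocked 𝓢 → e ∉ PHull 𝓢 (above (G ∩ ground 𝓢) e)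
      ∉blocked 𝓢 e∉G e∉ e∈H = e∉ (∈⟦⟧⁺ (blocked? 𝓢) (x∈p∧x∉q⇒x∈p─q e∈O e∉G , e∈H))

      A⊆ : ∀ {S} → O ⊆ S → G ⊆ S → above G e ∪ ⁅ e ⁆ ⊆ S
      A⊆ O⊆S G⊆S = ∪⁅⁆-least (G⊆S ∘ above⊆ {G}) (O⊆S e∈O)

      decide : Dec (e ∈ G) → Dec (∃[ j ] e ∈ blocked (𝓘A j)) → Dec (∃[ j ] e ∈ blocked (𝓘B j)) →
               e ∈ O ∩ G ⊎ (∃[ j ] e ∈ blocked (𝓘A j)) ⊎ (∃[ j ] e ∈ blocked (𝓘B j))
      decide (yes e∈G) _ _ = inj₁ (x∈p∩q⁺ (e∈O , e∈G))
      decide (no _) (yes blockedA) _ = inj₂ (inj₁ blockedA)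
      decide (no _) (no _) (yes blockedB) = inj₂ (inj₂ blockedB)
      decide (no e∉G) (no ¬A) (no ¬B) = ⊥-elim (e∉G (∈Greedy⁺ 𝓕 {X} (O⊆X e∈O)
        ( ( A⊆ (proj₁ (proj₁ indO)) (proj₁ (proj₁ G-indep))
          , λ j → component-admits (𝓘A j) (proj₂ (proj₁ G-indep) j) (∉blocked (𝓘A j) e∉G λ b → ¬A (j , b)) )
        , ( A⊆ (proj₁ (proj₂ indO)) (proj₁ (proj₂ G-indep))
          , λ j → component-admits (𝓘B j) (proj₂ (proj₂ G-indep) j) (∉blocked (𝓘B j) e∉G λ b → ¬B (j , b)) ) )))

    greedy-approximation : weight w O ≤ K * weight w G
    greedy-approximation = begin
      weight w O
        ≤⟨ weight-cover w-nonneg {U = blocked ∘ 𝓘A} {V = blocked ∘ 𝓘B} kept-or-blocked ⟩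
      weight w (O ∩ G) + (sum (weight w ∘ blocked ∘ 𝓘A) + sum (weight w ∘ blocked ∘ 𝓘B))
        ≤⟨ +-monoʳ-≤ _ (+-mono-≤ (sum-mono-≤ λ j → blocked-weight (𝓘A j) {k′ j} (boundedA j) (proj₂ (proj₁ indO) j))
                                 (sum-mono-≤ λ j → blocked-weight (𝓘B j) {ℓ′ j} (boundedB j) (proj₂ (proj₂ indO) j))) ⟩
      _ ≤⟨ +-monoʳ-≤ _ (components-weight (G ─ O)) ⟩
      weight w (O ∩ G) + K * weight w (G ─ O)
        ≤⟨ +-monoˡ-≤ _ (weight-mono w-nonneg λ e∈ → let e∈O , e∈G = x∈p∩q⁻ O G e∈ in x∈p∩q⁺ (e∈G , e∈O)) ⟩
      weight w (G ∩ O) + K * weight w (G ─ O)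
        ≈⟨ +-congʳ (*-identityˡ _) ⟨
      1# * weight w (G ∩ O) + K * weight w (G ─ O)
        -- The common part O ∩ G is charged once, and 1 ≤ K absorbs it next to the K-fold charge of
        -- G ─ O.
        ≤⟨ +-monoˡ-≤ _ (*-monoʳ-≤ (weight-nonneg w-nonneg (G ∩ O)) (1≤fromℕ 1≤k)) ⟩
      K * weight w (G ∩ O) + K * weight w (G ─ O)
        ≈⟨ distribˡ K _ _ ⟨
      K * (weight w (G ∩ O) + weight w (G ─ O))
        ≈⟨ *-congˡ (weight-split w G O) ⟨
      K * weight w G ∎

  -- Expected weight of relevant edges and of their core.

  module _ (p : Carrier) (0<p : 0# < p) (p≤1 : p ≤ 1#) where
    private
      0≤p = proj₁ 0<p
    open Random p 0≤p p≤1

    E-Rel : Carrier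
    E-Rel = E (weight w ∘ Rel)

    -- O ∩ δ Y competes with greedy on δ Y and has expected weight p times that of O, each edge
    -- having one agent. The greedy set has expected weight pS, so p cancels and S is compared with
    -- O.
    E-Rel-bound : ∀ {O} → Indep 𝓕 O → 1 ℕ.≤ maxTotal k′ ℓ′ → q * weight w O ≤ K * E-Rel
    E-Rel-bound {O} indO 1≤k = *-cancelˡ-≤ 0<p (begin
      p * (q * weight w O)         ≈⟨ x∙yz≈y∙xz p q _ ⟩
      q * (p * weight w O)         ≈⟨ *-congˡ E-O ⟨
      q * E (λ Y → weight w (O ∩ δ Y)) ≤⟨ *-monoˡ-≤ 0≤q (E-mono 0≤p 0≤q approx) ⟩
      q * E (λ Y → K * weight w (H Y)) ≈⟨ *-congˡ (E-*ˡ K (weight w ∘ H)) ⟩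
      q * (K * E (weight w ∘ H))   ≈⟨ *-congˡ (*-congˡ E-H) ⟩
      q * (K * (p * S))
        ≈⟨ solve 4 (λ q K p S → q :* (K :* (p :* S)) := p :* (K :* (q :* S))) refl q K p S ⟩
      p * (K * (q * S))            ≈⟨ *-congˡ (*-congˡ E-Rel≈) ⟨
      p * (K * E-Rel)              ∎)
      where
      S = sum (resampled agent w top?)

      x∙yz≈y∙xz : ∀ x y z → x * (y * z) ≈ y * (x * z)
      x∙yz≈y∙xz = solve 3 (λ x y z → x :* (y :* z) := y :* (x :* z)) refl

      E-H : E (weight w ∘ H) ≈ p * S
      E-H = E-agent-inside agent w top? H (λ Y e e∈ → H⊆δ e∈ , ∈H⇒top Y e e∈) top⇒∈H

      E-Rel≈ : E-Rel ≈ q * S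
      E-Rel≈ = E-agent-outside agent w top? Rel Rel⇒top top⇒Rel

      inO? : ∀ (Y : Subset #A) e → Dec (e ∈ O)
      inO? _ e = e ∈? O

      E-O : E (λ Y → weight w (O ∩ δ Y)) ≈ p * weight w O
      E-O = trans
        -- Membership in O is an event that ignores Y, so its resampled weight is the constant
        -- `on w O e`.
        (E-agent-inside agent w inO? (λ Y → O ∩ δ Y)
          (λ Y e e∈ → let e∈O , e∈δ = x∈p∩q⁻ O (δ Y) e∈ in ∈⟦⟧⁻ (δ? Y) e∈δ , e∈O)
          (λ Y e a∈Y e∈O → x∈p∩q⁺ (e∈O , ∈⟦⟧⁺ (δ? Y) a∈Y)))
        (*-congˡ (sum-cong-≋ λ e → E-const {#A} (on w O e)))

      approx : ∀ Y → weight w (O ∩ δ Y) ≤ K * weight w (H Y)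
      approx Y = ≡.subst (λ G → weight w (O ∩ δ Y) ≤ K * weight w G) (≡.sym (H≡Greedy Y))
        (greedy-approximation {δ Y} (downward-closed 𝓕 (p∩q⊆p O (δ Y)) indO) (p∩q⊆q O (δ Y)) 1≤k)

    E-lost : IndependenceSystem #E → Carrier
    E-lost 𝓢 = E (λ Y → weight w (lost (Rel Y) 𝓢))

    E-part : IndependenceSystem #E → Carrier
    E-part 𝓢 = E (λ Y → weight w (Rel Y ∩ ground 𝓢))

    -- The parameter r treats both cases at once without division: r = p for growth systems and r =
    -- 1 for matroids.
    core-bound : ∀ {r} → 0# ≤ r →
      (∀ j → r * E-lost (𝓘A j) ≤ q * (fromℕ (k′ j) * E-part (𝓘A j))) →
      (∀ j → r * E-lost (𝓘B j) ≤ q * (fromℕ (ℓ′ j) * E-part (𝓘B j))) →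
      r * E-Rel ≤ r * expectedCoreWeight p + q * (K * E-Rel)
    core-bound {r} 0≤r lossA lossB = begin
      r * E-Rel
        ≤⟨ *-monoˡ-≤ 0≤r (E-mono 0≤p 0≤q λ Y → weight-cover w-nonneg
             {C = Core (Rel Y)} {U = lost (Rel Y) ∘ 𝓘A} {V = lost (Rel Y) ∘ 𝓘B} (Core-or-lost {Rel Y})) ⟩
      r * E (λ Y → weight w (Core (Rel Y)) + (LA Y + LB Y))
        ≈⟨ *-congˡ (trans (E-+ (λ Y → weight w (Core (Rel Y))) _) (+-congˡ (E-+ LA LB))) ⟩
      r * (expectedCoreWeight p + (E LA + E LB))
        ≈⟨ *-congˡ (+-congˡ (+-cong (E-sum (λ j Y → weight w (lost (Rel Y) (𝓘A j)))) (E-sum (λ j Y → weight w (lost (Rel Y) (𝓘B j)))))) ⟩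
      r * (expectedCoreWeight p + (sum (E-lost ∘ 𝓘A) + sum (E-lost ∘ 𝓘B)))
        ≈⟨ solve 4 (λ r x y z → r :* (x :+ (y :+ z)) := r :* x :+ (r :* y :+ r :* z)) refl r _ (sum (E-lost ∘ 𝓘A)) (sum (E-lost ∘ 𝓘B)) ⟩
      r * expectedCoreWeight p + (r * sum (E-lost ∘ 𝓘A) + r * sum (E-lost ∘ 𝓘B))
        ≤⟨ +-monoʳ-≤ _ (+-mono-≤ (loss 𝓘A k′ lossA) (loss 𝓘B ℓ′ lossB)) ⟩
      r * expectedCoreWeight p + (q * sum (parts 𝓘A k′) + q * sum (parts 𝓘B ℓ′))
        ≈⟨ +-congˡ (distribˡ q _ _) ⟨
      r * expectedCoreWeight p + q * (sum (parts 𝓘A k′) + sum (parts 𝓘B ℓ′))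
        ≈⟨ +-congˡ (*-congˡ (trans (E-+ (partSum 𝓘A k′) (partSum 𝓘B ℓ′)) (+-cong (E-parts 𝓘A k′) (E-parts 𝓘B ℓ′)))) ⟨
      r * expectedCoreWeight p + q * E (λ Y → partSum 𝓘A k′ Y + partSum 𝓘B ℓ′ Y)
        ≤⟨ +-monoʳ-≤ _ (*-monoˡ-≤ 0≤q (E-mono 0≤p 0≤q (components-weight ∘ Rel))) ⟩
      r * expectedCoreWeight p + q * E (λ Y → K * weight w (Rel Y))
        ≈⟨ +-congˡ (*-congˡ (E-*ˡ K (weight w ∘ Rel))) ⟩
      r * expectedCoreWeight p + q * (K * E-Rel) ∎
      where
      LA LB : Subset #A → Carrier
      LA Y = sum (λ j → weight w (lost (Rel Y) (𝓘A j)))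
      LB Y = sum (λ j → weight w (lost (Rel Y) (𝓘B j)))

      parts : ∀ {M} → (Fin M → IndependenceSystem #E) → (Fin M → ℕ) → Fin M → Carrier
      parts 𝓢 k j = fromℕ (k j) * E-part (𝓢 j)

      partSum : ∀ {M} → (Fin M → IndependenceSystem #E) → (Fin M → ℕ) → Subset #A → Carrier
      partSum 𝓢 k Y = sum λ j → fromℕ (k j) * weight w (Rel Y ∩ ground (𝓢 j))

      loss : ∀ {M} (𝓢 : Fin M → IndependenceSystem #E) k → (∀ j → r * E-lost (𝓢 j) ≤ q * parts 𝓢 k j) →
             r * sum (E-lost ∘ 𝓢) ≤ q * sum (parts 𝓢 k)
      loss 𝓢 k bound = begin
        r * sum (E-lost ∘ 𝓢)            ≈⟨ *-distribˡ-sum r (E-lost ∘ 𝓢) ⟩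
        sum (λ j → r * E-lost (𝓢 j))    ≤⟨ sum-mono-≤ bound ⟩
        sum (λ j → q * parts 𝓢 k j)     ≈⟨ *-distribˡ-sum q (parts 𝓢 k) ⟨
        q * sum (parts 𝓢 k)             ∎

      E-parts : ∀ {M} (𝓢 : Fin M → IndependenceSystem #E) k →
        E (partSum 𝓢 k) ≈ sum (parts 𝓢 k)
      E-parts 𝓢 k = trans (E-sum (λ j Y → fromℕ (k j) * weight w (Rel Y ∩ ground (𝓢 j))))
        (sum-cong-≋ λ j → E-*ˡ (fromℕ (k j)) λ Y → weight w (Rel Y ∩ ground (𝓢 j)))

-- The choice of p

4k²≡[2k]² : ∀ k → 4 ℕ.* k ℕ.^ 2 ≡ (2 ℕ.* k) ℕ.* (2 ℕ.* k)
4k²≡[2k]² = solve 1 (λ k → con 4 :* k :^ 2 := (con 2 :* k) :* (con 2 :* k)) ≡.refl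
  where open Data.Nat.Solver.+-*-Solver

8k³≡[2k]³ : ∀ k → 8 ℕ.* k ℕ.^ 3 ≡ (2 ℕ.* k) ℕ.* ((2 ℕ.* k) ℕ.* (2 ℕ.* k))
8k³≡[2k]³ = solve 1 (λ k → con 8 :* k :^ 3 := (con 2 :* k) :* ((con 2 :* k) :* (con 2 :* k))) ≡.refl
  where open Data.Nat.Solver.+-*-Solver

module Numerics {c ℓ₁ ℓ₂} (R : EuclideanField c ℓ₁ ℓ₂) {k : ℕ} (1≤k : 1 ℕ.≤ k) where
  open EuclideanField R hiding (zero)
  open OrderedField R
  open ≤-Reasoning
  open Solver using (solve; _:=_; _:+_; _:*_; con)

  fromℕ-1 : fromℕ 1 ≈ 1#
  fromℕ-1 = +-identityʳ 1#

  fromℕ-2 : fromℕ 2 ≈ 1# + 1#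
  fromℕ-2 = +-congˡ fromℕ-1

  K : Carrier
  K = fromℕ k

  1≤K : 1# ≤ K
  1≤K = 1≤fromℕ 1≤k

  0<K : 0# < K
  0<K = fromℕ-pos 1≤k

  1≤2k : 1 ℕ.≤ 2 ℕ.* k
  1≤2k = ℕ.≤-trans 1≤k (ℕ.m≤m+n k _)

  -- With z = 1/(2k) the quantities 1/k, 1/(4k²) and 1/(8k³) become 2z, z² and z³, and the numerical
  -- estimate becomes polynomial in z.
  z : Carrier
  z = 1/ (2 ℕ.* k)

  private
    N = fromℕ (2 ℕ.* k)

  0<N : 0# < N
  0<N = fromℕ-pos 1≤2k

  N≈K+K : N ≈ K + K
  N≈K+K = begin-equality
    N           ≡⟨ ≡.cong (λ j → fromℕ (k ℕ.+ j)) (ℕ.+-identityʳ k) ⟩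
    fromℕ (k ℕ.+ k) ≈⟨ fromℕ-homo-+ k k ⟩
    K + K       ∎

  0<z : 0# < z
  0<z = ⁻¹-pos 0<N

  Nz≈1 : N * z ≈ 1#
  Nz≈1 = ⁻¹-inverse N (<⇒≉0 0<N)

  [K+K]z≈1 : (K + K) * z ≈ 1#
  [K+K]z≈1 = trans (*-congʳ (sym N≈K+K)) Nz≈1

  z+z≤1 : z + z ≤ 1#
  z+z≤1 = begin
    z + z         ≈⟨ solve 1 (λ z → z :+ z := (con 1 :+ con 1) :* z) refl z ⟩
    (1# + 1#) * z ≤⟨ *-monoʳ-≤ (proj₁ 0<z) (+-mono-≤ 1≤K 1≤K) ⟩
    (K + K) * z   ≈⟨ [K+K]z≈1 ⟩
    1#            ∎

  z≤1 : z ≤ 1#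
  z≤1 = ≤-trans (x≤x+y (proj₁ 0<z)) z+z≤1

  1/k≈z+z : 1/ k ≈ z + z
  1/k≈z+z = ⁻¹-unique 0<K (trans (solve 2 (λ K z → K :* (z :+ z) := (K :+ K) :* z) refl K z) [K+K]z≈1)

  1/4k²≈z² : 1/ (4 ℕ.* k ℕ.^ 2) ≈ z * z
  1/4k²≈z² = begin-equality
    1/ (4 ℕ.* k ℕ.^ 2)             ≡⟨ ≡.cong 1/_ (4k²≡[2k]² k) ⟩
    1/ ((2 ℕ.* k) ℕ.* (2 ℕ.* k))   ≈⟨ ⁻¹-unique (fromℕ-pos (ℕ.*-mono-≤ 1≤2k 1≤2k)) (begin-equality
      fromℕ ((2 ℕ.* k) ℕ.* (2 ℕ.* k)) * (z * z) ≈⟨ *-congʳ (fromℕ-homo-* (2 ℕ.* k) (2 ℕ.* k)) ⟩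
      N * N * (z * z)   ≈⟨ solve 2 (λ N z → N :* N :* (z :* z) := N :* z :* (N :* z)) refl N z ⟩
      N * z * (N * z)   ≈⟨ *-cong Nz≈1 Nz≈1 ⟩
      1# * 1#           ≈⟨ *-identityˡ 1# ⟩
      1#                ∎) ⟩
    z * z                          ∎

  1/8k³≈z³ : 1/ (8 ℕ.* k ℕ.^ 3) ≈ z * (z * z)
  1/8k³≈z³ = begin-equality
    1/ (8 ℕ.* k ℕ.^ 3) ≡⟨ ≡.cong 1/_ (8k³≡[2k]³ k) ⟩
    1/ ((2 ℕ.* k) ℕ.* ((2 ℕ.* k) ℕ.* (2 ℕ.* k)))
      ≈⟨ ⁻¹-unique (fromℕ-pos (ℕ.*-mono-≤ 1≤2k (ℕ.*-mono-≤ 1≤2k 1≤2k))) (begin-equality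
      fromℕ ((2 ℕ.* k) ℕ.* ((2 ℕ.* k) ℕ.* (2 ℕ.* k))) * (z * (z * z))
        ≈⟨ *-congʳ (trans (fromℕ-homo-* (2 ℕ.* k) _) (*-congˡ (fromℕ-homo-* (2 ℕ.* k) (2 ℕ.* k)))) ⟩
      N * (N * N) * (z * (z * z))
        ≈⟨ solve 2 (λ N z → N :* (N :* N) :* (z :* (z :* z)) := N :* z :* (N :* z :* (N :* z))) refl N z ⟩
      N * z * (N * z * (N * z))
        ≈⟨ *-cong Nz≈1 (*-cong Nz≈1 Nz≈1) ⟩
      1# * (1# * 1#)    ≈⟨ trans (*-identityˡ _) (*-identityˡ 1#) ⟩
      1#                ∎) ⟩
    z * (z * z) ∎

  s : Carrier
  s = √ (1# + 1/ k)

  0≤1+1/k : 0# ≤ 1# + 1/ k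
  0≤1+1/k = +-nonneg 0≤1 (⁻¹-nonneg 0<K)

  0≤s : 0# ≤ s
  0≤s = √-nonneg _ 0≤1+1/k

  s²≈1+1/k : s * s ≈ 1# + 1/ k
  s²≈1+1/k = √-square _ 0≤1+1/k

  bound : Carrier
  bound = fromℕ 2 + 1/ k - fromℕ 2 * s

  bound+2s : bound + (s + s) ≈ (1# + 1#) + 1/ k
  bound+2s = begin-equality
    bound + (s + s)
      ≈⟨ +-congˡ (trans (*-congʳ fromℕ-2) (solve 1 (λ s → (con 1 :+ con 1) :* s := s :+ s) refl s)) ⟨
    bound + fromℕ 2 * s     ≈⟨ x-y+y≈x _ (fromℕ 2 * s) ⟩
    fromℕ 2 + 1/ k          ≈⟨ +-congʳ fromℕ-2 ⟩
    (1# + 1#) + 1/ k        ∎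

  -- With d = 2 + 2z + z³ and m = d - z², the claim is 2 √(1 + 2z) < m, and
  -- m² = 4 + 8z + 5z⁴ - 2z⁵ + z⁶ exceeds 4 (1 + 2z) since 0 < z ≤ 1.
  private
    z² = z * z
    z³ = z * z²
    z⁴ = z² * z²
    d  = (1# + 1#) + (z + z) + z³
    m  = d - z²

    0<z² : 0# < z²
    0<z² = *-pos 0<z 0<z

    0<z⁴ : 0# < z⁴
    0<z⁴ = *-pos 0<z² 0<z²

    z²≤d : z² ≤ d
    z²≤d = begin
      z²        ≤⟨ *-monoˡ-≤ (proj₁ 0<z) z≤1 ⟩
      z * 1#    ≈⟨ *-identityʳ z ⟩
      z         ≤⟨ x≤x+y (+-nonneg (+-nonneg 0≤1 0≤1) (+-nonneg (proj₁ 0<z) (proj₁ (*-pos 0<z 0<z²)))) ⟩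
      z + ((1# + 1#) + (z + z³))
        ≈⟨ solve 2 (λ z z³ → z :+ ((con 1 :+ con 1) :+ (z :+ z³)) := (con 1 :+ con 1) :+ (z :+ z) :+ z³) refl z z³ ⟩
      d         ∎

    m²-expansion : m * m + (z⁴ + z⁴) * z ≈ (s + s) * (s + s) + (z⁴ * (1# + 1# + 1# + 1# + 1#) + z³ * z³)
    -- The padding 4z² + 4z³ avoids subtraction: with 2z⁵ it makes 2z²d, and m² + 2z²d = d² + z⁴
    -- because m + z² = d.
    m²-expansion = +-cancelˡ-≈ (z² * (1# + 1# + 1# + 1#) + z³ * (1# + 1# + 1# + 1#)) (begin-equality
      z² * (1# + 1# + 1# + 1#) + z³ * (1# + 1# + 1# + 1#) + (m * m + (z⁴ + z⁴) * z)
        ≈⟨ solve 2 (λ m z → let z² = z :* z; z³ = z :* z²; z⁴ = z² :* z²; 4# = con 1 :+ con 1 :+ con 1 :+ con 1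
                                d = (con 1 :+ con 1) :+ (z :+ z) :+ z³ in
             z² :* 4# :+ z³ :* 4# :+ (m :* m :+ (z⁴ :+ z⁴) :* z) := m :* m :+ (z² :+ z²) :* d) refl m z ⟩
      m * m + (z² + z²) * d
        ≈⟨ +-congˡ (*-congˡ m+z²≈d) ⟨
      m * m + (z² + z²) * (m + z²)
        ≈⟨ solve 2 (λ m z² → m :* m :+ (z² :+ z²) :* (m :+ z²) := (m :+ z²) :* (m :+ z²) :+ z² :* z²) refl m z² ⟩
      (m + z²) * (m + z²) + z⁴
        ≈⟨ +-congʳ (*-cong m+z²≈d m+z²≈d) ⟩
      d * d + z⁴
        ≈⟨ solve 1 (λ z → let z² = z :* z; z³ = z :* z²; z⁴ = z² :* z²; 4# = con 1 :+ con 1 :+ con 1 :+ con 1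
                              d = (con 1 :+ con 1) :+ (z :+ z) :+ z³ in
             d :* d :+ z⁴ := z² :* 4# :+ z³ :* 4# :+ (4# :* (con 1 :+ (z :+ z)) :+ (z⁴ :* (4# :+ con 1) :+ z³ :* z³))) refl z ⟩
      _ + ((1# + 1# + 1# + 1#) * (1# + (z + z)) + (z⁴ * (1# + 1# + 1# + 1# + 1#) + z³ * z³))
        ≈⟨ +-congˡ (+-congʳ (*-congˡ (trans s²≈1+1/k (+-congˡ 1/k≈z+z)))) ⟨
      _ + ((1# + 1# + 1# + 1#) * (s * s) + (z⁴ * (1# + 1# + 1# + 1# + 1#) + z³ * z³))
        ≈⟨ +-congˡ (+-congʳ (solve 1 (λ s → (con 1 :+ con 1 :+ con 1 :+ con 1) :* (s :* s) := (s :+ s) :* (s :+ s)) refl s)) ⟩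
      _ ∎)
      where
      m+z²≈d : m + z² ≈ d
      m+z²≈d = x-y+y≈x d z²

    m≰2s : ¬ (m ≤ s + s)
    m≰2s m≤2s = <⇒≱ 0<z⁴ (+-cancelˡ-≤ (m * m + (z⁴ + z⁴)) (begin
      m * m + (z⁴ + z⁴) + z⁴
        ≤⟨ +-monoˡ-≤ z⁴ (+-monoˡ-≤ (z⁴ + z⁴) (≤-trans (*-monoˡ-≤ (x≤y⇒0≤y-x z²≤d) m≤2s) (*-monoʳ-≤ (+-nonneg 0≤s 0≤s) m≤2s))) ⟩
      (s + s) * (s + s) + (z⁴ + z⁴) + z⁴
        -- Of the term 5z⁴, two copies absorb 2z⁵, one gives the contradiction z⁴ ≤ 0, and the
        -- remainder is slack.
        ≤⟨ x≤x+y (+-nonneg (+-nonneg (proj₁ 0<z⁴) (proj₁ 0<z⁴)) (proj₁ (*-pos (*-pos 0<z 0<z²) (*-pos 0<z 0<z²)))) ⟩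
      (s + s) * (s + s) + (z⁴ + z⁴) + z⁴ + (z⁴ + z⁴ + z³ * z³)
        ≈⟨ solve 3 (λ a z⁴ b → a :+ (z⁴ :+ z⁴) :+ z⁴ :+ (z⁴ :+ z⁴ :+ b)
             := a :+ (z⁴ :* (con 1 :+ con 1 :+ con 1 :+ con 1 :+ con 1) :+ b)) refl ((s + s) * (s + s)) z⁴ (z³ * z³) ⟩
      (s + s) * (s + s) + (z⁴ * (1# + 1# + 1# + 1# + 1#) + z³ * z³)
        ≈⟨ m²-expansion ⟨
      m * m + (z⁴ + z⁴) * z
        ≤⟨ +-monoʳ-≤ (m * m) (*-monoˡ-≤ (+-nonneg (proj₁ 0<z⁴) (proj₁ 0<z⁴)) z≤1) ⟩
      m * m + (z⁴ + z⁴) * 1#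
        ≈⟨ trans (+-congˡ (*-identityʳ _)) (sym (+-identityʳ _)) ⟩
      m * m + (z⁴ + z⁴) + 0# ∎))

  bound-lower : 1/ (4 ℕ.* k ℕ.^ 2) - 1/ (8 ℕ.* k ℕ.^ 3) < bound
  bound-lower = ≰⇒> λ bound≤ → m≰2s (+-cancelˡ-≤ (bound + z²) (begin
    bound + z² + m            ≈⟨ solve 3 (λ b z² m → b :+ z² :+ m := b :+ (m :+ z²)) refl bound z² m ⟩
    bound + (m + z²)          ≈⟨ +-congˡ (x-y+y≈x d z²) ⟩
    bound + d                 ≤⟨ +-monoˡ-≤ d bound≤ ⟩
    (1/ (4 ℕ.* k ℕ.^ 2) - 1/ (8 ℕ.* k ℕ.^ 3)) + d ≈⟨ +-congʳ (+-cong 1/4k²≈z² (-‿cong 1/8k³≈z³)) ⟩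
    (z² - z³) + d
      ≈⟨ solve 4 (λ a b c e → (a :+ b) :+ (c :+ e) := a :+ ((b :+ e) :+ c)) refl z² (- z³) _ z³ ⟩
    z² + ((- z³ + z³) + ((1# + 1#) + (z + z)))
      ≈⟨ +-congˡ (trans (+-congʳ (-‿inverseˡ z³)) (+-identityˡ _)) ⟩
    z² + ((1# + 1#) + (z + z)) ≈⟨ +-congˡ (+-congˡ 1/k≈z+z) ⟨
    z² + ((1# + 1#) + 1/ k)   ≈⟨ +-congˡ bound+2s ⟨
    z² + (bound + (s + s))    ≈⟨ solve 3 (λ b z² m → z² :+ (b :+ m) := b :+ z² :+ m) refl bound z² (s + s) ⟩
    bound + z² + (s + s)      ∎))

  -- The ratio for growth systems.

  private
    M = fromℕ (k ℕ.+ 1)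
    y = 1/ (k ℕ.+ 1)

    1≤k+1 : 1 ℕ.≤ k ℕ.+ 1
    1≤k+1 = ℕ.m≤n+m 1 k

    0<M : 0# < M
    0<M = fromℕ-pos 1≤k+1

    M≈K+1 : M ≈ K + 1#
    M≈K+1 = trans (fromℕ-homo-+ k 1) (+-congˡ fromℕ-1)

    0≤y : 0# ≤ y
    0≤y = ⁻¹-nonneg 0<M

    My≈1 : M * y ≈ 1#
    My≈1 = ⁻¹-inverse M (<⇒≉0 0<M)

    y≤1 : y ≤ 1#
    y≤1 = begin
      y      ≈⟨ *-identityˡ y ⟨
      1# * y ≤⟨ *-monoʳ-≤ 0≤y (1≤fromℕ 1≤k+1) ⟩
      M * y  ≈⟨ My≈1 ⟩
      1#     ∎

  -- The derivative of (q/k)(1 - qk/p) in p vanishes where (k + 1)p² = k.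
  p : Carrier
  p = √ (1# - y)

  private
    q = 1# - p

    0≤p : 0# ≤ p
    0≤p = √-nonneg _ (x≤y⇒0≤y-x y≤1)

    p²≈1-y : p * p ≈ 1# - y
    p²≈1-y = √-square _ (x≤y⇒0≤y-x y≤1)

    p+q≈1 : p + q ≈ 1#
    p+q≈1 = y+[x-y]≈x 1# p

    [K+1]p²≈K : (K + 1#) * (p * p) ≈ K
    [K+1]p²≈K = +-cancelˡ-≈ 1# (begin-equality
      1# + (K + 1#) * (p * p)   ≈⟨ +-cong (sym My≈1) (*-congʳ (sym M≈K+1)) ⟩
      M * y + M * (p * p)       ≈⟨ distribˡ M y (p * p) ⟨
      M * (y + p * p)           ≈⟨ *-congˡ (trans (+-congˡ p²≈1-y) (y+[x-y]≈x 1# y)) ⟩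
      M * 1#                    ≈⟨ *-identityʳ M ⟩
      M                         ≈⟨ trans M≈K+1 (+-comm K 1#) ⟩
      1# + K                    ∎)

  0<p : 0# < p
  0<p = 0≤p , λ 0≈p → proj₂ 0<K (begin-equality
    0#                  ≈⟨ solve 1 (λ K → con 0 := (K :+ con 1) :* (con 0 :* con 0)) refl K ⟩
    (K + 1#) * (0# * 0#) ≈⟨ *-congˡ (*-cong 0≈p 0≈p) ⟩
    (K + 1#) * (p * p)  ≈⟨ [K+1]p²≈K ⟩
    K                   ∎)

  p≤1 : p ≤ 1#
  p≤1 = square-cancel-≤ 0≤1 (begin
    p * p        ≤⟨ x≤x+y 0≤y ⟩
    p * p + y    ≈⟨ trans (+-congʳ p²≈1-y) (x-y+y≈x 1# y) ⟩
    1#           ≈⟨ *-identityˡ 1# ⟨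
    1# * 1#      ∎)

  private
    0≤q : 0# ≤ q
    0≤q = x≤y⇒0≤y-x p≤1

    -- This is p² = K(1 - p²) with the right side factored; 1 + p is written `p + q + p` to stay
    -- free of subtraction.
    p²≈Kq[1+p] : p * p ≈ K * q * (p + q + p)
    p²≈Kq[1+p] = +-cancelˡ-≈ (K * (p * p)) (begin-equality
      K * (p * p) + p * p            ≈⟨ solve 2 (λ K a → K :* a :+ a := (K :+ con 1) :* a) refl K (p * p) ⟩
      (K + 1#) * (p * p)             ≈⟨ [K+1]p²≈K ⟩
      K                              ≈⟨ solve 1 (λ K → K := K :* (con 1 :* con 1)) refl K ⟩
      K * (1# * 1#)                  ≈⟨ *-congˡ (*-cong p+q≈1 p+q≈1) ⟨
      K * ((p + q) * (p + q))
        ≈⟨ solve 3 (λ K p q → K :* ((p :+ q) :* (p :+ q)) := K :* (p :* p) :+ K :* q :* (p :+ q :+ p)) refl K p q ⟩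
      K * (p * p) + K * q * (p + q + p) ∎)

    qK≤p : q * K ≤ p
    qK≤p = *-cancelˡ-≤ 0<p (begin
      p * (q * K)
        ≤⟨ x≤x+y (*-nonneg (*-nonneg (proj₁ 0<K) 0≤q) (+-nonneg 0≤p 0≤q)) ⟩
      p * (q * K) + K * q * (p + q)
        ≈⟨ solve 3 (λ K p q → p :* (q :* K) :+ K :* q :* (p :+ q) := K :* q :* (p :+ q :+ p)) refl K p q ⟩
      K * q * (p + q + p)                 ≈⟨ p²≈Kq[1+p] ⟨
      p * p                               ∎)

    -- The fraction t/p = 1 - qK/p of the relevant weight is what survives in the core.
    t = p - q * K

    t+qK≈p : t + q * K ≈ p
    t+qK≈p = x-y+y≈x p (q * K)

    [sp]²≈1 : s * p * (s * p) ≈ 1# * 1#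
    [sp]²≈1 = *-cancelˡ 0<K (begin-equality
      K * (s * p * (s * p))
        ≈⟨ solve 3 (λ K s p → K :* (s :* p :* (s :* p)) := K :* (s :* s) :* (p :* p)) refl K s p ⟩
      K * (s * s) * (p * p)            ≈⟨ *-congʳ (*-congˡ s²≈1+1/k) ⟩
      K * (1# + 1/ k) * (p * p)
        ≈⟨ *-congʳ (trans (distribˡ K 1# (1/ k)) (+-cong (*-identityʳ K) (⁻¹-inverse K (<⇒≉0 0<K)))) ⟩
      (K + 1#) * (p * p)               ≈⟨ [K+1]p²≈K ⟩
      K                                ≈⟨ solve 1 (λ K → K := K :* (con 1 :* con 1)) refl K ⟩
      K * (1# * 1#)                    ∎)

    sp≈1 : s * p ≈ 1#
    sp≈1 = antisym (square-cancel-≤ 0≤1 (≤-reflexive [sp]²≈1))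
                   (square-cancel-≤ (*-nonneg 0≤s 0≤p) (≤-reflexive (sym [sp]²≈1)))

    p≈tq+2Kq : p ≈ t * q + (K + K) * q
    p≈tq+2Kq = begin-equality
      p                                         ≈⟨ *-identityʳ p ⟨
      p * 1#                                    ≈⟨ *-congˡ p+q≈1 ⟨
      p * (p + q)                               ≈⟨ distribˡ p p q ⟩
      p * p + p * q                             ≈⟨ +-cong p²≈Kq[1+p] (*-congʳ (sym t+qK≈p)) ⟩
      K * q * (p + q + p) + (t + q * K) * q
        ≈⟨ solve 4 (λ K p q t → K :* q :* (p :+ q :+ p) :+ (t :+ q :* K) :* q := t :* q :+ (K :+ K) :* q :* (p :+ q)) refl K p q t ⟩
      t * q + (K + K) * q * (p + q)             ≈⟨ +-congˡ (trans (*-congˡ p+q≈1) (*-identityʳ _)) ⟩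
      t * q + (K + K) * q                       ∎

    -- With denominators cleared, `bound` is the product of the ratios q/K and t/p. Adding 2K, which
    -- equals 2Ksp because s is the inverse of p, removes the subtracted root.
    Kp*bound≈tq : K * p * bound ≈ t * q
    Kp*bound≈tq = +-cancelˡ-≈ (K + K) (begin-equality
      K + K + K * p * bound
        ≈⟨ +-congʳ (solve 1 (λ K → K :+ K := K :* (con 1 :+ con 1)) refl K) ⟩
      K * (1# + 1#) + K * p * bound     ≈⟨ +-congʳ (*-congˡ (+-cong sp≈1 sp≈1)) ⟨
      K * (s * p + s * p) + K * p * bound
        ≈⟨ solve 4 (λ K p s b → K :* (s :* p :+ s :* p) :+ K :* p :* b := K :* p :* (b :+ (s :+ s))) refl K p s bound ⟩
      K * p * (bound + (s + s))         ≈⟨ *-congˡ bound+2s ⟩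
      K * p * ((1# + 1#) + 1/ k)
        ≈⟨ solve 3 (λ K p x → K :* p :* ((con 1 :+ con 1) :+ x) := (K :+ K) :* p :+ K :* x :* p) refl K p (1/ k) ⟩
      (K + K) * p + K * 1/ k * p
        ≈⟨ +-congˡ (trans (*-congʳ (⁻¹-inverse K (<⇒≉0 0<K))) (*-identityˡ p)) ⟩
      (K + K) * p + p                   ≈⟨ +-congˡ p≈tq+2Kq ⟩
      (K + K) * p + (t * q + (K + K) * q)
        ≈⟨ solve 4 (λ L p q x → L :* p :+ (x :+ L :* q) := L :* (p :+ q) :+ x) refl (K + K) p q (t * q) ⟩
      (K + K) * (p + q) + t * q         ≈⟨ +-congʳ (trans (*-congˡ p+q≈1) (*-identityʳ _)) ⟩
      K + K + t * q                     ∎)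

  growth-ratio : ∀ {rel core opt} → p * rel ≤ p * core + (1# - p) * (K * rel) → (1# - p) * opt ≤ K * rel →
                 bound * opt ≤ core
  growth-ratio {rel} {core} {opt} core-bound rel-bound = *-cancelˡ-≤ (*-pos 0<K 0<p) (begin
    K * p * (bound * opt) ≈⟨ *-assoc (K * p) bound opt ⟨
    K * p * bound * opt   ≈⟨ *-congʳ Kp*bound≈tq ⟩
    t * q * opt           ≈⟨ *-assoc t q opt ⟩
    t * (q * opt)         ≤⟨ *-monoˡ-≤ (x≤y⇒0≤y-x qK≤p) rel-bound ⟩
    t * (K * rel)         ≈⟨ solve 3 (λ t K r → t :* (K :* r) := K :* (t :* r)) refl t K rel ⟩
    K * (t * rel)         ≤⟨ *-monoˡ-≤ (proj₁ 0<K) t*rel≤p*core ⟩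
    K * (p * core)        ≈⟨ *-assoc K p core ⟨
    K * p * core          ∎)
    where
    t*rel≤p*core : t * rel ≤ p * core
    t*rel≤p*core = +-cancelˡ-≤ (q * (K * rel)) (begin
      q * (K * rel) + t * rel
        ≈⟨ solve 4 (λ q K r t → q :* (K :* r) :+ t :* r := (t :+ q :* K) :* r) refl q K rel t ⟩
      (t + q * K) * rel          ≈⟨ *-congʳ t+qK≈p ⟩
      p * rel                    ≤⟨ core-bound ⟩
      p * core + q * (K * rel)   ≈⟨ +-comm _ _ ⟩
      q * (K * rel) + p * core   ∎)

  -- Here 1 - p′ = 1/(2k), the maximiser of (q/k)(1 - qk) in q, with value 1/(4k²).
  p′ : Carrier
  p′ = 1# - z

  z≤p′ : z ≤ p′
  z≤p′ = +-cancelˡ-≤ z (begin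
    z + z  ≤⟨ z+z≤1 ⟩
    1#     ≈⟨ y+[x-y]≈x 1# z ⟨
    z + p′ ∎)

  0<p′ : 0# < p′
  0<p′ = <-≤-trans 0<z z≤p′

  p′≤1 : p′ ≤ 1#
  p′≤1 = begin
    p′     ≤⟨ x≤x+y (proj₁ 0<z) ⟩
    p′ + z ≈⟨ x-y+y≈x 1# z ⟩
    1#     ∎

  1-p′≈z : 1# - p′ ≈ z
  1-p′≈z = trans (+-congʳ (sym (x-y+y≈x 1# z))) (x+y-x≈y p′ z)

  matroid-ratio : ∀ {rel core opt} → 1# * rel ≤ 1# * core + (1# - p′) * (K * rel) → (1# - p′) * opt ≤ K * rel →
                  1/ (4 ℕ.* k ℕ.^ 2) * opt ≤ core
  matroid-ratio {rel} {core} {opt} core-bound rel-bound = begin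
    1/ (4 ℕ.* k ℕ.^ 2) * opt   ≈⟨ trans (*-congʳ 1/4k²≈z²) (*-assoc z z opt) ⟩
    z * (z * opt)              ≈⟨ *-congˡ (*-congʳ 1-p′≈z) ⟨
    z * ((1# - p′) * opt)      ≤⟨ *-monoˡ-≤ (proj₁ 0<z) rel-bound ⟩
    z * (K * rel)              ≤⟨ *-monoˡ-≤ (proj₁ 0<z) (*-monoˡ-≤ (proj₁ 0<K) rel≤core+core) ⟩
    z * (K * (core + core))
      ≈⟨ solve 3 (λ z K c → z :* (K :* (c :+ c)) := (K :+ K) :* z :* c) refl z K core ⟩
    (K + K) * z * core         ≈⟨ trans (*-congʳ [K+K]z≈1) (*-identityˡ core) ⟩
    core                       ∎
    where
    rel≤core+zK*rel : rel ≤ core + z * (K * rel)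
    rel≤core+zK*rel = begin
      rel                                 ≈⟨ *-identityˡ rel ⟨
      1# * rel                            ≤⟨ core-bound ⟩
      1# * core + (1# - p′) * (K * rel)   ≈⟨ +-cong (*-identityˡ core) (*-congʳ 1-p′≈z) ⟩
      core + z * (K * rel)                ∎

    -- Since zK = 1/2, at most half of the relevant weight is lost; the inequality is added to
    -- itself in place of halving.
    rel≤core+core : rel ≤ core + core
    rel≤core+core = +-cancelˡ-≤ rel (begin
      rel + rel                                       ≤⟨ +-mono-≤ rel≤core+zK*rel rel≤core+zK*rel ⟩
      core + z * (K * rel) + (core + z * (K * rel))
        ≈⟨ solve 4 (λ z K r c → c :+ z :* (K :* r) :+ (c :+ z :* (K :* r)) := (K :+ K) :* z :* r :+ (c :+ c)) refl z K rel core ⟩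
      (K + K) * z * rel + (core + core)
        ≈⟨ +-congʳ (trans (*-congʳ [K+K]z≈1) (*-identityˡ rel)) ⟩
      rel + (core + core)                             ∎)

-- A lower bound on k.

module Covering {c ℓ₁ ℓ₂} {R : EuclideanField c ℓ₁ ℓ₂} (𝔾 : Setting R) where
  open Setting 𝔾
  open Analysis R 𝔾
  open IndependenceSystem

  NonZero⇒element : ∀ n → NonZero n → Fin n
  NonZero⇒element (suc n) _ = zero

  part≤total : ∀ {M} (𝓢 : Fin M → IndependenceSystem #E) k {e j} → e ∈ ground (𝓢 j) → k j ℕ.≤ total 𝓢 k e
  part≤total 𝓢 k {e} {j} e∈ = ℕ.≤-trans
    (ℕ.≤-reflexive (≡.cong (if_then k j else 0) (≡.sym (dec-true (e ∈? ground (𝓢 j)) e∈))))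
    (term≤foldr-+ (λ j → if does (e ∈? ground (𝓢 j)) then k j else 0) j)

  -- Any edge lies in some agent component and in some item component, each with constant at least
  -- 1. The existence of an edge rules out the default value 0 of the maximum.
  2≤maxTotal : NonZero #E → ∀ k ℓ → (∀ j → 1 ℕ.≤ k j) → (∀ j → 1 ℕ.≤ ℓ j) → 2 ℕ.≤ maxTotal k ℓ
  2≤maxTotal nonZero k ℓ 1≤k 1≤ℓ =
    let e = NonZero⇒element #E nonZero
        i , e∈A = agent-covered e
        j , e∈B = item-covered e
    in ℕ.≤-trans
         (ℕ.+-mono-≤ (ℕ.≤-trans (1≤k i) (part≤total 𝓘A k e∈A)) (ℕ.≤-trans (1≤ℓ j) (part≤total 𝓘B ℓ e∈B)))
         (term≤foldr-⊔ (λ e → total 𝓘A k e ℕ.+ total 𝓘B ℓ e) e)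

theorem6 : ∀ {c ℓ₁ ℓ₂} (R : EuclideanField c ℓ₁ ℓ₂) (G : Setting R) →
    let open EuclideanField R
        open Weighted R
        open Setting G
    in
    NonZero #E →
    (∀ (k′ : Fin M-A → ℕ) (ℓ′ : Fin M-B → ℕ) →
      (∀ j → IsGrowthSystem (𝓘A j) (k′ j)) →
      (∀ j → IsGrowthSystem (𝓘B j) (ℓ′ j)) →
      let k = maxTotal k′ ℓ′
          p = √ (1# - 1/ (k ℕ.+ 1))
          bound = fromℕ 2 + 1/ k - fromℕ 2 * √ (1# + 1/ k)
      in
      (∀ O → IsOPT O → bound * weight w O ≤ expectedCoreWeight p)
      × (1/ (4 ℕ.* k ℕ.^ 2) - 1/ (8 ℕ.* k ℕ.^ 3) < bound))
    ×
    ((∀ j → IsMatroid (𝓘A j)) →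
      (∀ j → IsMatroid (𝓘B j)) →
      let k = maxTotal (const 1) (const 1) in
      ∀ O → IsOPT O →
      (k ≡ 1 → weight w O ≤ expectedCoreWeight 0#)
      × (2 ℕ.≤ k → 1/ (4 ℕ.* k ℕ.^ 2) * weight w O ≤ expectedCoreWeight (1# - 1/ (2 ℕ.* k))))
theorem6 R G nonZero = growth-part , matroid-part
  where
  open EuclideanField R
  open Weighted R
  open OrderedField R
  open Setting G
  open Analysis R G
  open Covering G

  growth-part : ∀ k′ ℓ′ → (∀ j → IsGrowthSystem (𝓘A j) (k′ j)) → (∀ j → IsGrowthSystem (𝓘B j) (ℓ′ j)) → _
  growth-part k′ ℓ′ growthA growthB =
    (λ O (indO , _) → growth-ratio
      (core-bound p 0<p p≤1 (proj₁ 0<p)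
        (λ j → E-lost-growth (𝓘A j) (λ Y → H-component-A Y j) {k′ j} (boundedA j))
        (λ j → E-lost-growth (𝓘B j) (λ Y → H-component-B Y j) {ℓ′ j} (boundedB j)))
      (E-Rel-bound p 0<p p≤1 {O} indO 1≤k)) , bound-lower
    where
    boundedA : ∀ j → HullBounded (𝓘A j) (k′ j)
    boundedA j = growth⇒hullBounded (𝓘A j) (growthA j)
    boundedB : ∀ j → HullBounded (𝓘B j) (ℓ′ j)
    boundedB j = growth⇒hullBounded (𝓘B j) (growthB j)
    1≤k = ℕ.<⇒≤ (2≤maxTotal nonZero k′ ℓ′ (IsGrowthSystem.positive ∘ growthA) (IsGrowthSystem.positive ∘ growthB))
    open Numerics R 1≤k using (p; 0<p; p≤1; growth-ratio; bound-lower)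
    open Combined R G k′ ℓ′ boundedA boundedB
    open Random p (proj₁ 0<p) p≤1

  matroid-part : (∀ j → IsMatroid (𝓘A j)) → (∀ j → IsMatroid (𝓘B j)) → ∀ O → IsOPT O → _
  matroid-part matroidA matroidB O (indO , _) =
    -- The covers on both sides force k ≥ 2, so `k ≡ 1` is contradictory.
    (λ k≡1 → ⊥-elim (ℕ.<-irrefl (≡.sym k≡1) 2≤k)) ,
    λ _ → matroid-ratio
      (core-bound p′ 0<p′ p′≤1 0≤1
        (λ j → unit (E-lost-matroid (𝓘A j) (λ Y → H-component-A Y j) (matroidA j)))
        (λ j → unit (E-lost-matroid (𝓘B j) (λ Y → H-component-B Y j) (matroidB j))))
      (E-Rel-bound p′ 0<p′ p′≤1 {O} indO (ℕ.<⇒≤ 2≤k))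
    where
    2≤k = 2≤maxTotal nonZero (const 1) (const 1) (λ _ → ℕ.≤-refl) (λ _ → ℕ.≤-refl)
    open Numerics R (ℕ.<⇒≤ 2≤k) using (p′; 0<p′; p′≤1; matroid-ratio)
    open Combined R G (const 1) (const 1)
      (λ j → matroid⇒hullBounded (𝓘A j) (matroidA j)) (λ j → matroid⇒hullBounded (𝓘B j) (matroidB j))
    open Random p′ (proj₁ 0<p′) p′≤1

    unit : ∀ {x y} → x ≤ q * y → 1# * x ≤ q * (fromℕ 1 * y)
    unit {x} {y} x≤qy = begin
      1# * x            ≈⟨ *-identityˡ x ⟩
      x                 ≤⟨ x≤qy ⟩
      q * y             ≈⟨ *-congˡ (trans (*-congʳ (+-identityʳ 1#)) (*-identityˡ y)) ⟨
      q * (fromℕ 1 * y) ∎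
      where open ≤-Reasoning
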